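{- Let $n\ge1$ and $w\in S_n$. Then: (1) $\displaystyle\mathfrak G^{(1)}_w=x_1^{n-1}x_2^{n-2}\cdots x_{n-1}\sum_{p\in\mathsf{paths}_{\overline{\mathcal G}_n}(w,w_0)}\frac{1}{\mathtt{wt}(p)}$; (2) $\displaystyle\mathfrak S_w=x_1^{n-1}x_2^{n-2}\cdots x_{n-1}\sum_{p\in\mathsf{paths}_{\mathcal G_n}(w,w_0)}\frac1{\mathtt{wt}(p)}$; (3) $\displaystyle\mathfrak G^{(1)}_w=\sum_{\substack{p\in\mathsf{paths}_{\mathcal R_n}(w,w_0)\\ p\text{ reduced}}}\mathfrak S_{w_0\cdot\delta(\mathsf{word}(p))}$; (4) $\displaystyle\mathfrak S_w=\sum_{p\in\mathsf{paths}_{\mathcal G_n}(w,w_0)}\mathfrak G_{w_0\cdot\delta(\mathsf{word}(p))}$.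
   Context: $S_n$ symmetric group, $s_i=(i\ i+1)$, $t_{a,b}=(a\ b)$, $w_0=n\,n-1\cdots1$; permutations in $S_n$ are also viewed as permutations of $\mathbb Z_{>0}$ fixing all $i>n$, and Bruhat order is used throughout. $N_i(f)=(f-s_i\cdot f)/(x_i-x_{i+1})$. Schubert: $\mathfrak S_{w_0}=x_1^{n-1}\cdots x_{n-1}$, $\mathfrak S_{ws_i}=N_i(\mathfrak S_w)$ if $w(i)>w(i+1)$. Grothendieck with parameter $\beta$: $\mathfrak G^{(\beta)}_{w_0}=x_1^{n-1}\cdots x_{n-1}$, $\mathfrak G^{(\beta)}_{ws_i}=N_i((1+\beta x_{i+1})\mathfrak G^{(\beta)}_w)$ if $w(i)>w(i+1)$; $\mathfrak G_w=\mathfrak G^{(-1)}_w$. Demazure product of a word: $\delta(\emptyset)=\mathrm{id}$, $\delta(a_1,\dots,a_k)=\delta(a_1,\dots,a_{k-1})*\tau_{a_k}$, $v*\tau_m=vs_m$ if $\ell(vs_m)>\ell(v)$, else $v$. Rothe diagram: $D(w)=\{(i,j):j<w(i),\ i<w^{ -1}(j)\}$. For a partition $\lambda$ (possibly empty) the Young diagram is $\mathbb Y_\lambda=\{(i,j):1\le j\le\lambda_i\}$; $\mathrm{dom}(w)$ is the largest Young diagram contained in $D(w)$. An addable cell of $\mathbb Y_\lambda$ is $(i,j)\notin\mathbb Y_\lambda$ with $(i-1,j)\in\mathbb Y_\lambda$ if $i>1$ and $(i,j-1)\in\mathbb Y_\lambda$ if $j>1$. For $w\ne w_0$, $\alpha(w)$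 is the smallest column $j$ such that $\mathrm{dom}(w)$ has an addable cell $(i,j)$ with $i+j\le n$. For $w$ and $i$, let $\phi_i(w)=\{a>i: w(a)>w(i),\text{ and there is no }a'\text{ with } i<a'<a,\ w(i)<w(a')<w(a)\}$, $\Phi_i(w)=\{wt_{i,a}:a\in\phi_i(w)\}$, and $\overline\Phi_i(w)=\{wt_{i,i_k}t_{i,i_{k-1}}\cdots t_{i,i_1}:\emptyset\ne\{i_1<\cdots<i_k\}\subseteq\phi_i(w)\}$. Three directed edge-labeled graphs with vertex set $S_n$: for each $w\ne w_0$, let $j=\alpha(w)$ and $i=w^{ -1}(j)$. In $\mathcal G_n$ there is an edge $w\xrightarrow{(i,j)}u$ for each $u\in\Phi_i(w)$; in $\overline{\mathcal G}_n$ for each $u\in\overline\Phi_i(w)$; in $\mathcal R_n$ for each $u\in\overline\Phi_i(w)$ with $u\ge ws_i$. For a directed path $p: u_1\xrightarrow{(i_1,j_1)}u_2\xrightarrow{(i_2,j_2)}\cdots\xrightarrow{(i_{k-1},j_{k-1})}u_k$, set $\mathsf{word}(p)=(i_{k-1},i_{k-2},\dots,i_1)$ and $\mathtt{wt}(p)=\prod_{h=1}^{k-1}x_{i_h}$; $p$ is reduced if $\mathsf{word}(p)$ is a reduced word. $\mathsf{paths}_\heartsuit(u,v)$ is the set of directed paths in $\heartsuit$ from $u$ to $v$ (including the empty path when $u=v$). -}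

module Defs where

open import Data.Nat as ℕ using (ℕ; zero; suc; _∸_; _+_; _*_; _≤ᵇ_; _<ᵇ_; _≡ᵇ_)
open import Data.Integer as ℤ using (ℤ; +_)
open import Data.List using (List; []; _∷_; [_]; _++_; map; concatMap; length; reverse; foldr; foldl; applyUpTo; zipWith)
open import Data.List.Properties using (≡-dec)
open import Data.Bool using (Bool; true; false; if_then_else_; _∧_; _∨_; not)
open import Data.Maybe using (Maybe; just; nothing; maybe)
open import Data.Product using (_×_; _,_)
open import Relation.Nullary.Decidable using (⌊_⌋)
open import Relation.Binary.PropositionalEquality using (_≡_)

anyB : List Bool → Bool
anyB = foldr _∨_ false

allB : List Bool → Bool
allB = foldr _∧_ true

filterB : {A : Set} → (A → Bool) → List A → List A
filterB p [] = []
filterB p (x ∷ xs) = if p x then x ∷ filterB p xs else filterB p xs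

countB : List Bool → ℕ
countB [] = 0
countB (true ∷ bs) = suc (countB bs)
countB (false ∷ bs) = countB bs

range : ℕ → List ℕ
range m = applyUpTo suc m

-- Permutations in one-line notation: w ∈ S_n is the list [w(1), ..., w(n)],
-- viewed as a permutation of ℤ_{>0} fixing every i > n.

Perm : Set
Perm = List ℕ

nth : List ℕ → ℕ → Maybe ℕ
nth [] _ = nothing
nth (x ∷ xs) zero = just x
nth (x ∷ xs) (suc k) = nth xs k

-- w(i)  (1-based; fixes positions beyond the list)
app : Perm → ℕ → ℕ
app w i = maybe (λ x → x) i (nth w (i ∸ 1))

findPos : List ℕ → ℕ → ℕ → Maybe ℕ
findPos [] j k = nothing
findPos (x ∷ xs) j k = if x ≡ᵇ j then just k else findPos xs j (suc k)

appInv : Perm → ℕ → ℕ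
appInv w j = maybe (λ x → x) j (findPos w j 1)

eqPerm : Perm → Perm → Bool
eqPerm [] [] = true
eqPerm [] (_ ∷ _) = false
eqPerm (_ ∷ _) [] = false
eqPerm (x ∷ xs) (y ∷ ys) = (x ≡ᵇ y) ∧ eqPerm xs ys

mulT : Perm → ℕ → ℕ → Perm
mulT w a b = map (λ k → app w (if k ≡ᵇ a then b else if k ≡ᵇ b then a else k)) (range (length w))

mulS : Perm → ℕ → Perm
mulS w i = mulT w i (suc i)

mulPerm : Perm → Perm → Perm
mulPerm u v = map (λ k → app u (app v k)) (range (length v))

idPerm : ℕ → Perm
idPerm n = range n

w0 : ℕ → Perm
w0 n = reverse (range n)

ell : Perm → ℕ
ell w = countB (concatMap (λ a → map (λ b → (a <ᵇ b) ∧ (app w b <ᵇ app w a)) (range m)) (range m))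
  where m = length w

-- Bruhat order: u ≤ v iff v is reached from u by a chain of right
-- multiplications by transpositions each strictly increasing length.
-- (Fuel: each step raises the length, which is < fuel = n*n+1.)
bruhatLeF : ℕ → Perm → Perm → Bool
bruhatLeF zero u v = eqPerm u v
bruhatLeF (suc f) u v =
  eqPerm u v ∨
  anyB (concatMap (λ a → map (λ b →
           (a <ᵇ b) ∧ (ell u <ᵇ ell (mulT u a b)) ∧ bruhatLeF f (mulT u a b) v)
         (range m)) (range m))
  where m = length u

bruhatLe : Perm → Perm → Bool
bruhatLe u v = bruhatLeF (length u * length u + 1) u v

dem : ℕ → List ℕ → Perm
dem n word = foldl (λ v m → if ell v <ᵇ ell (mulS v m) then mulS v m else v) (idPerm n) word

isReduced : ℕ → List ℕ → Bool
isReduced n word = ell (foldl mulS (idPerm n) word) ≡ᵇ length word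

inD : Perm → ℕ → ℕ → Bool
inD w i j = (j <ᵇ app w i) ∧ (i <ᵇ appInv w j)

-- (i,j) ∈ dom(w): the largest Young diagram contained in D(w) consists of
-- exactly those cells (i,j) whose rectangle [1..i]×[1..j] lies in D(w).
inDom : Perm → ℕ → ℕ → Bool
inDom w i j = allB (concatMap (λ i' → map (λ j' → inD w i' j') (range j)) (range i))

addable : Perm → ℕ → ℕ → Bool
addable w i j = not (inDom w i j)
              ∧ ((i ≡ᵇ 1) ∨ inDom w (i ∸ 1) j)
              ∧ ((j ≡ᵇ 1) ∨ inDom w i (j ∸ 1))

firstB : (ℕ → Bool) → List ℕ → Maybe ℕ
firstB p [] = nothing
firstB p (x ∷ xs) = if p x then just x else firstB p xs

alpha : ℕ → Perm → Maybe ℕ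
alpha n w = firstB (λ j → anyB (map (λ i → addable w i j ∧ (i + j ≤ᵇ n)) (range n))) (range n)

-- φ_i(w), Φ_i(w), Φ̄_i(w)   (restricted to positions ≤ n, i.e. to the vertex set S_n)

phi : ℕ → Perm → ℕ → List ℕ
phi n w i = filterB (λ a → (i <ᵇ a) ∧ (app w i <ᵇ app w a) ∧
                   not (anyB (map (λ a' → (i <ᵇ a') ∧ (a' <ᵇ a) ∧
                                         (app w i <ᵇ app w a') ∧ (app w a' <ᵇ app w a))
                                  (range n))))
                (range n)

subsets : List ℕ → List (List ℕ)
subsets [] = [ [] ]
subsets (x ∷ xs) = map (x ∷_) (subsets xs) ++ subsets xs

neSubsets : List ℕ → List (List ℕ)
neSubsets [] = []
neSubsets (x ∷ xs) = map (x ∷_) (subsets xs) ++ neSubsets xs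

Phi : ℕ → Perm → ℕ → List Perm
Phi n w i = map (mulT w i) (phi n w i)

PhiBar : ℕ → Perm → ℕ → List Perm
PhiBar n w i = map (λ S → foldl (λ v a → mulT v i a) w (reverse S)) (neSubsets (phi n w i))

data Graph : Set where
  𝒢 𝒢bar ℛ : Graph

targets : Graph → ℕ → Perm → ℕ → List Perm
targets 𝒢 n w i = Phi n w i
targets 𝒢bar n w i = PhiBar n w i
targets ℛ n w i = filterB (λ u → bruhatLe (mulS w i) u) (PhiBar n w i)

edges : Graph → ℕ → Perm → List (ℕ × Perm)
edges g n w =
  if eqPerm w (w0 n) then []
  else maybe (λ j → let i = appInv w j in map (λ u → (i , u)) (targets g n w i)) [] (alpha n w)

-- directed paths from u to w₀, each recorded by its sequence of row labels
-- (i₁, …, i_{k-1}) in path order; one list entry per path.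
-- (Fuel: every edge strictly increases length, so n*n+1 suffices.)
pathsF : Graph → ℕ → ℕ → Perm → List (List ℕ)
pathsF g n zero u = if eqPerm u (w0 n) then [ [] ] else []
pathsF g n (suc f) u =
  (if eqPerm u (w0 n) then [ [] ] else [])
  ++ concatMap (λ e → let (i , v) = e in map (i ∷_) (pathsF g n f v)) (edges g n u)

paths : Graph → ℕ → Perm → List (List ℕ)
paths g n u = pathsF g n (n * n + 1) u

word : List ℕ → List ℕ
word p = reverse p

-- Laurent polynomials in x₁,…,x_n over ℤ: finite formal sums of terms
-- c · x^e with e ∈ ℤⁿ (a list of length n); equality = equal coefficients.

Mono : Set
Mono = List ℤ

Poly : Set
Poly = List (ℤ × Mono)

eqMono : Mono → Mono → Bool
eqMono m e = ⌊ ≡-dec ℤ._≟_ m e ⌋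

coeff : Poly → Mono → ℤ
coeff [] e = + 0
coeff ((c , m) ∷ p) e = if eqMono m e then c ℤ.+ coeff p e else coeff p e

infix 4 _≈P_
_≈P_ : Poly → Poly → Set
p ≈P q = (e : Mono) → coeff p e ≡ coeff q e

polyMul : Poly → Poly → Poly
polyMul p q = concatMap (λ s → let (c , m) = s in
                 map (λ t → let (d , m') = t in (c ℤ.* d , zipWith ℤ._+_ m m')) q) p

zeroMono : ℕ → Mono
zeroMono n = applyUpTo (λ _ → + 0) n

varMono : ℕ → ℕ → Mono
varMono n i = map (λ k → if k ≡ᵇ i then + 1 else + 0) (range n)

getE : Mono → ℕ → ℤ
getE [] _ = + 0
getE (x ∷ xs) zero = x
getE (x ∷ xs) (suc k) = getE xs k

expAt : Mono → ℕ → ℤ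
expAt e i = getE e (i ∸ 1)

setAt : Mono → ℕ → ℤ → Mono
setAt e i v = zipWith (λ k x → if k ≡ᵇ i then v else x) (range (length e)) e

deltaPoly : ℕ → Poly
deltaPoly n = [ (+ 1 , map +_ (reverse (applyUpTo (λ k → k) n))) ]

-- divided difference N_i on a term c·x^e, writing a = e_i, b = e_{i+1}:
-- (x_i^a x_{i+1}^b − x_i^b x_{i+1}^a)/(x_i − x_{i+1})
--   = Σ_{k=0}^{a-b-1} x_i^{a-1-k} x_{i+1}^{b+k}            if a > b,
--   = 0                                                    if a = b,
--   = −Σ_{k=0}^{b-a-1} x_i^{b-1-k} x_{i+1}^{a+k}           if a < b.
NiTerm : ℕ → ℤ × Mono → Poly
NiTerm i (c , e) =
  if ⌊ b ℤ.<? a ⌋ then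
    map (λ k → (c , setAt (setAt e i (a ℤ.- + 1 ℤ.- + k)) (suc i) (b ℤ.+ + k))) (applyUpTo (λ k → k) ℤ.∣ a ℤ.- b ∣)
  else if ⌊ a ℤ.<? b ⌋ then
    map (λ k → (ℤ.- c , setAt (setAt e i (b ℤ.- + 1 ℤ.- + k)) (suc i) (a ℤ.+ + k))) (applyUpTo (λ k → k) ℤ.∣ b ℤ.- a ∣)
  else []
  where
    a = expAt e i
    b = expAt e (suc i)

N : ℕ → Poly → Poly
N i p = concatMap (NiTerm i) p

mulLin : ℕ → ℤ → ℕ → Poly → Poly
mulLin n β i p = p ++ polyMul [ (β , varMono n i) ] p

-- Schubert and β-Grothendieck polynomials, via the recursions
-- 𝔖_{ws_i} = N_i 𝔖_w, 𝔊_{ws_i} = N_i((1+βx_{i+1})𝔊_w) for w(i) > w(i+1),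
-- starting at w₀.  For v ≠ w₀ we use the first ascent i of v (v(i) < v(i+1)),
-- so that w = v s_i has w(i) > w(i+1) and w s_i = v.

firstAscent : ℕ → Perm → Maybe ℕ
firstAscent n v = firstB (λ i → app v i <ᵇ app v (suc i)) (range (n ∸ 1))

schubF : ℕ → ℕ → Perm → Poly
schubF n zero v = []
schubF n (suc f) v = maybe (λ i → N i (schubF n f (mulS v i))) (deltaPoly n) (firstAscent n v)

schub : ℕ → Perm → Poly
schub n v = schubF n (n * n + 1) v

grothF : ℕ → ℤ → ℕ → Perm → Poly
grothF n β zero v = []
grothF n β (suc f) v =
  maybe (λ i → N i (mulLin n β (suc i) (grothF n β f (mulS v i)))) (deltaPoly n) (firstAscent n v)

groth : ℕ → ℤ → Perm → Poly
groth n β v = grothF n β (n * n + 1) v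

invWt : ℕ → List ℕ → Poly
invWt n p = [ (+ 1 , foldr (λ i e → zipWith ℤ._-_ e (varMono n i)) (zeroMono n) p) ]

sumInvWt : ℕ → List (List ℕ) → Poly
sumInvWt n ps = concatMap (invWt n) ps

{-# OPTIONS --safe #-}
-- Let w ≠ w₀, j = α(w) and i = w⁻¹(j). All values of w in positions ≤ n + 1 − j other than i exceed j, and Lascoux's
-- transition formula x_i 𝔊_w = Σ_{u ∈ Φ̄_i(w)} β^{ℓ(u) − ℓ(w) − 1} 𝔊_u has no further terms. It is proved by induction on the row i
-- of the dot: with w' = w s_i one has 𝔊_w = π_i 𝔊_{w'}, where π_i = N_i (1 + β x_{i+1}), hence
-- x_i 𝔊_w = 𝔊_{w'} + (π_i + β)(x_{i+1} 𝔊_{w'}), and the transition formula for (w', i+1) applies. When the dot of w' reaches the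
-- antidiagonal, x_{i+1} 𝔊_{w'} is symmetric in x_i, x_{i+1}, since transitions in the later columns only involve x_k with k < i.
-- Dividing by x_i and iterating gives (1) and (2). Since w(i) < w(i+1), applying N_i (resp. N_i (1 − x_{i+1})) to x_i 𝔊_w gives
-- 𝔊_w = Σ N_i 𝔊_u and 𝔖_w = Σ π_i 𝔖_u, while v ↦ 𝔖_{w₀v} and v ↦ 𝔊_{w₀v} turn these operators into right multiplication by s_i
-- in the nil-Hecke and 0-Hecke monoids; iterating gives (3) and (4). In (3) the edges dropped from 𝒢bar to ℛ have u(i) < u(i+1),
-- so that N_i 𝔊_u = 0.
module Submission where

open import Defs
open import Data.Nat using (ℕ; zero; suc; pred; _+_; _*_; _∸_; _≤_; _<_; _<ᵇ_; _≤ᵇ_; _≡ᵇ_; z≤n; s≤s; s≤s⁻¹)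
open import Data.Nat.Properties
open import Data.Nat.Tactic.RingSolver using () renaming (solve-∀ to ℕ-solve-∀)
open import Data.Integer as ℤ using (ℤ; +_; -_; -[1+_])
import Data.Integer.Properties as ℤ
import Algebra.Properties.AbelianGroup ℤ.+-0-abelianGroup as ℤGroup
open import Data.Integer.Tactic.RingSolver using (solve-∀)
open import Data.Bool using (Bool; true; false; if_then_else_; _∧_; _∨_; not; T)
open import Data.Bool.Properties using (∧-zeroʳ)
open import Data.Unit using (⊤; tt)
open import Data.List using (List; []; _∷_; [_]; _++_; map; concatMap; length; reverse; foldr; foldl; applyUpTo; applyDownFrom; zipWith; _∷ʳ_)
open import Data.List.Properties using (map-applyUpTo; length-applyUpTo; applyUpTo-∷ʳ; length-map; map-++; reverse-applyUpTo; ++-identityʳ; map-cong-local; concatMap-++; map-∘; ≡-dec; reverse-foldr; reverse-involutive; length-reverse; unfold-reverse; foldl-∷ʳ)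
open import Data.List.Relation.Unary.All as All using (All; []; _∷_)
import Data.List.Relation.Unary.All.Properties as All
open import Data.List.Relation.Unary.AllPairs using (AllPairs; []; _∷_)
import Data.List.Relation.Unary.AllPairs.Properties as AllPairsProperties
open import Data.List.Relation.Unary.Unique.Propositional using (Unique)
import Data.List.Relation.Unary.Unique.Propositional.Properties as Unique
open import Data.List.Membership.Propositional using (_∈_)
open import Data.List.Relation.Unary.Any using (here; there)
open import Data.List.Relation.Binary.Permutation.Propositional using (_↭_; ↭-sym; ↭⇒↭ₛ)
open import Data.List.Relation.Binary.Permutation.Propositional.Properties using (∈-resp-↭; ↭-length)
import Data.List.Relation.Binary.Permutation.Setoid.Properties as PermutationSetoid
open import Data.Maybe using (Maybe; just; nothing; maybe)
open import Data.Product using (_×_; _,_; proj₁; proj₂; ∃) renaming (swap to ×-swap)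
open import Data.Sum using (_⊎_; inj₁; inj₂)
open import Function using (_∘_; id)
open import Relation.Nullary using (¬_; Dec; yes; no; contradiction)
open import Relation.Nullary.Decidable using (⌊_⌋)
open import Relation.Binary using (Setoid; Tri; tri<; tri≈; tri>)
open import Relation.Binary.PropositionalEquality using (_≡_; _≢_; refl; sym; trans; cong; cong₂; subst; subst₂; setoid; module ≡-Reasoning)

-- One-line notation

-- The polynomials are defined along the first ascent only, while the argument needs the recursion
-- at the ascent i given by the dot. So the operators π_i must satisfy the braid relations, and this
-- is the main obstacle. Computing π_i π_{i+1} π_i on monomials is avoided: each operator involved
-- obeys a twisted Leibniz rule, letting x_l pass (perhaps as another variable) at the cost of a
-- remainder. Two linear operators with the same rules and the same value at 1 coincide on all
-- Laurent polynomials.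
--
-- Laurent polynomials also make division by x_i an operator. Symmetry of f in x_i, x_{i+1} is
-- always expressed as ∂_i f = 0.
--
-- The parameter β stays an arbitrary integer up to the transition formula; 𝔖 is the case β = 0, and
-- the cases β = 1 and β = -1 give the two kinds of Grothendieck polynomials.
--
-- Lists of terms have no normal form, and equality means equal coefficients. The theory is
-- therefore developed over an interface, `LaurentAlgebra`, which the lists of terms instantiate
-- only at the end.

true≢false : ¬ (true ≡ false)
true≢false ()

<⇒<ᵇ≡ : ∀ {a b} → a < b → (a <ᵇ b) ≡ true
<⇒<ᵇ≡ {a} {b} p with a <ᵇ b | <⇒<ᵇ p
... | true | _ = refl

≮⇒<ᵇ≡ : ∀ {a b} → ¬ a < b → (a <ᵇ b) ≡ false
≮⇒<ᵇ≡ {a} {b} p with a <ᵇ b in eq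
... | false = refl
... | true = contradiction (<ᵇ⇒< a b (subst T (sym eq) tt)) p

<ᵇ≡⇒< : ∀ {a b} → (a <ᵇ b) ≡ true → a < b
<ᵇ≡⇒< {a} {b} eq = <ᵇ⇒< a b (subst T (sym eq) tt)

<ᵇ≡⇒≮ : ∀ {a b} → (a <ᵇ b) ≡ false → ¬ a < b
<ᵇ≡⇒≮ eq p = true≢false (trans (sym (<⇒<ᵇ≡ p)) eq)

<ᵇ-cong : ∀ {a b c d} → (a < b → c < d) → (c < d → a < b) → (a <ᵇ b) ≡ (c <ᵇ d)
<ᵇ-cong {a} {b} f g with a <ᵇ b in eq
... | true = sym (<⇒<ᵇ≡ (f (<ᵇ≡⇒< eq)))
... | false = sym (≮⇒<ᵇ≡ (λ q → <ᵇ≡⇒≮ eq (g q)))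

≡ᵇ-refl : ∀ k → (k ≡ᵇ k) ≡ true
≡ᵇ-refl zero = refl
≡ᵇ-refl (suc k) = ≡ᵇ-refl k

≢⇒≡ᵇ : ∀ {a b} → a ≢ b → (a ≡ᵇ b) ≡ false
≢⇒≡ᵇ {a} {b} p with a ≡ᵇ b in eq
... | false = refl
... | true = contradiction (≡ᵇ⇒≡ a b (subst T (sym eq) tt)) p

≡ᵇ≡⇒≡ : ∀ {a b} → (a ≡ᵇ b) ≡ true → a ≡ b
≡ᵇ≡⇒≡ {a} {b} eq = ≡ᵇ⇒≡ a b (subst T (sym eq) tt)

In : ℕ → ℕ → Set
In n k = 1 ≤ k × k ≤ n

All-range : ∀ {P : ℕ → Set} n → (∀ k → In n k → P k) → All P (range n)
All-range n h = All.applyUpTo⁺₁ suc n (λ {k} k<n → h (suc k) (s≤s z≤n , k<n))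

map-range-cong : ∀ {A : Set} {f g : ℕ → A} n → (∀ k → In n k → f k ≡ g k) → map f (range n) ≡ map g (range n)
map-range-cong n h = map-cong-local (All-range n h)

length-range : ∀ n → length (range n) ≡ n
length-range = length-applyUpTo suc

nth-applyUpTo : ∀ (f : ℕ → ℕ) n k → k < n → nth (applyUpTo f n) k ≡ just (f k)
nth-applyUpTo f (suc n) zero p = refl
nth-applyUpTo f (suc n) (suc k) (s≤s p) = nth-applyUpTo (f ∘ suc) n k p

getD : ℕ → Maybe ℕ → ℕ
getD d = maybe {B = λ _ → ℕ} (λ x → x) d

app-map : ∀ (f : ℕ → ℕ) {n k} → In n k → app (map f (range n)) k ≡ f k
app-map f {n} {suc k} (_ , k≤n) =
  cong (getD (suc k)) (trans (cong (λ l → nth l k) (map-applyUpTo suc f n)) (nth-applyUpTo (f ∘ suc) n k k≤n))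

app-range : ∀ {n k} → In n k → app (range n) k ≡ k
app-range {n} {suc k} (_ , k≤n) = cong (getD (suc k)) (nth-applyUpTo suc n k k≤n)

-- `app` defaults to the position itself, so the default shifts when the list loses its head; inside
-- the list the default is never reached.
getD-nth : ∀ (w : List ℕ) {k} d e → k < length w → getD d (nth w k) ≡ getD e (nth w k)
getD-nth (x ∷ w) {zero} d e p = refl
getD-nth (x ∷ w) {suc k} d e (s≤s p) = getD-nth w {k} d e p

tabulate-app : ∀ w → map (app w) (range (length w)) ≡ w
tabulate-app w = trans (map-applyUpTo suc (app w) (length w)) (lemma w (app w ∘ suc) (λ k k<n → refl))
  where
  lemma : ∀ (w : List ℕ) (f : ℕ → ℕ) → (∀ k → k < length w → f k ≡ getD (suc k) (nth w k)) →
    applyUpTo f (length w) ≡ w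
  lemma [] f h = refl
  lemma (x ∷ w) f h = cong₂ _∷_ (h 0 (s≤s z≤n)) (lemma w (f ∘ suc)
    (λ k k<n → trans (h (suc k) (s≤s k<n)) (getD-nth w (suc (suc k)) (suc k) k<n)))

app-ext : ∀ {n u v} → length u ≡ n → length v ≡ n → (∀ k → In n k → app u k ≡ app v k) → u ≡ v
app-ext {n} {u} {v} refl q h = begin
  u ≡⟨ sym (tabulate-app u) ⟩
  map (app u) (range n) ≡⟨ map-range-cong n h ⟩
  map (app v) (range n) ≡⟨ cong (λ m → map (app v) (range m)) (sym q) ⟩
  map (app v) (range (length v)) ≡⟨ tabulate-app v ⟩
  v ∎
  where open ≡-Reasoning

-- Surjectivity is carried along with injectivity in place of a pigeonhole argument: each
-- construction transports it directly, and `find-corner` uses it to locate the dot in a given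
-- column.
record IsPerm (n : ℕ) (w : Perm) : Set where
  field
    len : length w ≡ n
    bound : ∀ {k} → In n k → In n (app w k)
    inj : ∀ {k l} → In n k → In n l → app w k ≡ app w l → k ≡ l
    surj : ∀ {j} → In n j → ∃ λ k → In n k × app w k ≡ j
open IsPerm public

app-∈ : ∀ w {k} → In (length w) k → app w k ∈ w
app-∈ w {suc k} (_ , p) = go w k p
  where
  go : ∀ (w : List ℕ) k {d} → k < length w → getD d (nth w k) ∈ w
  go (x ∷ w) zero p = here refl
  go (x ∷ w) (suc k) (s≤s p) = there (go w k p)

∈-app : ∀ {w j} → j ∈ w → ∃ λ k → In (length w) k × app w k ≡ j
∈-app {w} m = let (k , p , q) = go w m in suc k , (s≤s z≤n , p) , cong (getD (suc k)) q
  where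
  go : ∀ (w : List ℕ) {j} → j ∈ w → ∃ λ k → k < length w × nth w k ≡ just j
  go (x ∷ w) (here refl) = 0 , s≤s z≤n , refl
  go (x ∷ w) (there m) = let (k , p , q) = go w m in suc k , s≤s p , q

∈-range⇒In : ∀ {n k} → k ∈ range n → In n k
∈-range⇒In {n} = All.lookup (All-range {In n} n (λ k p → p))

In⇒∈-range : ∀ {n k} → In n k → k ∈ range n
In⇒∈-range {n} {k} p = subst (_∈ range n) (app-range p) (app-∈ (range n) (subst (λ m → In m k) (sym (length-range n)) p))

-- Transpositions and length

unique-range : ∀ n → Unique (range n)
unique-range n = Unique.applyUpTo⁺₁ suc n (λ i<j _ eq → <⇒≢ i<j (suc-injective eq))

unique-app : ∀ {w k l} → Unique w → In (length w) k → In (length w) l → app w k ≡ app w l → k ≡ l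
unique-app {w} {suc k} {suc l} u (_ , p) (_ , q) eq = cong suc (go u p q eq)
  where
  nth-∈ : ∀ (w : List ℕ) {k d} → k < length w → getD d (nth w k) ∈ w
  nth-∈ (x ∷ w) {zero} p = here refl
  nth-∈ (x ∷ w) {suc k} (s≤s p) = there (nth-∈ w p)
  go : ∀ {w : List ℕ} {k l d e} → Unique w → k < length w → l < length w →
    getD d (nth w k) ≡ getD e (nth w l) → k ≡ l
  go {x ∷ w} {zero} {zero} u p q eq = refl
  go {x ∷ w} {zero} {suc l} (a ∷ u) p (s≤s q) eq = contradiction eq (All.lookup a (nth-∈ w q))
  go {x ∷ w} {suc k} {zero} (a ∷ u) (s≤s p) q eq = contradiction (sym eq) (All.lookup a (nth-∈ w p))
  go {x ∷ w} {suc k} {suc l} (a ∷ u) (s≤s p) (s≤s q) eq = cong suc (go u p q eq)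

↭-range⇒IsPerm : ∀ {n w} → w ↭ range n → IsPerm n w
↭-range⇒IsPerm {n} {w} p = record
  { len = len′
  ; bound = λ {k} i → ∈-range⇒In (∈-resp-↭ p (app-∈ w (to i)))
  ; inj = λ i j → unique-app u (to i) (to j)
  ; surj = λ i → let (k , q , e) = ∈-app (∈-resp-↭ (↭-sym p) (In⇒∈-range i)) in k , subst (λ m → In m k) len′ q , e
  }
  where
  len′ : length w ≡ n
  len′ = trans (↭-length p) (length-range n)
  to : ∀ {k} → In n k → In (length w) k
  to {k} = subst (λ m → In m k) (sym len′)
  u : Unique w
  u = PermutationSetoid.Unique-resp-↭ (setoid ℕ) (↭⇒↭ₛ (↭-sym p)) (unique-range n)

-- Definitionally the index function inside `mulT`, so `app-mulT` is a mere evaluation of `map` over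
-- `range`.
sw : ℕ → ℕ → ℕ → ℕ
sw a b k = if k ≡ᵇ a then b else if k ≡ᵇ b then a else k

sw-l : ∀ a b → sw a b a ≡ b
sw-l a b rewrite ≡ᵇ-refl a = refl

sw-r : ∀ a b → sw a b b ≡ a
sw-r a b with b ≡ᵇ a in eq
... | true = ≡ᵇ≡⇒≡ eq
... | false rewrite ≡ᵇ-refl b = refl

sw-o : ∀ {a b k} → k ≢ a → k ≢ b → sw a b k ≡ k
sw-o p q rewrite ≢⇒≡ᵇ p | ≢⇒≡ᵇ q = refl

data Swap (a b k : ℕ) : ℕ → Set where
  left : k ≡ a → Swap a b k b
  right : k ≡ b → Swap a b k a
  other : k ≢ a → k ≢ b → Swap a b k k

swap : ∀ a b k → Swap a b k (sw a b k)
swap a b k with k ≟ a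
... | yes refl = subst (Swap a b k) (sym (sw-l a b)) (left refl)
... | no k≢a with k ≟ b
...   | yes refl = subst (Swap a b k) (sym (sw-r a b)) (right refl)
...   | no k≢b = subst (Swap a b k) (sym (sw-o k≢a k≢b)) (other k≢a k≢b)

sw-invol : ∀ a b k → sw a b (sw a b k) ≡ k
sw-invol a b k with sw a b k | swap a b k
... | _ | left refl = sw-r a b
... | _ | right refl = sw-l a b
... | _ | other p q = sw-o p q

sw-In : ∀ {n a b k} → In n a → In n b → In n k → In n (sw a b k)
sw-In {n} {a} {b} {k} p q r with sw a b k | swap a b k
... | _ | left refl = q
... | _ | right refl = p
... | _ | other _ _ = r

length-mulT : ∀ w a b → length (mulT w a b) ≡ length w
length-mulT w a b = trans (length-map _ (range (length w))) (length-range (length w))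

app-mulT : ∀ {n} w a b {k} → length w ≡ n → In n k → app (mulT w a b) k ≡ app w (sw a b k)
app-mulT w a b refl = app-map (λ k → app w (sw a b k))

mulT-perm : ∀ {n w a b} → IsPerm n w → In n a → In n b → IsPerm n (mulT w a b)
mulT-perm {n} {w} {a} {b} W p q = record
  { len = trans (length-mulT w a b) (len W)
  ; bound = λ i → subst (In n) (sym (app-mulT w a b (len W) i)) (bound W (sw-In p q i))
  ; inj = λ {k} {l} i j eq → trans (sym (sw-invol a b k)) (trans (cong (sw a b)
      (inj W (sw-In p q i) (sw-In p q j) (trans (sym (app-mulT w a b (len W) i)) (trans eq (app-mulT w a b (len W) j)))))
      (sw-invol a b l))
  ; surj = λ i → let (k , r , e) = surj W i in sw a b k , sw-In p q r ,
      trans (app-mulT w a b (len W) (sw-In p q r)) (trans (cong (app w) (sw-invol a b k)) e)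
  }

mulT-app-l : ∀ {n w a b} → IsPerm n w → In n a → In n b → app (mulT w a b) a ≡ app w b
mulT-app-l {w = w} {a} {b} W p q = trans (app-mulT w a b (len W) p) (cong (app w) (sw-l a b))

mulT-app-r : ∀ {n w a b} → IsPerm n w → In n a → In n b → app (mulT w a b) b ≡ app w a
mulT-app-r {w = w} {a} {b} W p q = trans (app-mulT w a b (len W) q) (cong (app w) (sw-r a b))

mulT-app-o : ∀ {n w a b k} → IsPerm n w → In n k → k ≢ a → k ≢ b → app (mulT w a b) k ≡ app w k
mulT-app-o {w = w} {a} {b} W p q r = trans (app-mulT w a b (len W) p) (cong (app w) (sw-o q r))

mulT-invol : ∀ {n w a b} → IsPerm n w → In n a → In n b → mulT (mulT w a b) a b ≡ w
mulT-invol {n} {w} {a} {b} W p q = app-ext (len (mulT-perm (mulT-perm W p q) p q)) (len W) (λ k i →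
  trans (app-mulT (mulT w a b) a b (len (mulT-perm W p q)) i)
    (trans (app-mulT w a b (len W) (sw-In p q i)) (cong (app w) (sw-invol a b k))))

b2n : Bool → ℕ
b2n true = 1
b2n false = 0

countB-++ : ∀ xs ys → countB (xs ++ ys) ≡ countB xs + countB ys
countB-++ [] ys = refl
countB-++ (true ∷ xs) ys = cong suc (countB-++ xs ys)
countB-++ (false ∷ xs) ys = countB-++ xs ys

∑ : ℕ → (ℕ → ℕ) → ℕ
∑ zero f = 0
∑ (suc n) f = ∑ n f + f (suc n)

∑-cong : ∀ n {f g : ℕ → ℕ} → (∀ k → In n k → f k ≡ g k) → ∑ n f ≡ ∑ n g
∑-cong zero h = refl
∑-cong (suc n) h = cong₂ _+_ (∑-cong n (λ k (p , q) → h k (p , m≤n⇒m≤1+n q))) (h (suc n) (s≤s z≤n , ≤-refl))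

∑-+ : ∀ n (f g : ℕ → ℕ) → ∑ n (λ k → f k + g k) ≡ ∑ n f + ∑ n g
∑-+ zero f g = refl
∑-+ (suc n) f g = trans (cong (_+ (f (suc n) + g (suc n))) (∑-+ n f g)) (lemma (∑ n f) (∑ n g) (f (suc n)) (g (suc n)))
  where
  lemma : ∀ a b c d → a + b + (c + d) ≡ a + c + (b + d)
  lemma = ℕ-solve-∀

∑-swap : ∀ n k (f : ℕ → ℕ) → 1 ≤ k → suc k ≤ n → ∑ n (f ∘ sw k (suc k)) ≡ ∑ n f
∑-swap (suc n) k f p (s≤s q) with k ≟ n
... | no k≢n = cong₂ _+_ (∑-swap n k f p (≤∧≢⇒< q k≢n))
        (cong f (sw-o (λ e → <⇒≢ (s≤s q) (sym e)) (λ e → k≢n (sym (suc-injective e)))))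
∑-swap (suc (suc n)) _ f p (s≤s q) | yes refl = trans (cong₂ _+_ (cong₂ _+_ (∑-cong n
    (λ k (_ , r) → cong f (sw-o (<⇒≢ (s≤s r)) (<⇒≢ (s≤s (m≤n⇒m≤1+n r))))))
    (cong f (sw-l (suc n) (suc (suc n))))) (cong f (sw-r (suc n) (suc (suc n)))))
  (lemma (∑ n f) (f (suc n)) (f (suc (suc n))))
  where
  lemma : ∀ a b c → a + c + b ≡ a + b + c
  lemma = ℕ-solve-∀

∑-zero : ∀ n {f : ℕ → ℕ} → (∀ k → In n k → f k ≡ 0) → ∑ n f ≡ 0
∑-zero zero h = refl
∑-zero (suc n) h = cong₂ _+_ (∑-zero n (λ k (p , q) → h k (p , m≤n⇒m≤1+n q))) (h (suc n) (s≤s z≤n , ≤-refl))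

δ : ℕ → ℕ → ℕ
δ p k = b2n (p ≡ᵇ k)

∑-δ : ∀ n {k} c → In n k → ∑ n (λ q → c * δ q k) ≡ c
∑-δ zero c (s≤s _ , ())
∑-δ (suc n) {k} c (p , q) with k ≟ suc n
... | yes refl = cong₂ _+_ (∑-zero n (λ l (_ , r) → trans (cong (λ b → c * b2n b) (≢⇒≡ᵇ (<⇒≢ (s≤s r)))) (*-zeroʳ c)))
                   (trans (cong (λ b → c * b2n b) (≡ᵇ-refl (suc n))) (*-identityʳ c))
... | no k≢ = trans (cong₂ _+_ (∑-δ n c (p , s≤s⁻¹ (≤∧≢⇒< q k≢))) (trans (cong (λ b → c * b2n b) (≢⇒≡ᵇ (λ e → k≢ (sym e)))) (*-zeroʳ c))) (+-identityʳ c)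

countB-range : ∀ n (f : ℕ → Bool) → countB (map f (range n)) ≡ ∑ n (λ k → b2n (f k))
countB-range zero f = refl
countB-range (suc n) f = begin
  countB (map f (range (suc n))) ≡⟨ cong (countB ∘ map f) (sym (applyUpTo-∷ʳ suc n)) ⟩
  countB (map f (range n ∷ʳ suc n)) ≡⟨ cong countB (map-++ f (range n) [ suc n ]) ⟩
  countB (map f (range n) ++ [ f (suc n) ]) ≡⟨ countB-++ (map f (range n)) _ ⟩
  countB (map f (range n)) + countB [ f (suc n) ] ≡⟨ cong₂ _+_ (countB-range n f) (single (f (suc n))) ⟩
  ∑ n (λ k → b2n (f k)) + b2n (f (suc n)) ∎
  where
  open ≡-Reasoning
  single : ∀ b → countB [ b ] ≡ b2n b
  single true = refl
  single false = refl

countB-concatMap : ∀ n (g : ℕ → List Bool) → countB (concatMap g (range n)) ≡ ∑ n (λ k → countB (g k))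
countB-concatMap zero g = refl
countB-concatMap (suc n) g = begin
  countB (concatMap g (range (suc n))) ≡⟨ cong (countB ∘ concatMap g) (sym (applyUpTo-∷ʳ suc n)) ⟩
  countB (concatMap g (range n ∷ʳ suc n)) ≡⟨ cong countB (concatMap-++ g (range n) [ suc n ]) ⟩
  countB (concatMap g (range n) ++ g (suc n) ++ []) ≡⟨ countB-++ (concatMap g (range n)) _ ⟩
  countB (concatMap g (range n)) + countB (g (suc n) ++ []) ≡⟨ cong₂ _+_ (countB-concatMap n g) (cong countB (++-identityʳ (g (suc n)))) ⟩
  ∑ n (λ k → countB (g k)) + countB (g (suc n)) ∎
  where open ≡-Reasoning

ell-∑ : ∀ {n} w → length w ≡ n → ell w ≡ ∑ n (λ a → ∑ n (λ b → b2n ((a <ᵇ b) ∧ (app w b <ᵇ app w a))))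
ell-∑ {n} w refl = trans (countB-concatMap n _) (∑-cong n (λ a _ → countB-range n _))

module _ (v : ℕ → ℕ) (k : ℕ) (asc : v k < v (suc k)) where
  -- The swap of k and k + 1 reverses the relative order of these two positions only. As v ascends
  -- there, the one new inversion is the pair p = k + 1, q = k, which the product of deltas records.
  inv-swap : ∀ p q → b2n ((sw k (suc k) p <ᵇ sw k (suc k) q) ∧ (v q <ᵇ v p)) ≡ b2n ((p <ᵇ q) ∧ (v q <ᵇ v p)) + δ p (suc k) * δ q k
  inv-swap p q with p ≟ q
  ... | yes refl rewrite ≮⇒<ᵇ≡ (<-irrefl (refl {x = v p})) | ∧-zeroʳ (p <ᵇ p) | ∧-zeroʳ (sw k (suc k) p <ᵇ sw k (suc k) p) =
    sym (dd (p ≟ k))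
    where
    dd : Dec (p ≡ k) → δ p (suc k) * δ p k ≡ 0
    dd (yes refl) rewrite ≢⇒≡ᵇ (<⇒≢ (n<1+n k)) = refl
    dd (no ne) rewrite ≢⇒≡ᵇ ne = *-zeroʳ (δ p (suc k))
  ... | no p≢q with p ≟ suc k | q ≟ k
  ...   | yes refl | yes refl rewrite sw-l k (suc k) | sw-r k (suc k) | ≡ᵇ-refl k
            | <⇒<ᵇ≡ (n<1+n k) | <⇒<ᵇ≡ asc | ≮⇒<ᵇ≡ (<⇒≯ (n<1+n k)) = refl
  ...   | yes refl | no q≢k rewrite sw-r k (suc k) | sw-o q≢k (λ e → p≢q (sym e)) | ≢⇒≡ᵇ q≢k =
            trans (cong (λ b → b2n (b ∧ (v q <ᵇ v (suc k)))) (<ᵇ-cong {k} {q} {suc k} {q} (λ r → ≤∧≢⇒< r p≢q) (<-trans (n<1+n k))))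
                  (sym (trans (cong (λ x → b2n ((suc k <ᵇ q) ∧ (v q <ᵇ v (suc k))) + x) (*-zeroʳ (δ (suc k) (suc k)))) (+-identityʳ _)))
  ...   | no p≢sk | yes refl rewrite sw-l k (suc k) | sw-o p≢q p≢sk | ≢⇒≡ᵇ p≢sk =
            trans (cong (λ b → b2n (b ∧ (v k <ᵇ v p))) (<ᵇ-cong {p} {suc k} {p} {k} (λ r → ≤∧≢⇒< (s≤s⁻¹ r) p≢q) (λ r → m≤n⇒m≤1+n r)))
                  (sym (+-identityʳ _))
  ...   | no p≢sk | no q≢k = trans (rest (p ≟ k) (q ≟ suc k))
            (sym (trans (cong (λ b → b2n ((p <ᵇ q) ∧ (v q <ᵇ v p)) + b2n b * δ q k) (≢⇒≡ᵇ p≢sk)) (+-identityʳ _)))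
    where
    rest : Dec (p ≡ k) → Dec (q ≡ suc k) →
      b2n ((sw k (suc k) p <ᵇ sw k (suc k) q) ∧ (v q <ᵇ v p)) ≡ b2n ((p <ᵇ q) ∧ (v q <ᵇ v p))
    rest (yes refl) (yes refl) rewrite ≮⇒<ᵇ≡ (<⇒≯ asc) = cong b2n (trans (∧-zeroʳ _) (sym (∧-zeroʳ _)))
    rest (yes refl) (no q≢sk) rewrite sw-l k (suc k) | sw-o q≢k q≢sk =
      cong (λ b → b2n (b ∧ (v q <ᵇ v p))) (<ᵇ-cong {suc k} {q} {k} {q} (<-trans (n<1+n k)) (λ r → ≤∧≢⇒< r (λ e → q≢sk (sym e))))
    rest (no p≢k) (yes refl) rewrite sw-r k (suc k) | sw-o p≢k p≢sk =
      cong (λ b → b2n (b ∧ (v q <ᵇ v p))) (<ᵇ-cong {p} {k} {p} {suc k} m≤n⇒m≤1+n (λ r → ≤∧≢⇒< (s≤s⁻¹ r) p≢k))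
    rest (no p≢k) (no q≢sk) rewrite sw-o p≢k p≢sk | sw-o q≢k q≢sk = refl

Adj : ℕ → ℕ → Set
Adj n k = 1 ≤ k × suc k ≤ n

Adj-l : ∀ {n k} → Adj n k → In n k
Adj-l (p , q) = p , <⇒≤ q

Adj-r : ∀ {n k} → Adj n k → In n (suc k)
Adj-r (p , q) = s≤s z≤n , q

ell-asc : ∀ {n w k} → IsPerm n w → Adj n k → app w k < app w (suc k) → ell (mulS w k) ≡ suc (ell w)
ell-asc {n} {w} {k} W A asc = begin
  ell (mulS w k) ≡⟨ ell-∑ (mulS w k) (len (mulT-perm W (Adj-l A) (Adj-r A))) ⟩
  ∑ n (λ p → ∑ n (λ q → b2n ((p <ᵇ q) ∧ (app (mulS w k) q <ᵇ app (mulS w k) p))))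
    ≡⟨ ∑-cong n (λ p i → ∑-cong n (λ q j → cong₂ (λ x y → b2n ((p <ᵇ q) ∧ (x <ᵇ y)))
         (app-mulT w k (suc k) (len W) j) (app-mulT w k (suc k) (len W) i))) ⟩
  ∑ n (λ p → ∑ n (λ q → b2n ((p <ᵇ q) ∧ (app w (s q) <ᵇ app w (s p)))))
    -- Writing p as s (s p) turns the summand into a function of s p and s q; reindexing both sums
    -- by s then moves the swap from the values to the order test.
    ≡⟨ ∑-cong n (λ p i → ∑-cong n (λ q j → cong₂ (λ x y → b2n ((x <ᵇ y) ∧ (app w (s q) <ᵇ app w (s p))))
         (sym (sw-invol k (suc k) p)) (sym (sw-invol k (suc k) q)))) ⟩
  ∑ n (λ p → ∑ n (λ q → F (s p) (s q))) ≡⟨ ∑-cong n (λ p i → ∑-swap n k (F (s p)) (proj₁ A) (proj₂ A)) ⟩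
  ∑ n (λ p → ∑ n (F (s p))) ≡⟨ ∑-swap n k (λ p → ∑ n (F p)) (proj₁ A) (proj₂ A) ⟩
  ∑ n (λ p → ∑ n (F p)) ≡⟨ ∑-cong n (λ p i → trans (∑-cong n (λ q j → inv-swap (app w) k asc p q)) (∑-+ n _ _)) ⟩
  ∑ n (λ p → ∑ n (λ q → b2n ((p <ᵇ q) ∧ (app w q <ᵇ app w p))) + ∑ n (λ q → δ p (suc k) * δ q k)) ≡⟨ ∑-+ n _ _ ⟩
  ∑ n (λ p → ∑ n (λ q → b2n ((p <ᵇ q) ∧ (app w q <ᵇ app w p)))) + ∑ n (λ p → ∑ n (λ q → δ p (suc k) * δ q k))
    ≡⟨ cong₂ _+_ (sym (ell-∑ w (len W))) (trans (∑-cong n (λ p i → trans (∑-δ n (δ p (suc k)) (Adj-l A)) (sym (*-identityˡ _)))) (∑-δ n 1 (Adj-r A))) ⟩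
  ell w + 1 ≡⟨ +-comm (ell w) 1 ⟩
  suc (ell w) ∎
  where
  open ≡-Reasoning
  s = sw k (suc k)
  F : ℕ → ℕ → ℕ
  F p q = b2n ((s p <ᵇ s q) ∧ (app w q <ᵇ app w p))

mulS-perm : ∀ {n w k} → IsPerm n w → Adj n k → IsPerm n (mulS w k)
mulS-perm W A = mulT-perm W (Adj-l A) (Adj-r A)

mulS-invol : ∀ {n w k} → IsPerm n w → Adj n k → mulS (mulS w k) k ≡ w
mulS-invol W A = mulT-invol W (Adj-l A) (Adj-r A)

mulS-desc : ∀ {n w k} → IsPerm n w → Adj n k → app w (suc k) < app w k → app (mulS w k) k < app (mulS w k) (suc k)
mulS-desc W A d = subst₂ _<_ (sym (mulT-app-l W (Adj-l A) (Adj-r A))) (sym (mulT-app-r W (Adj-l A) (Adj-r A))) d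

ell-desc : ∀ {n w k} → IsPerm n w → Adj n k → app w (suc k) < app w k → ell w ≡ suc (ell (mulS w k))
ell-desc {w = w} W A d = trans (cong ell (sym (mulS-invol W A))) (ell-asc (mulS-perm W A) A (mulS-desc W A d))

∑-≤ : ∀ n c (f : ℕ → ℕ) → (∀ k → f k ≤ c) → ∑ n f ≤ n * c
∑-≤ zero c f h = z≤n
∑-≤ (suc n) c f h = ≤-trans (+-mono-≤ (∑-≤ n c f h) (h (suc n))) (≤-reflexive (+-comm (n * c) c))

ell-≤ : ∀ {n w} → IsPerm n w → ell w ≤ n * n
ell-≤ {n} {w} W = ≤-trans (≤-reflexive (ell-∑ w (len W))) (∑-≤ n n _ (λ a → ≤-trans (∑-≤ n 1 _ (λ b → b2n≤1 _)) (≤-reflexive (*-identityʳ n))))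
  where
  b2n≤1 : ∀ b → b2n b ≤ 1
  b2n≤1 true = ≤-refl
  b2n≤1 false = z≤n

asc-or-desc : ∀ {n w a b} → IsPerm n w → In n a → In n b → a ≢ b → app w a < app w b ⊎ app w b < app w a
asc-or-desc {w = w} {a} {b} W p q a≢b with <-cmp (app w a) (app w b)
... | tri< lt _ _ = inj₁ lt
... | tri≈ _ e _ = contradiction (inj W p q e) a≢b
... | tri> _ _ gt = inj₂ gt

sw-comm : ∀ a b k → sw a b k ≡ sw b a k
sw-comm a b k with sw a b k | swap a b k
... | _ | left refl = sym (sw-r b a)
... | _ | right refl = sym (sw-l b a)
... | _ | other p q = sym (sw-o q p)

sw-conj : ∀ {a c d} k → c ≢ d → a ≢ c → a ≢ d → sw c d (sw a c (sw c d k)) ≡ sw a d k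
sw-conj {a} {c} {d} k c≢d a≢c a≢d with sw c d k | swap c d k
... | _ | left refl = trans (cong (sw c d) (sw-o (a≢d ∘ sym) (c≢d ∘ sym))) (trans (sw-r c d) (sym (sw-o (a≢c ∘ sym) c≢d)))
... | _ | right refl = trans (cong (sw c d) (sw-r a c)) (trans (sw-o a≢c a≢d) (sym (sw-r a d)))
... | _ | other p q with k ≟ a
...   | yes refl = trans (cong (sw c d) (sw-l a c)) (trans (sw-l c d) (sym (sw-l a d)))
...   | no k≢a = trans (cong (sw c d) (sw-o k≢a p)) (trans (sw-o p q) (sym (sw-o k≢a q)))

mulT-conj : ∀ {n w a c d} → IsPerm n w → In n a → In n c → In n d → c ≢ d → a ≢ c → a ≢ d →
  mulT (mulT (mulT w c d) a c) c d ≡ mulT w a d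
mulT-conj {n} {w} {a} {c} {d} W p q r c≢d a≢c a≢d = app-ext (len V) (len (mulT-perm W p r)) λ k i → begin
  app (mulT (mulT (mulT w c d) a c) c d) k ≡⟨ app-mulT (mulT (mulT w c d) a c) c d (len (mulT-perm (mulT-perm W q r) p q)) i ⟩
  app (mulT (mulT w c d) a c) (sw c d k) ≡⟨ app-mulT (mulT w c d) a c (len (mulT-perm W q r)) (sw-In q r i) ⟩
  app (mulT w c d) (sw a c (sw c d k)) ≡⟨ app-mulT w c d (len W) (sw-In p q (sw-In q r i)) ⟩
  app w (sw c d (sw a c (sw c d k))) ≡⟨ cong (app w) (sw-conj k c≢d a≢c a≢d) ⟩
  app w (sw a d k) ≡⟨ sym (app-mulT w a d (len W) i) ⟩
  app (mulT w a d) k ∎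
  where
  open ≡-Reasoning
  V = mulT-perm (mulT-perm (mulT-perm W q r) p q) q r

mulT-comm : ∀ {n w a b} → IsPerm n w → In n a → In n b → mulT w a b ≡ mulT w b a
mulT-comm {n} {w} {a} {b} W p q = app-ext (len (mulT-perm W p q)) (len (mulT-perm W q p)) λ k i →
  trans (app-mulT w a b (len W) i) (trans (cong (app w) (sw-comm a b k)) (sym (app-mulT w b a (len W) i)))

ell-mulS-≥ : ∀ {n w k} → IsPerm n w → Adj n k → ell w ≤ suc (ell (mulS w k))
ell-mulS-≥ W A with asc-or-desc W (Adj-l A) (Adj-r A) (<⇒≢ (n<1+n _))
... | inj₁ asc = ≤-trans (n≤1+n _) (≤-trans (≤-reflexive (sym (ell-asc W A asc))) (n≤1+n _))
... | inj₂ desc = ≤-reflexive (ell-desc W A desc)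

-- Induction on b - a through t_{a,c+1} = s_c t_{a,c} s_c. If the first s_c lengthens w, the last
-- one may at worst undo that gain. If it shortens w, then w(a) < w(c+1) < w(c), and this makes the
-- last s_c lengthen again.
ell-mulT : ∀ {n w a b} → IsPerm n w → In n a → In n b → a < b → app w a < app w b → ell w < ell (mulT w a b)
ell-mulT {n} {w} {a} {suc c} W p q (s≤s a≤c) asc with a ≟ c
... | yes refl = ≤-reflexive (sym (ell-asc W (proj₁ p , proj₂ q) asc))
... | no a≢c = subst (λ u → ell w < ell u) (mulT-conj W p (Adj-l A) q (<⇒≢ (n<1+n c)) a≢c (<⇒≢ (s≤s a≤c)))
                 (cases (<-≤-connex (app w c) (app w (suc c))))
  where
  open ≤-Reasoning
  a<c : a < c
  a<c = ≤∧≢⇒< a≤c a≢c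
  A : Adj n c
  A = ≤-trans (proj₁ p) a≤c , proj₂ q
  v = mulS w c
  V : IsPerm n v
  V = mulS-perm W A
  y = mulT v a c
  Y : IsPerm n y
  Y = mulT-perm V p (Adj-l A)
  v-a : app v a ≡ app w a
  v-a = mulT-app-o W p a≢c (<⇒≢ (s≤s a≤c))
  v-c : app v c ≡ app w (suc c)
  v-c = mulT-app-l W (Adj-l A) (Adj-r A)
  y-c : app y c ≡ app w a
  y-c = trans (mulT-app-r V p (Adj-l A)) v-a
  y-sc : app y (suc c) ≡ app w c
  y-sc = trans (mulT-app-o V q (<⇒≢ (s≤s a≤c) ∘ sym) (<⇒≢ (n<1+n c) ∘ sym)) (mulT-app-r W (Adj-l A) (Adj-r A))
  ih : ell v < ell y
  ih = ell-mulT V p (Adj-l A) a<c (subst₂ _<_ (sym v-a) (sym v-c) asc)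
  cases : app w c < app w (suc c) ⊎ app w (suc c) ≤ app w c → ell w < ell (mulS y c)
  cases (inj₁ lt) = begin-strict
    ell w <⟨ n<1+n _ ⟩
    suc (ell w) ≡⟨ sym (ell-asc W A lt) ⟩
    ell v ≤⟨ s≤s⁻¹ (≤-trans ih (ell-mulS-≥ Y A)) ⟩
    ell (mulS y c) ∎
  cases (inj₂ ge) = begin-strict
    ell w ≡⟨ ell-desc W A gt ⟩
    suc (ell v) ≤⟨ ih ⟩
    ell y <⟨ n<1+n _ ⟩
    suc (ell y) ≡⟨ sym (ell-asc Y A (subst₂ _<_ (sym y-c) (sym y-sc) (<-trans asc gt))) ⟩
    ell (mulS y c) ∎
    where
    gt : app w (suc c) < app w c
    gt = ≤∧≢⇒< ge (λ e → <⇒≢ (n<1+n c) (sym (inj W (Adj-r A) (Adj-l A) e)))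

-- Laurent polynomials with divided differences, abstractly

-- An abstract view of the additive group of Laurent polynomials: as for _≈P_, equality is equality of all coefficients.
record FormalModule : Set₁ where
  infixl 6 _⊕_
  infixr 7 _·_
  field
    M I : Set
    coef : M → I → ℤ
    𝟘 : M
    _⊕_ : M → M → M
    _·_ : ℤ → M → M
    coef-𝟘 : ∀ e → coef 𝟘 e ≡ + 0
    coef-⊕ : ∀ f g e → coef (f ⊕ g) e ≡ coef f e ℤ.+ coef g e
    coef-· : ∀ c f e → coef (c · f) e ≡ c ℤ.* coef f e

module ModuleTheory (Z : FormalModule) where
  open FormalModule Z
  infix 4 _≈_

  -- A record, not the bare family of equations, so that f and g can be inferred from a proof of
  -- `f ≈ g`.
  record _≈_ (f g : M) : Set where
    constructor mk
    field at : ∀ e → coef f e ≡ coef g e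
  open _≈_ public

  record Linear (F : M → M) : Set where
    constructor linear
    field
      resp : ∀ {f g} → f ≈ g → F f ≈ F g
      add : ∀ f g → F (f ⊕ g) ≈ F f ⊕ F g
      scale : ∀ c f → F (c · f) ≈ c · F f
  open Linear public

  ≈-refl : ∀ {f} → f ≈ f
  ≈-refl = mk λ e → refl

  ≈-sym : ∀ {f g} → f ≈ g → g ≈ f
  ≈-sym p = mk λ e → sym (at p e)

  ≈-trans : ∀ {f g h} → f ≈ g → g ≈ h → f ≈ h
  ≈-trans p q = mk λ e → trans (at p e) (at q e)

  ≈-reflexive : ∀ {f g} → f ≡ g → f ≈ g
  ≈-reflexive refl = ≈-refl

  ≈-setoid : Setoid _ _
  ≈-setoid = record { Carrier = M ; _≈_ = _≈_ ; isEquivalence = record { refl = ≈-refl ; sym = ≈-sym ; trans = ≈-trans } }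

  ⊕-cong : ∀ {f f′ g g′} → f ≈ f′ → g ≈ g′ → f ⊕ g ≈ f′ ⊕ g′
  ⊕-cong p q = mk λ e → trans (coef-⊕ _ _ e) (trans (cong₂ ℤ._+_ (at p e) (at q e)) (sym (coef-⊕ _ _ e)))

  ·-cong : ∀ c {f g} → f ≈ g → c · f ≈ c · g
  ·-cong c p = mk λ e → trans (coef-· c _ e) (trans (cong (c ℤ.*_) (at p e)) (sym (coef-· c _ e)))

  infixl 6 _:+_
  infixr 7 _:*_
  -- Formal ℤ-linear combinations: they reduce linear identities in M to identities in ℤ, which the ring solver proves.
  data Expr : Set where
    ⟨_⟩ : M → Expr
    :0 : Expr
    _:+_ : Expr → Expr → Expr
    _:*_ : ℤ → Expr → Expr

  ⟦_⟧ : Expr → M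
  ⟦ ⟨ f ⟩ ⟧ = f
  ⟦ :0 ⟧ = 𝟘
  ⟦ a :+ b ⟧ = ⟦ a ⟧ ⊕ ⟦ b ⟧
  ⟦ c :* a ⟧ = c · ⟦ a ⟧

  ⟦_⟧ᶻ : Expr → I → ℤ
  ⟦ ⟨ f ⟩ ⟧ᶻ e = coef f e
  ⟦ :0 ⟧ᶻ e = + 0
  ⟦ a :+ b ⟧ᶻ e = ⟦ a ⟧ᶻ e ℤ.+ ⟦ b ⟧ᶻ e
  ⟦ c :* a ⟧ᶻ e = c ℤ.* ⟦ a ⟧ᶻ e

  coef-⟦⟧ : ∀ a e → coef ⟦ a ⟧ e ≡ ⟦ a ⟧ᶻ e
  coef-⟦⟧ ⟨ f ⟩ e = refl
  coef-⟦⟧ :0 e = coef-𝟘 e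
  coef-⟦⟧ (a :+ b) e = trans (coef-⊕ _ _ e) (cong₂ ℤ._+_ (coef-⟦⟧ a e) (coef-⟦⟧ b e))
  coef-⟦⟧ (c :* a) e = trans (coef-· c _ e) (cong (c ℤ.*_) (coef-⟦⟧ a e))

  coefficientwise : ∀ a b → (∀ e → ⟦ a ⟧ᶻ e ≡ ⟦ b ⟧ᶻ e) → ⟦ a ⟧ ≈ ⟦ b ⟧
  coefficientwise a b h = mk λ e → trans (coef-⟦⟧ a e) (trans (h e) (sym (coef-⟦⟧ b e)))

  id-linear : Linear (λ f → f)
  id-linear = linear id (λ f g → ≈-refl) (λ c f → ≈-refl)

  ∘-linear : ∀ {F G} → Linear F → Linear G → Linear (λ f → F (G f))
  ∘-linear L K = linear (λ p → resp L (resp K p)) (λ f g → ≈-trans (resp L (add K f g)) (add L _ _))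
    (λ c f → ≈-trans (resp L (scale K c f)) (scale L c _))

  ⊕-linear : ∀ {F G} → Linear F → Linear G → Linear (λ f → F f ⊕ G f)
  ⊕-linear {F} {G} L K = linear (λ p → ⊕-cong (resp L p) (resp K p))
    (λ f g → ≈-trans (⊕-cong (add L f g) (add K f g))
      (coefficientwise (⟨ F f ⟩ :+ ⟨ F g ⟩ :+ (⟨ G f ⟩ :+ ⟨ G g ⟩)) (⟨ F f ⟩ :+ ⟨ G f ⟩ :+ (⟨ F g ⟩ :+ ⟨ G g ⟩))
        (λ e → lemma₁ (coef (F f) e) (coef (F g) e) (coef (G f) e) (coef (G g) e))))
    (λ c f → ≈-trans (⊕-cong (scale L c f) (scale K c f))
      (coefficientwise ((c :* ⟨ F f ⟩) :+ (c :* ⟨ G f ⟩)) (c :* (⟨ F f ⟩ :+ ⟨ G f ⟩))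
        (λ e → lemma₂ c (coef (F f) e) (coef (G f) e))))
    where
    lemma₁ : ∀ a b c d → a ℤ.+ b ℤ.+ (c ℤ.+ d) ≡ a ℤ.+ c ℤ.+ (b ℤ.+ d)
    lemma₁ = solve-∀
    lemma₂ : ∀ c a b → c ℤ.* a ℤ.+ c ℤ.* b ≡ c ℤ.* (a ℤ.+ b)
    lemma₂ = solve-∀

  ·-linear : ∀ c {F} → Linear F → Linear (λ f → c · F f)
  ·-linear c {F} L = linear (λ p → ·-cong c (resp L p))
    (λ f g → ≈-trans (·-cong c (add L f g)) (coefficientwise (c :* (⟨ F f ⟩ :+ ⟨ F g ⟩)) ((c :* ⟨ F f ⟩) :+ (c :* ⟨ F g ⟩))
      (λ e → lemma₁ c (coef (F f) e) (coef (F g) e))))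
    (λ d f → ≈-trans (·-cong c (scale L d f)) (coefficientwise (c :* d :* ⟨ F f ⟩) (d :* c :* ⟨ F f ⟩)
      (λ e → lemma₂ c d (coef (F f) e))))
    where
    lemma₁ : ∀ c a b → c ℤ.* (a ℤ.+ b) ≡ c ℤ.* a ℤ.+ c ℤ.* b
    lemma₁ = solve-∀
    lemma₂ : ∀ c d a → c ℤ.* (d ℤ.* a) ≡ d ℤ.* (c ℤ.* a)
    lemma₂ = solve-∀

  linear-𝟘 : ∀ {F} → Linear F → F 𝟘 ≈ 𝟘
  linear-𝟘 {F} L = ≈-trans (resp L (coefficientwise :0 (+ 0 :* :0) (λ e → refl)))
    (≈-trans (scale L (+ 0) 𝟘) (coefficientwise (+ 0 :* ⟨ F 𝟘 ⟩) :0 (λ e → ℤ.*-zeroˡ (coef (F 𝟘) e))))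

  linear-≈𝟘 : ∀ {F} → Linear F → ∀ {f} → f ≈ 𝟘 → F f ≈ 𝟘
  linear-≈𝟘 L p = ≈-trans (resp L p) (linear-𝟘 L)

  ⊕-identityʳ : ∀ f → f ⊕ 𝟘 ≈ f
  ⊕-identityʳ f = coefficientwise (⟨ f ⟩ :+ :0) ⟨ f ⟩ (λ e → ℤ.+-identityʳ (coef f e))

  ⊕-identityˡ : ∀ f → 𝟘 ⊕ f ≈ f
  ⊕-identityˡ f = coefficientwise (:0 :+ ⟨ f ⟩) ⟨ f ⟩ (λ e → ℤ.+-identityˡ (coef f e))

  ⊕-cancelʳ : ∀ {f g h} → f ⊕ h ≈ g ⊕ h → f ≈ g
  ⊕-cancelʳ {f} {g} {h} p = mk λ e → ℤGroup.∙-cancelʳ (coef h e) _ _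
    (trans (sym (coef-⊕ f h e)) (trans (at p e) (coef-⊕ g h e)))

  mapᴱ : (M → M) → Expr → Expr
  mapᴱ F ⟨ f ⟩ = ⟨ F f ⟩
  mapᴱ F :0 = :0
  mapᴱ F (a :+ b) = mapᴱ F a :+ mapᴱ F b
  mapᴱ F (c :* a) = c :* mapᴱ F a

  distribute : ∀ {F} → Linear F → ∀ a → F ⟦ a ⟧ ≈ ⟦ mapᴱ F a ⟧
  distribute L ⟨ f ⟩ = ≈-refl
  distribute L :0 = linear-𝟘 L
  distribute L (a :+ b) = ≈-trans (add L _ _) (⊕-cong (distribute L a) (distribute L b))
  distribute L (c :* a) = ≈-trans (scale L c _) (·-cong c (distribute L a))

-- The facts about Laurent polynomials on which the four expansions rest. `Y k` is division by x_k;
-- `∂-Xˡ`, `∂-Xʳ` and `∂-Xᵒ` together are the twisted Leibniz rule of the divided difference for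
-- multiplication by a variable; `generated` is induction over sums, scalars and the x_k^{±1}.
record LaurentAlgebra (n : ℕ) : Set₁ where
  field
    formalModule : FormalModule
  open FormalModule formalModule public
  open ModuleTheory formalModule public
  field
    𝟙 Δ : M
    X Y ∂ : ℕ → M → M
    X-linear : ∀ k → Linear (X k)
    Y-linear : ∀ k → Linear (Y k)
    ∂-linear : ∀ k → Linear (∂ k)
    XY : ∀ k f → X k (Y k f) ≈ f
    YX : ∀ k f → Y k (X k f) ≈ f
    X-comm : ∀ k l f → X k (X l f) ≈ X l (X k f)
    ∂-𝟙 : ∀ {k} → Adj n k → ∂ k 𝟙 ≈ 𝟘
    ∂-Xˡ : ∀ {k} → Adj n k → ∀ f → ∂ k (X k f) ≈ f ⊕ X (suc k) (∂ k f)
    ∂-Xʳ : ∀ {k} → Adj n k → ∀ f → ∂ k (X (suc k) f) ≈ X k (∂ k f) ⊕ -[1+ 0 ] · f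
    ∂-Xᵒ : ∀ {k l} → Adj n k → l ≢ k → l ≢ suc k → ∀ f → ∂ k (X l f) ≈ X l (∂ k f)
    ∂-XΔ : ∀ {k} → Adj n k → ∂ k (X (suc k) Δ) ≈ 𝟘
    generated : (P : M → Set) → (∀ {f g} → f ≈ g → P f → P g) → P 𝟘 → (∀ {f g} → P f → P g → P (f ⊕ g)) →
      (∀ c {f} → P f → P (c · f)) → P 𝟙 → (∀ {k f} → In n k → P f → P (X k f)) →
      (∀ {k f} → In n k → P f → P (Y k f)) → ∀ f → P f

  X-cancel : ∀ k {f g} → X k f ≈ X k g → f ≈ g
  X-cancel k p = ≈-trans (≈-sym (YX k _)) (≈-trans (resp (Y-linear k) p) (YX k _))

  -- Laurent polynomials are generated from 1 by the x_k^{±1}, so an operator is determined by its twisted Leibniz rule and its value at 1.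
  agree : ∀ {F G} → Linear F → Linear G → F 𝟙 ≈ G 𝟙 →
    (∀ {k} → In n k → ∃ λ l → ∃ λ (R : M → M) → ∀ f → F (X k f) ≈ X l (F f) ⊕ R f × G (X k f) ≈ X l (G f) ⊕ R f) →
    ∀ f → F f ≈ G f
  agree {F} {G} L K one h = generated (λ f → F f ≈ G f)
    (λ p q → ≈-trans (resp L (≈-sym p)) (≈-trans q (resp K p)))
    (≈-trans (linear-𝟘 L) (≈-sym (linear-𝟘 K)))
    (λ p q → ≈-trans (add L _ _) (≈-trans (⊕-cong p q) (≈-sym (add K _ _))))
    (λ c p → ≈-trans (scale L c _) (≈-trans (·-cong c p) (≈-sym (scale K c _))))
    one
    (λ {k} {f} i p → let (l , R , r) = h i in
      ≈-trans (proj₁ (r f)) (≈-trans (⊕-cong (resp (X-linear l) p) (≈-refl {R f})) (≈-sym (proj₂ (r f)))))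
    -- For f / x_k the rule is read backwards: applied to `Y k f`, it writes F f and G f, already
    -- known to agree, as `X l` of the wanted values plus a common remainder, and `X l` is
    -- injective.
    (λ {k} {f} i p → let (l , R , r) = h i in
      X-cancel l (⊕-cancelʳ {h = R (Y k f)} (≈-trans (≈-sym (proj₁ (r (Y k f))))
        (≈-trans (≈-trans (resp L (XY k f)) (≈-trans p (≈-sym (resp K (XY k f))))) (proj₂ (r (Y k f)))))))

-- Demazure operators and their braid relations

module Demazure {n : ℕ} (A : LaurentAlgebra n) (β : ℤ) where
  open LaurentAlgebra A
  open import Relation.Binary.Reasoning.Setoid ≈-setoid

  θ : ℕ → M → M
  θ k f = f ⊕ β · X k f

  -- One family for all cases, with π² = -β π: β = 0 gives the divided difference, of square zero,
  -- and β = -1 an idempotent operator.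
  π : ℕ → M → M
  π k f = ∂ k (θ (suc k) f)

  θ-linear : ∀ k → Linear (θ k)
  θ-linear k = ⊕-linear id-linear (·-linear β (X-linear k))

  π-linear : ∀ k → Linear (π k)
  π-linear k = ∘-linear (∂-linear k) (θ-linear (suc k))

  X-θ : ∀ k l f → X l (θ k f) ≈ θ k (X l f)
  X-θ k l f = ≈-trans (distribute (X-linear l) (⟨ f ⟩ :+ β :* ⟨ X k f ⟩)) (⊕-cong ≈-refl (·-cong β (X-comm l k f)))

  module _ {k : ℕ} (A : Adj n k) where
    -- Compared through `agree` with the zero operator. Applying the Leibniz rule twice returns
    -- every variable to itself, and the two corrections ∂f and -∂f cancel.
    ∂-∂ : ∀ f → ∂ k (∂ k f) ≈ 𝟘
    ∂-∂ = agree (∘-linear (∂-linear k) (∂-linear k)) (linear (λ _ → ≈-refl) (λ _ _ → ≈-sym (⊕-identityʳ 𝟘))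
        (λ c _ → ≈-sym (linear-𝟘 (·-linear c id-linear))))
      (linear-≈𝟘 (∂-linear k) (∂-𝟙 A))
      (λ {l} i → step i (l ≟ k) (l ≟ suc k))
      where
      zero-side : ∀ l → 𝟘 ≈ X l 𝟘 ⊕ 𝟘
      zero-side l = ≈-sym (≈-trans (⊕-identityʳ _) (linear-𝟘 (X-linear l)))
      lemma₁ : ∀ a b → a ℤ.+ (b ℤ.+ -[1+ 0 ] ℤ.* a) ≡ b ℤ.+ + 0
      lemma₁ = solve-∀
      lemma₂ : ∀ a b → a ℤ.+ b ℤ.+ -[1+ 0 ] ℤ.* a ≡ b ℤ.+ + 0
      lemma₂ = solve-∀
      step : ∀ {l} → In n l → Dec (l ≡ k) → Dec (l ≡ suc k) →
        ∃ λ m → ∃ λ (R : M → M) → ∀ f → ∂ k (∂ k (X l f)) ≈ X m (∂ k (∂ k f)) ⊕ R f × 𝟘 ≈ X m 𝟘 ⊕ R f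
      step i (yes refl) _ = k , (λ _ → 𝟘) , λ f → (begin
        ∂ k (∂ k (X k f)) ≈⟨ resp (∂-linear k) (∂-Xˡ A f) ⟩
        ∂ k (f ⊕ X (suc k) (∂ k f)) ≈⟨ add (∂-linear k) _ _ ⟩
        ∂ k f ⊕ ∂ k (X (suc k) (∂ k f)) ≈⟨ ⊕-cong ≈-refl (∂-Xʳ A (∂ k f)) ⟩
        ∂ k f ⊕ (X k (∂ k (∂ k f)) ⊕ -[1+ 0 ] · ∂ k f)
          ≈⟨ coefficientwise (⟨ ∂ k f ⟩ :+ (⟨ X k (∂ k (∂ k f)) ⟩ :+ -[1+ 0 ] :* ⟨ ∂ k f ⟩)) (⟨ X k (∂ k (∂ k f)) ⟩ :+ :0)
               (λ e → lemma₁ (coef (∂ k f) e) (coef (X k (∂ k (∂ k f))) e)) ⟩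
        X k (∂ k (∂ k f)) ⊕ 𝟘 ∎) , zero-side k
      step i (no _) (yes refl) = suc k , (λ _ → 𝟘) , λ f → (begin
        ∂ k (∂ k (X (suc k) f)) ≈⟨ resp (∂-linear k) (∂-Xʳ A f) ⟩
        ∂ k (X k (∂ k f) ⊕ -[1+ 0 ] · f) ≈⟨ distribute (∂-linear k) (⟨ X k (∂ k f) ⟩ :+ -[1+ 0 ] :* ⟨ f ⟩) ⟩
        ∂ k (X k (∂ k f)) ⊕ -[1+ 0 ] · ∂ k f ≈⟨ ⊕-cong (∂-Xˡ A (∂ k f)) ≈-refl ⟩
        ∂ k f ⊕ X (suc k) (∂ k (∂ k f)) ⊕ -[1+ 0 ] · ∂ k f
          ≈⟨ coefficientwise (⟨ ∂ k f ⟩ :+ ⟨ X (suc k) (∂ k (∂ k f)) ⟩ :+ -[1+ 0 ] :* ⟨ ∂ k f ⟩) (⟨ X (suc k) (∂ k (∂ k f)) ⟩ :+ :0)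
               (λ e → lemma₂ (coef (∂ k f) e) (coef (X (suc k) (∂ k (∂ k f))) e)) ⟩
        X (suc k) (∂ k (∂ k f)) ⊕ 𝟘 ∎) , zero-side (suc k)
      step {l} i (no l≢k) (no l≢sk) = l , (λ _ → 𝟘) , λ f →
        ≈-trans (resp (∂-linear k) (∂-Xᵒ A l≢k l≢sk f)) (≈-trans (∂-Xᵒ A l≢k l≢sk (∂ k f)) (≈-sym (⊕-identityʳ _))) , zero-side l

    ∂-π : ∀ f → ∂ k (π k f) ≈ 𝟘
    ∂-π f = ∂-∂ (θ (suc k) f)

    -- Here and below, vanishing of `∂ k f` stands for symmetry of f in x_k and x_{k+1}; such an f
    -- behaves as a scalar for ∂_k, and ∂_k x_k = 1.
    ∂-X-fixed : ∀ {f} → ∂ k f ≈ 𝟘 → ∂ k (X k f) ≈ f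
    ∂-X-fixed p = ≈-trans (∂-Xˡ A _) (≈-trans (⊕-cong ≈-refl (linear-≈𝟘 (X-linear (suc k)) p)) (⊕-identityʳ _))

    π-fixed : ∀ {f} → ∂ k f ≈ 𝟘 → π k f ≈ (- β) · f
    π-fixed {f} p = begin
      ∂ k (f ⊕ β · X (suc k) f) ≈⟨ distribute (∂-linear k) (⟨ f ⟩ :+ β :* ⟨ X (suc k) f ⟩) ⟩
      ∂ k f ⊕ β · ∂ k (X (suc k) f) ≈⟨ ⊕-cong p (·-cong β (≈-trans (∂-Xʳ A f) (⊕-cong (linear-≈𝟘 (X-linear k) p) ≈-refl))) ⟩
      𝟘 ⊕ β · (𝟘 ⊕ -[1+ 0 ] · f)
        ≈⟨ coefficientwise (:0 :+ β :* (:0 :+ -[1+ 0 ] :* ⟨ f ⟩)) ((- β) :* ⟨ f ⟩) (λ e → lemma β (coef f e)) ⟩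
      (- β) · f ∎
      where
      lemma : ∀ b a → + 0 ℤ.+ b ℤ.* (+ 0 ℤ.+ -[1+ 0 ] ℤ.* a) ≡ (- b) ℤ.* a
      lemma = solve-∀

    π-π : ∀ f → π k (π k f) ≈ (- β) · π k f
    π-π f = π-fixed (∂-π f)

    π-𝟙 : π k 𝟙 ≈ (- β) · 𝟙
    π-𝟙 = π-fixed (∂-𝟙 A)

    π-Xˡ : ∀ f → π k (X k f) ≈ θ (suc k) f ⊕ X (suc k) (π k f)
    π-Xˡ f = ≈-trans (resp (∂-linear k) (≈-sym (X-θ (suc k) k f))) (∂-Xˡ A _)

    π-Xʳ : ∀ f → π k (X (suc k) f) ≈ X k (π k f) ⊕ -[1+ 0 ] · θ (suc k) f
    π-Xʳ f = ≈-trans (resp (∂-linear k) (≈-sym (X-θ (suc k) (suc k) f))) (∂-Xʳ A _)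

    π-Xᵒ : ∀ {l} → l ≢ k → l ≢ suc k → ∀ f → π k (X l f) ≈ X l (π k f)
    π-Xᵒ {l} p q f = ≈-trans (resp (∂-linear k) (≈-sym (X-θ (suc k) l f))) (∂-Xᵒ A p q _)

    π-θᵒ : ∀ {l} → l ≢ k → l ≢ suc k → ∀ f → π k (θ l f) ≈ θ l (π k f)
    π-θᵒ {l} p q f = ≈-trans (distribute (π-linear k) (⟨ f ⟩ :+ β :* ⟨ X l f ⟩)) (⊕-cong ≈-refl (·-cong β (π-Xᵒ p q f)))

    π-θˡ : ∀ f → π k (θ k f) ≈ θ (suc k) (π k f) ⊕ β · θ (suc k) f
    π-θˡ f = begin
      π k (θ k f) ≈⟨ distribute (π-linear k) (⟨ f ⟩ :+ β :* ⟨ X k f ⟩) ⟩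
      π k f ⊕ β · π k (X k f) ≈⟨ ⊕-cong ≈-refl (·-cong β (π-Xˡ f)) ⟩
      π k f ⊕ β · (θ (suc k) f ⊕ X (suc k) (π k f))
        ≈⟨ coefficientwise (⟨ π k f ⟩ :+ β :* (⟨ θ (suc k) f ⟩ :+ ⟨ X (suc k) (π k f) ⟩))
             (⟨ π k f ⟩ :+ β :* ⟨ X (suc k) (π k f) ⟩ :+ β :* ⟨ θ (suc k) f ⟩)
             (λ e → lemma β (coef (π k f) e) (coef (θ (suc k) f) e) (coef (X (suc k) (π k f)) e)) ⟩
      θ (suc k) (π k f) ⊕ β · θ (suc k) f ∎
      where
      lemma : ∀ b x y z → x ℤ.+ b ℤ.* (y ℤ.+ z) ≡ x ℤ.+ b ℤ.* z ℤ.+ b ℤ.* y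
      lemma = solve-∀

    π-θʳ : ∀ f → π k (θ (suc k) f) ≈ θ k (π k f) ⊕ (- β) · θ (suc k) f
    π-θʳ f = begin
      π k (θ (suc k) f) ≈⟨ distribute (π-linear k) (⟨ f ⟩ :+ β :* ⟨ X (suc k) f ⟩) ⟩
      π k f ⊕ β · π k (X (suc k) f) ≈⟨ ⊕-cong ≈-refl (·-cong β (π-Xʳ f)) ⟩
      π k f ⊕ β · (X k (π k f) ⊕ -[1+ 0 ] · θ (suc k) f)
        ≈⟨ coefficientwise (⟨ π k f ⟩ :+ β :* (⟨ X k (π k f) ⟩ :+ -[1+ 0 ] :* ⟨ θ (suc k) f ⟩))
             (⟨ π k f ⟩ :+ β :* ⟨ X k (π k f) ⟩ :+ (- β) :* ⟨ θ (suc k) f ⟩)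
             (λ e → lemma β (coef (π k f) e) (coef (θ (suc k) f) e) (coef (X k (π k f)) e)) ⟩
      θ k (π k f) ⊕ (- β) · θ (suc k) f ∎
      where
      lemma : ∀ b x y z → x ℤ.+ b ℤ.* (z ℤ.+ -[1+ 0 ] ℤ.* y) ≡ x ℤ.+ b ℤ.* z ℤ.+ (- b) ℤ.* y
      lemma = solve-∀

  module _ {k : ℕ} (A : Adj n k) (A′ : Adj n (suc k)) where
    private
      p q x₁ x₂ x₃ θ₂ θ₃ : M → M
      p = π k
      q = π (suc k)
      x₁ = X k
      x₂ = X (suc k)
      x₃ = X (suc (suc k))
      θ₂ = θ (suc k)
      θ₃ = θ (suc (suc k))

      3≢1 : suc (suc k) ≢ k
      3≢1 = <⇒≢ (m≤n⇒m≤1+n (n<1+n k)) ∘ sym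

      3≢2 : suc (suc k) ≢ suc k
      3≢2 = <⇒≢ (n<1+n (suc k)) ∘ sym

      1≢2 : k ≢ suc k
      1≢2 = <⇒≢ (n<1+n k)

      px₃ : ∀ f → p (x₃ f) ≈ x₃ (p f)
      px₃ = π-Xᵒ A 3≢1 3≢2

      pθ₃ : ∀ f → p (θ₃ f) ≈ θ₃ (p f)
      pθ₃ = π-θᵒ A 3≢1 3≢2

      qx₁ : ∀ f → q (x₁ f) ≈ x₁ (q f)
      qx₁ = π-Xᵒ A′ 1≢2 (3≢1 ∘ sym)

      θ₃-pp : ∀ f → θ₃ (p (p f)) ≈ (- β) · θ₃ (p f)
      θ₃-pp f = ≈-trans (resp (θ-linear _) (π-π A f)) (scale (θ-linear _) (- β) (p f))

      -- The outer q is a divided difference after θ₃. Both θ₃θ₂ and q f are symmetric in x_{k+1}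
      -- and x_{k+2}, so it annihilates their product.
      qθ₂q : ∀ f → q (θ₂ (q f)) ≈ 𝟘
      qθ₂q f = begin
        q (θ₂ (q f)) ≈⟨ π-θˡ A′ (q f) ⟩
        θ₃ (q (q f)) ⊕ β · θ₃ (q f) ≈⟨ ⊕-cong (≈-trans (resp (θ-linear _) (π-π A′ f)) (scale (θ-linear _) (- β) (q f))) ≈-refl ⟩
        (- β) · θ₃ (q f) ⊕ β · θ₃ (q f)
          ≈⟨ coefficientwise ((- β) :* ⟨ θ₃ (q f) ⟩ :+ β :* ⟨ θ₃ (q f) ⟩) :0 (λ e → lemma β (coef (θ₃ (q f)) e)) ⟩
        𝟘 ∎
        where
        lemma : ∀ b a → (- b) ℤ.* a ℤ.+ b ℤ.* a ≡ + 0
        lemma = solve-∀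

      pqθ₂ : ∀ f → p (q (θ₂ f)) ≈ θ₃ (p (q f)) ⊕ β · θ₃ (p f)
      pqθ₂ f = begin
        p (q (θ₂ f)) ≈⟨ resp (π-linear k) (π-θˡ A′ f) ⟩
        p (θ₃ (q f) ⊕ β · θ₃ f) ≈⟨ distribute (π-linear k) (⟨ θ₃ (q f) ⟩ :+ β :* ⟨ θ₃ f ⟩) ⟩
        p (θ₃ (q f)) ⊕ β · p (θ₃ f) ≈⟨ ⊕-cong (pθ₃ (q f)) (·-cong β (pθ₃ f)) ⟩
        θ₃ (p (q f)) ⊕ β · θ₃ (p f) ∎

      -- Both braid words turn x₁, x₂, x₃ into x₃, x₂, x₁. `F₁` to `F₃` compute this for pqp and
      -- `G₁` to `G₃` for qpq; that the remainders are the same for both words is what `agree` asks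
      -- for.
      F₁ : ∀ f → p (q (p (x₁ f))) ≈ x₃ (p (q (p f))) ⊕ θ₃ (p (q f))
      F₁ f = begin
        p (q (p (x₁ f))) ≈⟨ resp (∘-linear (π-linear k) (π-linear (suc k))) (π-Xˡ A f) ⟩
        p (q (θ₂ f ⊕ x₂ (p f))) ≈⟨ add (∘-linear (π-linear k) (π-linear (suc k))) _ _ ⟩
        p (q (θ₂ f)) ⊕ p (q (x₂ (p f))) ≈⟨ ⊕-cong (pqθ₂ f) (≈-trans (resp (π-linear k) (π-Xˡ A′ (p f))) (add (π-linear k) _ _)) ⟩
        θ₃ (p (q f)) ⊕ β · θ₃ (p f) ⊕ (p (θ₃ (p f)) ⊕ p (x₃ (q (p f))))
          ≈⟨ ⊕-cong ≈-refl (⊕-cong (≈-trans (pθ₃ (p f)) (θ₃-pp f)) (px₃ (q (p f)))) ⟩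
        θ₃ (p (q f)) ⊕ β · θ₃ (p f) ⊕ ((- β) · θ₃ (p f) ⊕ x₃ (p (q (p f))))
          ≈⟨ coefficientwise (⟨ θ₃ (p (q f)) ⟩ :+ β :* ⟨ θ₃ (p f) ⟩ :+ ((- β) :* ⟨ θ₃ (p f) ⟩ :+ ⟨ x₃ (p (q (p f))) ⟩))
               (⟨ x₃ (p (q (p f))) ⟩ :+ ⟨ θ₃ (p (q f)) ⟩)
               (λ e → lemma β (coef (θ₃ (p (q f))) e) (coef (θ₃ (p f)) e) (coef (x₃ (p (q (p f)))) e)) ⟩
        x₃ (p (q (p f))) ⊕ θ₃ (p (q f)) ∎
        where
        lemma : ∀ b x y z → x ℤ.+ b ℤ.* y ℤ.+ ((- b) ℤ.* y ℤ.+ z) ≡ z ℤ.+ x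
        lemma = solve-∀

      G₁ : ∀ f → q (p (q (x₁ f))) ≈ x₃ (q (p (q f))) ⊕ θ₃ (p (q f))
      G₁ f = begin
        q (p (q (x₁ f))) ≈⟨ resp (∘-linear (π-linear (suc k)) (π-linear k)) (qx₁ f) ⟩
        q (p (x₁ (q f))) ≈⟨ resp (π-linear (suc k)) (π-Xˡ A (q f)) ⟩
        q (θ₂ (q f) ⊕ x₂ (p (q f))) ≈⟨ add (π-linear (suc k)) _ _ ⟩
        q (θ₂ (q f)) ⊕ q (x₂ (p (q f))) ≈⟨ ⊕-cong (qθ₂q f) (π-Xˡ A′ (p (q f))) ⟩
        𝟘 ⊕ (θ₃ (p (q f)) ⊕ x₃ (q (p (q f))))
          ≈⟨ coefficientwise (:0 :+ (⟨ θ₃ (p (q f)) ⟩ :+ ⟨ x₃ (q (p (q f))) ⟩)) (⟨ x₃ (q (p (q f))) ⟩ :+ ⟨ θ₃ (p (q f)) ⟩)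
               (λ e → lemma (coef (θ₃ (p (q f))) e) (coef (x₃ (q (p (q f)))) e)) ⟩
        x₃ (q (p (q f))) ⊕ θ₃ (p (q f)) ∎
        where
        lemma : ∀ x z → + 0 ℤ.+ (x ℤ.+ z) ≡ z ℤ.+ x
        lemma = solve-∀

      R₂ : M → M
      R₂ f = θ₂ (q (p f)) ⊕ -[1+ 0 ] · θ₃ (p (q f)) ⊕ (- β) · θ₃ (p f)

      F₂ : ∀ f → p (q (p (x₂ f))) ≈ x₂ (p (q (p f))) ⊕ R₂ f
      F₂ f = begin
        p (q (p (x₂ f))) ≈⟨ resp (∘-linear (π-linear k) (π-linear (suc k))) (π-Xʳ A f) ⟩
        p (q (x₁ (p f) ⊕ -[1+ 0 ] · θ₂ f)) ≈⟨ distribute (∘-linear (π-linear k) (π-linear (suc k))) (⟨ x₁ (p f) ⟩ :+ -[1+ 0 ] :* ⟨ θ₂ f ⟩) ⟩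
        p (q (x₁ (p f))) ⊕ -[1+ 0 ] · p (q (θ₂ f))
          ≈⟨ ⊕-cong (≈-trans (resp (π-linear k) (qx₁ (p f))) (π-Xˡ A (q (p f)))) (·-cong -[1+ 0 ] (pqθ₂ f)) ⟩
        θ₂ (q (p f)) ⊕ x₂ (p (q (p f))) ⊕ -[1+ 0 ] · (θ₃ (p (q f)) ⊕ β · θ₃ (p f))
          ≈⟨ coefficientwise (⟨ θ₂ (q (p f)) ⟩ :+ ⟨ x₂ (p (q (p f))) ⟩ :+ -[1+ 0 ] :* (⟨ θ₃ (p (q f)) ⟩ :+ β :* ⟨ θ₃ (p f) ⟩))
               (⟨ x₂ (p (q (p f))) ⟩ :+ (⟨ θ₂ (q (p f)) ⟩ :+ -[1+ 0 ] :* ⟨ θ₃ (p (q f)) ⟩ :+ (- β) :* ⟨ θ₃ (p f) ⟩))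
               (λ e → lemma β (coef (θ₂ (q (p f))) e) (coef (x₂ (p (q (p f)))) e) (coef (θ₃ (p (q f))) e) (coef (θ₃ (p f)) e)) ⟩
        x₂ (p (q (p f))) ⊕ R₂ f ∎
        where
        lemma : ∀ b x y z w → x ℤ.+ y ℤ.+ -[1+ 0 ] ℤ.* (z ℤ.+ b ℤ.* w) ≡ y ℤ.+ (x ℤ.+ -[1+ 0 ] ℤ.* z ℤ.+ (- b) ℤ.* w)
        lemma = solve-∀

      G₂ : ∀ f → q (p (q (x₂ f))) ≈ x₂ (q (p (q f))) ⊕ R₂ f
      G₂ f = begin
        q (p (q (x₂ f))) ≈⟨ resp (∘-linear (π-linear (suc k)) (π-linear k)) (π-Xˡ A′ f) ⟩
        q (p (θ₃ f ⊕ x₃ (q f))) ≈⟨ add (∘-linear (π-linear (suc k)) (π-linear k)) _ _ ⟩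
        q (p (θ₃ f)) ⊕ q (p (x₃ (q f))) ≈⟨ ⊕-cong (resp (π-linear (suc k)) (pθ₃ f)) (resp (π-linear (suc k)) (px₃ (q f))) ⟩
        q (θ₃ (p f)) ⊕ q (x₃ (p (q f))) ≈⟨ ⊕-cong (π-θʳ A′ (p f)) (π-Xʳ A′ (p (q f))) ⟩
        θ₂ (q (p f)) ⊕ (- β) · θ₃ (p f) ⊕ (x₂ (q (p (q f))) ⊕ -[1+ 0 ] · θ₃ (p (q f)))
          ≈⟨ coefficientwise (⟨ θ₂ (q (p f)) ⟩ :+ (- β) :* ⟨ θ₃ (p f) ⟩ :+ (⟨ x₂ (q (p (q f))) ⟩ :+ -[1+ 0 ] :* ⟨ θ₃ (p (q f)) ⟩))
               (⟨ x₂ (q (p (q f))) ⟩ :+ (⟨ θ₂ (q (p f)) ⟩ :+ -[1+ 0 ] :* ⟨ θ₃ (p (q f)) ⟩ :+ (- β) :* ⟨ θ₃ (p f) ⟩))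
               (λ e → lemma β (coef (θ₂ (q (p f))) e) (coef (x₂ (q (p (q f)))) e) (coef (θ₃ (p (q f))) e) (coef (θ₃ (p f)) e)) ⟩
        x₂ (q (p (q f))) ⊕ R₂ f ∎
        where
        lemma : ∀ b x y z w → x ℤ.+ (- b) ℤ.* w ℤ.+ (y ℤ.+ -[1+ 0 ] ℤ.* z) ≡ y ℤ.+ (x ℤ.+ -[1+ 0 ] ℤ.* z ℤ.+ (- b) ℤ.* w)
        lemma = solve-∀

      R₃ : M → M
      R₃ f = -[1+ 0 ] · θ₂ (q (p f)) ⊕ β · θ₃ (p f)

      F₃ : ∀ f → p (q (p (x₃ f))) ≈ x₁ (p (q (p f))) ⊕ R₃ f
      F₃ f = begin
        p (q (p (x₃ f))) ≈⟨ resp (∘-linear (π-linear k) (π-linear (suc k))) (px₃ f) ⟩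
        p (q (x₃ (p f))) ≈⟨ resp (π-linear k) (π-Xʳ A′ (p f)) ⟩
        p (x₂ (q (p f)) ⊕ -[1+ 0 ] · θ₃ (p f)) ≈⟨ distribute (π-linear k) (⟨ x₂ (q (p f)) ⟩ :+ -[1+ 0 ] :* ⟨ θ₃ (p f) ⟩) ⟩
        p (x₂ (q (p f))) ⊕ -[1+ 0 ] · p (θ₃ (p f))
          ≈⟨ ⊕-cong (π-Xʳ A (q (p f))) (·-cong -[1+ 0 ] (≈-trans (pθ₃ (p f)) (θ₃-pp f))) ⟩
        x₁ (p (q (p f))) ⊕ -[1+ 0 ] · θ₂ (q (p f)) ⊕ -[1+ 0 ] · (- β) · θ₃ (p f)
          ≈⟨ coefficientwise (⟨ x₁ (p (q (p f))) ⟩ :+ -[1+ 0 ] :* ⟨ θ₂ (q (p f)) ⟩ :+ -[1+ 0 ] :* (- β) :* ⟨ θ₃ (p f) ⟩)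
               (⟨ x₁ (p (q (p f))) ⟩ :+ (-[1+ 0 ] :* ⟨ θ₂ (q (p f)) ⟩ :+ β :* ⟨ θ₃ (p f) ⟩))
               (λ e → lemma β (coef (x₁ (p (q (p f)))) e) (coef (θ₂ (q (p f))) e) (coef (θ₃ (p f)) e)) ⟩
        x₁ (p (q (p f))) ⊕ R₃ f ∎
        where
        lemma : ∀ b x y z → x ℤ.+ -[1+ 0 ] ℤ.* y ℤ.+ -[1+ 0 ] ℤ.* ((- b) ℤ.* z) ≡ x ℤ.+ (-[1+ 0 ] ℤ.* y ℤ.+ b ℤ.* z)
        lemma = solve-∀

      G₃ : ∀ f → q (p (q (x₃ f))) ≈ x₁ (q (p (q f))) ⊕ R₃ f
      G₃ f = begin
        q (p (q (x₃ f))) ≈⟨ resp (∘-linear (π-linear (suc k)) (π-linear k)) (π-Xʳ A′ f) ⟩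
        q (p (x₂ (q f) ⊕ -[1+ 0 ] · θ₃ f)) ≈⟨ distribute (∘-linear (π-linear (suc k)) (π-linear k)) (⟨ x₂ (q f) ⟩ :+ -[1+ 0 ] :* ⟨ θ₃ f ⟩) ⟩
        q (p (x₂ (q f))) ⊕ -[1+ 0 ] · q (p (θ₃ f))
          ≈⟨ ⊕-cong (resp (π-linear (suc k)) (π-Xʳ A (q f))) (·-cong -[1+ 0 ] (≈-trans (resp (π-linear (suc k)) (pθ₃ f)) (π-θʳ A′ (p f)))) ⟩
        q (x₁ (p (q f)) ⊕ -[1+ 0 ] · θ₂ (q f)) ⊕ -[1+ 0 ] · (θ₂ (q (p f)) ⊕ (- β) · θ₃ (p f))
          ≈⟨ ⊕-cong (≈-trans (distribute (π-linear (suc k)) (⟨ x₁ (p (q f)) ⟩ :+ -[1+ 0 ] :* ⟨ θ₂ (q f) ⟩))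
               (⊕-cong (qx₁ (p (q f))) (·-cong -[1+ 0 ] (qθ₂q f)))) ≈-refl ⟩
        x₁ (q (p (q f))) ⊕ -[1+ 0 ] · 𝟘 ⊕ -[1+ 0 ] · (θ₂ (q (p f)) ⊕ (- β) · θ₃ (p f))
          ≈⟨ coefficientwise (⟨ x₁ (q (p (q f))) ⟩ :+ -[1+ 0 ] :* :0 :+ -[1+ 0 ] :* (⟨ θ₂ (q (p f)) ⟩ :+ (- β) :* ⟨ θ₃ (p f) ⟩))
               (⟨ x₁ (q (p (q f))) ⟩ :+ (-[1+ 0 ] :* ⟨ θ₂ (q (p f)) ⟩ :+ β :* ⟨ θ₃ (p f) ⟩))
               (λ e → lemma β (coef (x₁ (q (p (q f)))) e) (coef (θ₂ (q (p f))) e) (coef (θ₃ (p f)) e)) ⟩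
        x₁ (q (p (q f))) ⊕ R₃ f ∎
        where
        lemma : ∀ b x y z → x ℤ.+ -[1+ 0 ] ℤ.* + 0 ℤ.+ -[1+ 0 ] ℤ.* (y ℤ.+ (- b) ℤ.* z) ≡ x ℤ.+ (-[1+ 0 ] ℤ.* y ℤ.+ b ℤ.* z)
        lemma = solve-∀

      scalar³ : ∀ {F G H} → Linear F → Linear G → Linear H → F 𝟙 ≈ (- β) · 𝟙 → G 𝟙 ≈ (- β) · 𝟙 → H 𝟙 ≈ (- β) · 𝟙 →
        F (G (H 𝟙)) ≈ (- β) · (- β) · (- β) · 𝟙
      scalar³ {F} {G} {H} f g h f𝟙 g𝟙 h𝟙 = begin
        F (G (H 𝟙)) ≈⟨ resp (∘-linear f g) h𝟙 ⟩
        F (G ((- β) · 𝟙)) ≈⟨ scale (∘-linear f g) (- β) 𝟙 ⟩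
        (- β) · F (G 𝟙) ≈⟨ ·-cong (- β) (≈-trans (resp f g𝟙) (≈-trans (scale f (- β) 𝟙) (·-cong (- β) f𝟙))) ⟩
        (- β) · (- β) · (- β) · 𝟙 ∎

    π-braid : ∀ f → π k (π (suc k) (π k f)) ≈ π (suc k) (π k (π (suc k) f))
    π-braid = agree (∘-linear (π-linear k) (∘-linear (π-linear (suc k)) (π-linear k)))
      (∘-linear (π-linear (suc k)) (∘-linear (π-linear k) (π-linear (suc k))))
      (≈-trans (scalar³ (π-linear _) (π-linear _) (π-linear _) (π-𝟙 A) (π-𝟙 A′) (π-𝟙 A))
        (≈-sym (scalar³ (π-linear _) (π-linear _) (π-linear _) (π-𝟙 A′) (π-𝟙 A) (π-𝟙 A′))))
      (λ {l} i → step i (l ≟ k) (l ≟ suc k) (l ≟ suc (suc k)))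
      where
      step : ∀ {l} → In n l → Dec (l ≡ k) → Dec (l ≡ suc k) → Dec (l ≡ suc (suc k)) →
        ∃ λ m → ∃ λ (R : M → M) → ∀ f → p (q (p (X l f))) ≈ X m (p (q (p f))) ⊕ R f × q (p (q (X l f))) ≈ X m (q (p (q f))) ⊕ R f
      step i (yes refl) _ _ = suc (suc k) , (λ f → θ₃ (p (q f))) , λ f → F₁ f , G₁ f
      step i (no _) (yes refl) _ = suc k , R₂ , λ f → F₂ f , G₂ f
      step i (no _) (no _) (yes refl) = k , R₃ , λ f → F₃ f , G₃ f
      step {l} i (no l≢1) (no l≢2) (no l≢3) = l , (λ _ → 𝟘) , λ f →
        ≈-trans (commutes p q p p-l q-l p-l f) (≈-sym (⊕-identityʳ _)) , ≈-trans (commutes q p q q-l p-l q-l f) (≈-sym (⊕-identityʳ _))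
        where
        Comm : (M → M) → Set
        Comm F = Linear F × (∀ f → F (X l f) ≈ X l (F f))
        p-l : Comm p
        p-l = π-linear k , π-Xᵒ A l≢1 l≢2
        q-l : Comm q
        q-l = π-linear (suc k) , π-Xᵒ A′ l≢2 l≢3
        commutes : ∀ F G H → Comm F → Comm G → Comm H → ∀ f → F (G (H (X l f))) ≈ X l (F (G (H f)))
        commutes F G H (F-lin , F-X) (G-lin , G-X) (_ , H-X) f =
          ≈-trans (resp (∘-linear F-lin G-lin) (H-X f)) (≈-trans (resp F-lin (G-X (H f))) (F-X (G (H f))))

  module _ {k l : ℕ} (A : Adj n k) (B : Adj n l) (sk<l : suc k < l) where
    private
      k≢l : k ≢ l
      k≢l = <⇒≢ (<-trans (n<1+n k) sk<l)
      sk≢l : suc k ≢ l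
      sk≢l = <⇒≢ sk<l
      k≢sl : k ≢ suc l
      k≢sl = <⇒≢ (m≤n⇒m≤1+n (<-trans (n<1+n k) sk<l))
      sk≢sl : suc k ≢ suc l
      sk≢sl = k≢l ∘ suc-injective

      -- The pattern shared by the four nontrivial cases: π_a changes the variable and leaves a
      -- remainder r, while π_b commutes with both variables and with r.
      past : ∀ {m m′ a b} {r : M → M} → (∀ f → π a (X m f) ≈ X m′ (π a f) ⊕ r f) →
        (∀ f → π b (X m f) ≈ X m (π b f)) → (∀ f → π b (X m′ f) ≈ X m′ (π b f)) → (∀ f → π b (r f) ≈ r (π b f)) →
        ∀ f → π a (π b (X m f)) ≈ X m′ (π a (π b f)) ⊕ r (π b f) × π b (π a (X m f)) ≈ X m′ (π b (π a f)) ⊕ r (π b f)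
      past {m} {m′} {a} {b} h bm bm′ br f =
        ≈-trans (resp (π-linear a) (bm f)) (h (π b f)) ,
        ≈-trans (resp (π-linear b) (h f)) (≈-trans (add (π-linear b) _ _) (⊕-cong (bm′ (π a f)) (br f)))

      π-Xˡ′ : ∀ {a} → Adj n a → ∀ f → π a (X a f) ≈ X (suc a) (π a f) ⊕ θ (suc a) f
      π-Xˡ′ {a} A f = ≈-trans (π-Xˡ A f) (coefficientwise (⟨ θ (suc a) f ⟩ :+ ⟨ X (suc a) (π a f) ⟩) (⟨ X (suc a) (π a f) ⟩ :+ ⟨ θ (suc a) f ⟩)
        (λ e → ℤ.+-comm (coef (θ (suc a) f) e) (coef (X (suc a) (π a f)) e)))

      -1θ-comm : ∀ {a b} → Adj n b → a ≢ b → a ≢ suc b → ∀ f → π b (-[1+ 0 ] · θ a f) ≈ -[1+ 0 ] · θ a (π b f)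
      -1θ-comm {a} {b} B p q f = ≈-trans (scale (π-linear b) -[1+ 0 ] _) (·-cong -[1+ 0 ] (π-θᵒ B p q f))

    π-comm : ∀ f → π k (π l f) ≈ π l (π k f)
    π-comm = agree (∘-linear (π-linear k) (π-linear l)) (∘-linear (π-linear l) (π-linear k))
      (≈-trans (twice A B) (≈-sym (twice B A)))
      (λ {m} i → step i (m ≟ k) (m ≟ suc k) (m ≟ l) (m ≟ suc l))
      where
      twice : ∀ {a b} → Adj n a → Adj n b → π a (π b 𝟙) ≈ (- β) · (- β) · 𝟙
      twice A B = ≈-trans (resp (π-linear _) (π-𝟙 B)) (≈-trans (scale (π-linear _) (- β) 𝟙) (·-cong (- β) (π-𝟙 A)))
      step : ∀ {m} → In n m → Dec (m ≡ k) → Dec (m ≡ suc k) → Dec (m ≡ l) → Dec (m ≡ suc l) →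
        ∃ λ m′ → ∃ λ (R : M → M) → ∀ f → π k (π l (X m f)) ≈ X m′ (π k (π l f)) ⊕ R f × π l (π k (X m f)) ≈ X m′ (π l (π k f)) ⊕ R f
      step i (yes refl) _ _ _ = suc k , (λ f → θ (suc k) (π l f)) ,
        past (π-Xˡ′ A) (π-Xᵒ B k≢l k≢sl) (π-Xᵒ B sk≢l sk≢sl) (π-θᵒ B sk≢l sk≢sl)
      step i (no _) (yes refl) _ _ = k , (λ f → -[1+ 0 ] · θ (suc k) (π l f)) ,
        past (π-Xʳ A) (π-Xᵒ B sk≢l sk≢sl) (π-Xᵒ B k≢l k≢sl) (-1θ-comm B sk≢l sk≢sl)
      step i (no _) (no _) (yes refl) _ = suc l , (λ f → θ (suc l) (π k f)) 
        , λ f → ×-swap (past (π-Xˡ′ B) (π-Xᵒ A (k≢l ∘ sym) (sk≢l ∘ sym)) (π-Xᵒ A (k≢sl ∘ sym) (sk≢sl ∘ sym))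
          (π-θᵒ A (k≢sl ∘ sym) (sk≢sl ∘ sym)) f)
      step i (no _) (no _) (no _) (yes refl) = l , (λ f → -[1+ 0 ] · θ (suc l) (π k f)) 
        , λ f → ×-swap (past (π-Xʳ B) (π-Xᵒ A (k≢sl ∘ sym) (sk≢sl ∘ sym)) (π-Xᵒ A (k≢l ∘ sym) (sk≢l ∘ sym))
          (-1θ-comm A (k≢sl ∘ sym) (sk≢sl ∘ sym)) f)
      step {m} i (no p) (no q) (no r) (no s) = m , (λ _ → 𝟘) , λ f →
        ≈-trans (resp (π-linear k) (π-Xᵒ B r s f)) (≈-trans (π-Xᵒ A p q _) (≈-sym (⊕-identityʳ _))) ,
        ≈-trans (resp (π-linear l) (π-Xᵒ A p q f)) (≈-trans (π-Xᵒ B r s _) (≈-sym (⊕-identityʳ _)))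

-- Independence of the choice of ascents

firstB-view : ∀ p xs → (∃ λ x → firstB p xs ≡ just x × x ∈ xs × p x ≡ true) ⊎ (firstB p xs ≡ nothing × (∀ {x} → x ∈ xs → p x ≡ false))
firstB-view p [] = inj₂ (refl , λ ())
firstB-view p (x ∷ xs) with p x in eq
... | true = inj₁ (x , refl , here refl , eq)
... | false with firstB-view p xs
...   | inj₁ (y , e , m , q) = inj₁ (y , e , there m , q)
...   | inj₂ (e , h) = inj₂ (e , λ { (here refl) → eq ; (there m) → h m })

In-pred⇒Adj : ∀ {n k} → In (n ∸ 1) k → Adj n k
In-pred⇒Adj {zero} (p , q) = contradiction (≤-trans p q) λ ()
In-pred⇒Adj {suc n} (p , q) = p , s≤s q

Adj⇒In-pred : ∀ {n k} → Adj n k → In (n ∸ 1) k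
Adj⇒In-pred {suc n} (p , s≤s q) = p , q

firstAscent-view : ∀ n v → (∃ λ k → firstAscent n v ≡ just k × Adj n k × app v k < app v (suc k))
  ⊎ (firstAscent n v ≡ nothing × (∀ {k} → Adj n k → ¬ app v k < app v (suc k)))
firstAscent-view n v with firstB-view (λ i → app v i <ᵇ app v (suc i)) (range (n ∸ 1))
... | inj₁ (k , e , m , q) = inj₁ (k , e , In-pred⇒Adj (∈-range⇒In m) , <ᵇ≡⇒< q)
... | inj₂ (e , h) = inj₂ (e , λ A → <ᵇ≡⇒≮ (h (In⇒∈-range (Adj⇒In-pred A))))

app-w0 : ∀ {n k} → In n k → app (w0 n) k ≡ suc n ∸ k
app-w0 {n} {suc k} (_ , q) = cong (getD (suc k)) (trans (cong (λ l → nth l k) (reverse-applyUpTo suc n)) (nth-applyDownFrom n k q))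
  where
  nth-applyDownFrom : ∀ n k → k < n → nth (applyDownFrom suc n) k ≡ just (n ∸ k)
  nth-applyDownFrom (suc n) zero p = refl
  nth-applyDownFrom (suc n) (suc k) (s≤s p) = nth-applyDownFrom n k p

firstAscent-w0 : ∀ n → firstAscent n (w0 n) ≡ nothing
firstAscent-w0 n with firstAscent-view n (w0 n)
... | inj₂ (e , _) = e
... | inj₁ (k , _ , A , asc) = contradiction (subst₂ _<_ (app-w0 (Adj-l A)) (app-w0 (Adj-r A)) asc) (≤⇒≯ (∸-monoʳ-≤ (suc n) (n≤1+n k)))

mulS-comm : ∀ {n w i k} → IsPerm n w → Adj n i → Adj n k → suc i < k → mulS (mulS w i) k ≡ mulS (mulS w k) i
mulS-comm {n} {w} {i} {k} W A B lt = app-ext (len (mulS-perm (mulS-perm W A) B)) (len (mulS-perm (mulS-perm W B) A)) λ l j → begin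
  app (mulS (mulS w i) k) l ≡⟨ app-mulT (mulS w i) k (suc k) (len (mulS-perm W A)) j ⟩
  app (mulS w i) (s k l) ≡⟨ app-mulT w i (suc i) (len W) (sw-In (Adj-l B) (Adj-r B) j) ⟩
  app w (s i (s k l)) ≡⟨ cong (app w) (commute l) ⟩
  app w (s k (s i l)) ≡⟨ sym (app-mulT w k (suc k) (len W) (sw-In (Adj-l A) (Adj-r A) j)) ⟩
  app (mulS w k) (s i l) ≡⟨ sym (app-mulT (mulS w k) i (suc i) (len (mulS-perm W B)) j) ⟩
  app (mulS (mulS w k) i) l ∎
  where
  open ≡-Reasoning
  s : ℕ → ℕ → ℕ
  s i = sw i (suc i)
  i≢k : i ≢ k
  i≢k = <⇒≢ (<-trans (n<1+n i) lt)
  si≢k : suc i ≢ k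
  si≢k = <⇒≢ lt
  i≢sk : i ≢ suc k
  i≢sk = <⇒≢ (m≤n⇒m≤1+n (<-trans (n<1+n i) lt))
  commute : ∀ l → s i (s k l) ≡ s k (s i l)
  commute l with l ≟ i | l ≟ suc i
  ... | yes refl | _ = trans (cong (s l) (sw-o i≢k i≢sk)) (trans (sw-l i (suc i)) (sym (trans (cong (s k) (sw-l i (suc i))) (sw-o si≢k (i≢k ∘ suc-injective)))))
  ... | no _ | yes refl = trans (cong (s i) (sw-o si≢k (i≢k ∘ suc-injective))) (trans (sw-r i (suc i)) (sym (trans (cong (s k) (sw-r i (suc i))) (sw-o i≢k i≢sk))))
  ... | no p | no q with s k l | swap k (suc k) l
  ...   | _ | left refl = trans (sw-o (i≢sk ∘ sym) (i≢k ∘ sym ∘ suc-injective)) (sym (trans (cong (s k) (sw-o p q)) (sw-l k (suc k))))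
  ...   | _ | right refl = trans (sw-o (i≢k ∘ sym) (si≢k ∘ sym)) (sym (trans (cong (s k) (sw-o p q)) (sw-r k (suc k))))
  ...   | _ | other a b = trans (sw-o p q) (sym (trans (cong (s k) (sw-o p q)) (sw-o a b)))

-- Both triple products are the transposition of i and i + 2, by two instances of `sw-conj`.
mulS-braid : ∀ {n w i} → IsPerm n w → Adj n i → Adj n (suc i) →
  mulS (mulS (mulS w i) (suc i)) i ≡ mulS (mulS (mulS w (suc i)) i) (suc i)
mulS-braid {n} {w} {i} W A B = app-ext (len (mulS-perm (mulS-perm (mulS-perm W A) B) A)) (len (mulS-perm (mulS-perm (mulS-perm W B) A) B))
  λ l j → trans (triple W A B A j) (trans (cong (app w) (braid l)) (sym (triple W B A B j)))
  where
  s : ℕ → ℕ → ℕ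
  s i = sw i (suc i)
  triple : ∀ {a b c l} → IsPerm n w → Adj n a → Adj n b → Adj n c → In n l → app (mulS (mulS (mulS w a) b) c) l ≡ app w (s a (s b (s c l)))
  triple {a} {b} {c} W A B C j = trans (app-mulT (mulS (mulS w a) b) c (suc c) (len (mulS-perm (mulS-perm W A) B)) j)
    (trans (app-mulT (mulS w a) b (suc b) (len (mulS-perm W A)) (sw-In (Adj-l C) (Adj-r C) j))
      (app-mulT w a (suc a) (len W) (sw-In (Adj-l B) (Adj-r B) (sw-In (Adj-l C) (Adj-r C) j))))
  i≢1 : i ≢ suc i
  i≢1 = <⇒≢ (n<1+n i)
  1≢2 : suc i ≢ suc (suc i)
  1≢2 = i≢1 ∘ suc-injective
  i≢2 : i ≢ suc (suc i)
  i≢2 = <⇒≢ (m≤n⇒m≤1+n (n<1+n i))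
  braid : ∀ l → s i (s (suc i) (s i l)) ≡ s (suc i) (s i (s (suc i) l))
  braid l = begin
    sw i (suc i) (sw (suc i) (suc (suc i)) (sw i (suc i) l)) ≡⟨ cong (λ x → sw i (suc i) (sw (suc i) (suc (suc i)) x)) (sw-comm i (suc i) l) ⟩
    sw i (suc i) (sw (suc i) (suc (suc i)) (sw (suc i) i l)) ≡⟨ sw-comm i (suc i) (sw (suc i) (suc (suc i)) (sw (suc i) i l)) ⟩
    sw (suc i) i (sw (suc i) (suc (suc i)) (sw (suc i) i l)) ≡⟨ cong (sw (suc i) i) (sw-comm (suc i) (suc (suc i)) (sw (suc i) i l)) ⟩
    sw (suc i) i (sw (suc (suc i)) (suc i) (sw (suc i) i l)) ≡⟨ sw-conj l (i≢1 ∘ sym) (1≢2 ∘ sym) (i≢2 ∘ sym) ⟩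
    sw (suc (suc i)) i l ≡⟨ sw-comm (suc (suc i)) i l ⟩
    sw i (suc (suc i)) l ≡⟨ sym (sw-conj l 1≢2 i≢1 i≢2) ⟩
    sw (suc i) (suc (suc i)) (sw i (suc i) (sw (suc i) (suc (suc i)) l)) ∎
    where open ≡-Reasoning

module Grothendieck {n : ℕ} (A : LaurentAlgebra n) (β : ℤ) where
  open LaurentAlgebra A
  open Demazure A β
  open import Relation.Binary.Reasoning.Setoid ≈-setoid

  GF : ℕ → Perm → M
  GF zero v = 𝟘
  GF (suc f) v = maybe (λ k → π k (GF f (mulS v k))) Δ (firstAscent n v)

  G : Perm → M
  G v = GF (n * n + 1) v

  -- An unfolding step lengthens v by one and uses one unit of fuel, so the sum is preserved; since
  -- lengths are at most n², the condition fails at fuel 0.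
  Fuel : ℕ → Perm → Set
  Fuel f v = n * n < ell v + f

  no-fuel : ∀ {v} → IsPerm n v → ¬ Fuel 0 v
  no-fuel {v} V p = <⇒≱ p (≤-trans (≤-reflexive (+-identityʳ (ell v))) (ell-≤ V))

  fuel-mulS : ∀ {f v k} → IsPerm n v → Adj n k → app v k < app v (suc k) → Fuel (suc f) v → Fuel f (mulS v k)
  fuel-mulS {f} {v} V A asc p = ≤-trans p (≤-reflexive (trans (+-suc (ell v) f) (cong (_+ f) (sym (ell-asc V A asc)))))

  full-fuel : ∀ v f → n * n < f → Fuel f v
  full-fuel v f p = ≤-trans p (m≤n+m f (ell v))

  GF-fuel : ∀ f f′ {v} → IsPerm n v → Fuel f v → Fuel f′ v → GF f v ≡ GF f′ v
  GF-fuel zero f′ V p q = contradiction p (no-fuel V)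
  GF-fuel (suc f) zero V p q = contradiction q (no-fuel V)
  GF-fuel (suc f) (suc f′) {v} V p q with firstAscent-view n v
  ... | inj₂ (e , _) rewrite e = refl
  ... | inj₁ (k , e , A , asc) rewrite e = cong (π k) (GF-fuel f f′ (mulS-perm V A) (fuel-mulS V A asc p) (fuel-mulS V A asc q))

  n²<n²+1 : n * n < n * n + 1
  n²<n²+1 = ≤-reflexive (+-comm 1 (n * n))

  -- The right-hand side is, by computation, `GF` with one more unit of fuel; unfolding is thus an
  -- instance of independence of the fuel.
  G-unfold : ∀ {v} → IsPerm n v → G v ≡ maybe (λ k → π k (G (mulS v k))) Δ (firstAscent n v)
  G-unfold {v} V = GF-fuel (n * n + 1) (suc (n * n + 1)) V (full-fuel v _ n²<n²+1) (full-fuel v _ (m≤n⇒m≤1+n n²<n²+1))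

  -- The recursion at an arbitrary ascent instead of the first one. It is proved by induction from
  -- longer to shorter permutations, completing the diamond formed by two ascents of v.
  Ascends : Perm → Set
  Ascends v = ∀ {k} → Adj n k → app v k < app v (suc k) → G v ≈ π k (G (mulS v k))

  module _ {v : Perm} (V : IsPerm n v) (ih : ∀ {u} → IsPerm n u → ell v < ell u → Ascends u) where
    ih-mulS : ∀ {k l} → Adj n k → app v k < app v (suc k) → Adj n l → app (mulS v k) l < app (mulS v k) (suc l) →
      G (mulS v k) ≈ π l (G (mulS (mulS v k) l))
    ih-mulS A asc B = ih (mulS-perm V A) (≤-reflexive (sym (ell-asc V A asc))) B

    diamond-far : ∀ {i k} → suc i < k → Adj n i → Adj n k → app v i < app v (suc i) → app v k < app v (suc k) →
      π i (G (mulS v i)) ≈ π k (G (mulS v k))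
    diamond-far {i} {k} lt A B a b = begin
      π i (G (mulS v i)) ≈⟨ resp (π-linear i) (ih-mulS A a B (subst₂ _<_ (sym (mulT-app-o V (Adj-l B) (i≢k ∘ sym) (si≢k ∘ sym)))
          (sym (mulT-app-o V (Adj-r B) (i≢sk ∘ sym) (i≢k ∘ sym ∘ suc-injective))) b)) ⟩
      π i (π k (G (mulS (mulS v i) k))) ≈⟨ π-comm A B lt _ ⟩
      π k (π i (G (mulS (mulS v i) k))) ≡⟨ cong (λ u → π k (π i (G u))) (mulS-comm V A B lt) ⟩
      π k (π i (G (mulS (mulS v k) i))) ≈⟨ ≈-sym (resp (π-linear k) (ih-mulS B b A (subst₂ _<_ (sym (mulT-app-o V (Adj-l A) i≢k i≢sk))
          (sym (mulT-app-o V (Adj-r A) si≢k (i≢k ∘ suc-injective))) a))) ⟩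
      π k (G (mulS v k)) ∎
      where
      i≢k : i ≢ k
      i≢k = <⇒≢ (<-trans (n<1+n i) lt)
      si≢k : suc i ≢ k
      si≢k = <⇒≢ lt
      i≢sk : i ≢ suc k
      i≢sk = <⇒≢ (m≤n⇒m≤1+n (<-trans (n<1+n i) lt))

    -- Here v increases along i, i + 1, i + 2. Both reduced words of the longest element of S₃ climb
    -- from v through ascents only and end at the same permutation, so the induction hypothesis
    -- reduces the claim to `π-braid`.
    diamond-near : ∀ {i} → Adj n i → Adj n (suc i) → app v i < app v (suc i) → app v (suc i) < app v (suc (suc i)) →
      π i (G (mulS v i)) ≈ π (suc i) (G (mulS v (suc i)))
    diamond-near {i} A B a b = begin
      π i (G (mulS v i)) ≈⟨ resp (π-linear i) (ih-mulS A a B b₁) ⟩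
      π i (π (suc i) (G (mulS (mulS v i) (suc i)))) ≈⟨ resp (∘-linear (π-linear i) (π-linear (suc i))) (ih (mulS-perm (mulS-perm V A) B) (up₂ A B a b₁) A c₁) ⟩
      π i (π (suc i) (π i (G (mulS (mulS (mulS v i) (suc i)) i)))) ≈⟨ π-braid A B _ ⟩
      π (suc i) (π i (π (suc i) (G (mulS (mulS (mulS v i) (suc i)) i)))) ≡⟨ cong (λ u → π (suc i) (π i (π (suc i) (G u)))) (mulS-braid V A B) ⟩
      π (suc i) (π i (π (suc i) (G (mulS (mulS (mulS v (suc i)) i) (suc i)))))
        ≈⟨ ≈-sym (resp (∘-linear (π-linear (suc i)) (π-linear i)) (ih (mulS-perm (mulS-perm V B) A) (up₂ B A b b₂) B c₂)) ⟩
      π (suc i) (π i (G (mulS (mulS v (suc i)) i))) ≈⟨ ≈-sym (resp (π-linear (suc i)) (ih-mulS B b A b₂)) ⟩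
      π (suc i) (G (mulS v (suc i))) ∎
      where
      up₂ : ∀ {k l} → (A : Adj n k) → Adj n l → app v k < app v (suc k) → app (mulS v k) l < app (mulS v k) (suc l) → ell v < ell (mulS (mulS v k) l)
      up₂ {k} A B a b = ≤-trans (s≤s (n≤1+n _)) (≤-reflexive (sym (trans (ell-asc (mulS-perm V A) B b) (cong suc (ell-asc V A a)))))
      i≢1 : i ≢ suc i
      i≢1 = <⇒≢ (n<1+n i)
      1≢2 : suc i ≢ suc (suc i)
      1≢2 = i≢1 ∘ suc-injective
      i≢2 : i ≢ suc (suc i)
      i≢2 = <⇒≢ (m≤n⇒m≤1+n (n<1+n i))
      i₀ = Adj-l A
      i₁ = Adj-r A
      i₂ = Adj-r B
      b₁ : app (mulS v i) (suc i) < app (mulS v i) (suc (suc i))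
      b₁ = subst₂ _<_ (sym (mulT-app-r V i₀ i₁)) (sym (mulT-app-o V i₂ (i≢2 ∘ sym) (1≢2 ∘ sym))) (<-trans a b)
      c₁ : app (mulS (mulS v i) (suc i)) i < app (mulS (mulS v i) (suc i)) (suc i)
      c₁ = subst₂ _<_ (sym (trans (mulT-app-o (mulS-perm V A) i₀ i≢1 i≢2) (mulT-app-l V i₀ i₁)))
        (sym (trans (mulT-app-l (mulS-perm V A) i₁ i₂) (mulT-app-o V i₂ (i≢2 ∘ sym) (1≢2 ∘ sym)))) b
      b₂ : app (mulS v (suc i)) i < app (mulS v (suc i)) (suc i)
      b₂ = subst₂ _<_ (sym (mulT-app-o V i₀ i≢1 i≢2)) (sym (mulT-app-l V i₁ i₂)) (<-trans a b)
      c₂ : app (mulS (mulS v (suc i)) i) (suc i) < app (mulS (mulS v (suc i)) i) (suc (suc i))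
      c₂ = subst₂ _<_ (sym (trans (mulT-app-r (mulS-perm V B) i₀ i₁) (mulT-app-o V i₀ i≢1 i≢2)))
        (sym (trans (mulT-app-o (mulS-perm V B) i₂ (i≢2 ∘ sym) (1≢2 ∘ sym)) (mulT-app-r V i₁ i₂))) a

    diamond : ∀ {i k} → i < k → Adj n i → Adj n k → app v i < app v (suc i) → app v k < app v (suc k) →
      π i (G (mulS v i)) ≈ π k (G (mulS v k))
    diamond {i} {k} lt A B a b with suc i ≟ k
    ... | yes refl = diamond-near A B a b
    ... | no ne = diamond-far (≤∧≢⇒< lt ne) A B a b

    ascends-step : Ascends v
    ascends-step {k} A asc with firstAscent-view n v
    ... | inj₂ (_ , none) = contradiction asc (none A)
    ... | inj₁ (i , e , B , b) = ≈-trans (≈-reflexive (trans (G-unfold V) (cong (maybe (λ k → π k (G (mulS v k))) Δ) e))) compare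
      where
      compare : π i (G (mulS v i)) ≈ π k (G (mulS v k))
      compare with <-cmp i k
      ... | tri< lt _ _ = diamond lt B A b asc
      ... | tri≈ _ refl _ = ≈-refl
      ... | tri> _ _ gt = ≈-sym (diamond gt A B asc b)

  ell-induction : (P : Perm → Set) → (∀ {v} → IsPerm n v → (∀ {u} → IsPerm n u → ell v < ell u → P u) → P v) → ∀ {v} → IsPerm n v → P v
  ell-induction P step {v} V = go (n * n + 1) V (full-fuel v _ n²<n²+1)
    where
    go : ∀ f {v} → IsPerm n v → Fuel f v → P v
    go zero V p = contradiction p (no-fuel V)
    go (suc f) V p = step V λ U lt → go f U (≤-trans p (≤-trans (≤-reflexive (+-suc _ f)) (+-monoˡ-≤ f lt)))

  G-asc : ∀ {v k} → IsPerm n v → Adj n k → app v k < app v (suc k) → G v ≈ π k (G (mulS v k))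
  G-asc V = ell-induction Ascends (λ V ih → ascends-step V ih) V

  G-desc : ∀ {v k} → IsPerm n v → Adj n k → app v (suc k) < app v k → G (mulS v k) ≈ π k (G v)
  G-desc V A d = ≈-trans (G-asc (mulS-perm V A) A (mulS-desc V A d)) (≈-reflexive (cong (λ u → π _ (G u)) (mulS-invol V A)))

  -- An ascent exhibits G v as a value of π_k, hence as symmetric. The terms that vanish in the
  -- transition formula and on passing to ℛ vanish for this reason.
  ∂-G : ∀ {v k} → IsPerm n v → Adj n k → app v k < app v (suc k) → ∂ k (G v) ≈ 𝟘
  ∂-G V A asc = ≈-trans (resp (∂-linear _) (G-asc V A asc)) (∂-π A _)

-- The sets φ_i(w) and the first dot off the antidiagonal

bool-ext : ∀ {a b} → (a ≡ true → b ≡ true) → (b ≡ true → a ≡ true) → a ≡ b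
bool-ext {true} f g = sym (f refl)
bool-ext {false} {true} f g = g refl
bool-ext {false} {false} f g = refl

∧-true : ∀ {a b} → (a ∧ b) ≡ true → a ≡ true × b ≡ true
∧-true {true} p = refl , p

anyB-elim : ∀ {A : Set} (f : A → Bool) xs → anyB (map f xs) ≡ true → ∃ λ x → x ∈ xs × f x ≡ true
anyB-elim f (x ∷ xs) p with f x in eq
... | true = x , here refl , eq
... | false = let (y , m , q) = anyB-elim f xs p in y , there m , q

anyB-intro : ∀ {A : Set} (f : A → Bool) {x xs} → x ∈ xs → f x ≡ true → anyB (map f xs) ≡ true
anyB-intro f (here refl) q rewrite q = refl
anyB-intro f {xs = y ∷ xs} (there m) q with f y
... | true = refl
... | false = anyB-intro f m q

filterB-cong : ∀ {A : Set} {p q : A → Bool} {xs} → All (λ x → p x ≡ q x) xs → filterB p xs ≡ filterB q xs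
filterB-cong [] = refl
filterB-cong {q = q} {x ∷ xs} (e ∷ es) rewrite e with q x
... | true = cong (x ∷_) (filterB-cong es)
... | false = filterB-cong es

filterB-filterB : ∀ {A : Set} (p q : A → Bool) xs → filterB p (filterB q xs) ≡ filterB (λ x → q x ∧ p x) xs
filterB-filterB p q [] = refl
filterB-filterB p q (x ∷ xs) with q x
... | false = filterB-filterB p q xs
... | true with p x
...   | true = cong (x ∷_) (filterB-filterB p q xs)
...   | false = filterB-filterB p q xs

filterB-none : ∀ {A : Set} {p : A → Bool} {xs} → All (λ x → p x ≡ false) xs → filterB p xs ≡ []
filterB-none [] = refl
filterB-none (e ∷ es) rewrite e = filterB-none es

All-filterB : ∀ {A : Set} {P : A → Set} (p : A → Bool) {xs} → All P xs → All (λ x → p x ≡ true × P x) (filterB p xs)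
All-filterB p [] = []
All-filterB p {x ∷ xs} (r ∷ rs) with p x in eq
... | true = (eq , r) ∷ All-filterB p rs
... | false = All-filterB p rs

AllPairs-filterB : ∀ {A : Set} {R : A → A → Set} (p : A → Bool) {xs} → AllPairs R xs → AllPairs R (filterB p xs)
AllPairs-filterB p [] = []
AllPairs-filterB p {x ∷ xs} (r ∷ rs) with p x
... | true = All.map proj₂ (All-filterB p r) ∷ AllPairs-filterB p rs
... | false = AllPairs-filterB p rs

sorted-range : ∀ n → AllPairs _<_ (range n)
sorted-range n = AllPairsProperties.applyUpTo⁺₁ suc n (λ i<j _ → s≤s i<j)

filterB-least : ∀ {k xs} (r : ℕ → Bool) → AllPairs _<_ xs → k ∈ xs → (∀ {a} → r a ≡ true → k < a) →
  filterB (λ a → (a ≡ᵇ k) ∨ r a) xs ≡ k ∷ filterB r xs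
filterB-least {k} {x ∷ xs} r (x< ∷ s) m h with x ≟ k
... | yes refl rewrite ≡ᵇ-refl x with r x in eq
...   | true = contradiction (h eq) (<-irrefl refl)
...   | false = cong (x ∷_) (filterB-cong (All.map (λ {a} x<a → cong (_∨ r a) (≢⇒≡ᵇ (<⇒≢ x<a ∘ sym))) x<))
filterB-least {k} {x ∷ xs} r (x< ∷ s) (here refl) h | no x≢k = contradiction refl x≢k
filterB-least {k} {x ∷ xs} r (x< ∷ s) (there m) h | no x≢k rewrite ≢⇒≡ᵇ x≢k with r x in eq
... | true = contradiction (All.lookup x< m) (<⇒≯ (h eq))
... | false = filterB-least r s m h

record Exposed (n : ℕ) (w : Perm) (i a : ℕ) : Set where
  constructor exposed
  field
    right-of : i < a
    above : app w i < app w a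
    unblocked : ∀ {a′} → In n a′ → i < a′ → a′ < a → app w i < app w a′ → ¬ app w a′ < app w a
open Exposed public

module _ (n : ℕ) (w : Perm) (i : ℕ) where
  blockᵇ : ℕ → ℕ → Bool
  blockᵇ a a′ = (i <ᵇ a′) ∧ (a′ <ᵇ a) ∧ (app w i <ᵇ app w a′) ∧ (app w a′ <ᵇ app w a)

  exposedᵇ : ℕ → Bool
  exposedᵇ a = (i <ᵇ a) ∧ (app w i <ᵇ app w a) ∧ not (anyB (map (blockᵇ a) (range n)))

  exposedᵇ⇒ : ∀ {a} → exposedᵇ a ≡ true → Exposed n w i a
  exposedᵇ⇒ {a} p = let (q , r) = ∧-true {i <ᵇ a} p ; (s , t) = ∧-true {app w i <ᵇ app w a} r in
    exposed (<ᵇ≡⇒< q) (<ᵇ≡⇒< s) (λ j b c d e → true≢false (trans (sym t)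
      (cong not (anyB-intro (blockᵇ a) (In⇒∈-range j) (cong₂ _∧_ (<⇒<ᵇ≡ b)
        (cong₂ _∧_ (<⇒<ᵇ≡ c) (cong₂ _∧_ (<⇒<ᵇ≡ d) (<⇒<ᵇ≡ e))))))))

  ⇒exposedᵇ : ∀ {a} → Exposed n w i a → exposedᵇ a ≡ true
  ⇒exposedᵇ {a} (exposed p q h) rewrite <⇒<ᵇ≡ p | <⇒<ᵇ≡ q with anyB (map (blockᵇ a) (range n)) in eq
  ... | false = refl
  ... | true = let (a′ , m , r) = anyB-elim (blockᵇ a) (range n) eq
                   (s , t) = ∧-true {i <ᵇ a′} r
                   (u , v) = ∧-true {a′ <ᵇ a} t
                   (x , y) = ∧-true {app w i <ᵇ app w a′} v
               in contradiction (<ᵇ≡⇒< y) (h (∈-range⇒In m) (<ᵇ≡⇒< s) (<ᵇ≡⇒< u) (<ᵇ≡⇒< x))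

  phi-exposed : All (λ a → Exposed n w i a × In n a) (phi n w i)
  phi-exposed = All.map (λ (p , q) → exposedᵇ⇒ p , q) (All-filterB exposedᵇ (All-range {In n} n (λ k p → p)))

  phi-sorted : AllPairs _<_ (phi n w i)
  phi-sorted = AllPairs-filterB exposedᵇ (sorted-range n)

  Decreasing : ℕ → ℕ → Set
  Decreasing x y = x < y × app w y < app w x

  -- Of two exposed positions, the earlier would block the later if its value were smaller.
  phi-decreasing : IsPerm n w → AllPairs Decreasing (phi n w i)
  phi-decreasing W = go phi-exposed phi-sorted
    where
    go : ∀ {xs} → All (λ a → Exposed n w i a × In n a) xs → AllPairs _<_ xs → AllPairs Decreasing xs
    go [] [] = []
    go {x ∷ xs} ((e , p) ∷ es) (x< ∷ s) = All.zipWith (λ { ((f , q) , x<y) → x<y , ≤∧≢⇒< (≮⇒≥ (unblocked f p (right-of e) x<y (above e)))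
      (λ eq → <⇒≢ x<y (sym (inj W q p eq))) }) (es , x<) ∷ go es s

module _ {n : ℕ} {w : Perm} {i : ℕ} (W : IsPerm n w) (A : Adj n i) (asc : app w i < app w (suc i)) where
  mulS-at-right : app (mulS w i) (suc i) ≡ app w i
  mulS-at-right = mulT-app-r W (Adj-l A) (Adj-r A)

  mulS-beyond : ∀ {a} → In n a → suc i < a → app (mulS w i) a ≡ app w a
  mulS-beyond p lt = mulT-app-o W p (<⇒≢ (<-trans (n<1+n i) lt) ∘ sym) (<⇒≢ lt ∘ sym)

  -- Seen from i, position i + 1 is exposed and blocks exactly the later positions of value above
  -- w(i+1). All other blocking is the same for w at i and for ws_i at i + 1, because the two dots
  -- have the same value.
  exposed-mulS : ∀ {a} → In n a → exposedᵇ n w i a ≡ (a ≡ᵇ suc i) ∨ (exposedᵇ n (mulS w i) (suc i) a ∧ (app w a <ᵇ app w (suc i)))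
  exposed-mulS {a} p with a ≟ suc i
  ... | yes refl rewrite ≡ᵇ-refl a = ⇒exposedᵇ n w i (exposed (n<1+n i) asc (λ _ l r _ → contradiction (≤-trans r l) (<-irrefl refl)))
  ... | no ne rewrite ≢⇒≡ᵇ ne = bool-ext to from
    where
    to : exposedᵇ n w i a ≡ true → (exposedᵇ n (mulS w i) (suc i) a ∧ (app w a <ᵇ app w (suc i))) ≡ true
    to t = cong₂ _∧_ (⇒exposedᵇ n (mulS w i) (suc i) (exposed gt (subst₂ _<_ (sym mulS-at-right) (sym (mulS-beyond p gt)) (above e))
        λ q l r u v → unblocked e q (<-trans (n<1+n i) l) r (subst₂ _<_ mulS-at-right (mulS-beyond q l) u)
          (subst₂ _<_ (mulS-beyond q l) (mulS-beyond p gt) v)))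
        (<⇒<ᵇ≡ (≤∧≢⇒< (≮⇒≥ (unblocked e (Adj-r A) (n<1+n i) gt asc)) (ne ∘ inj W p (Adj-r A))))
      where
      e = exposedᵇ⇒ n w i t
      gt : suc i < a
      gt = ≤∧≢⇒< (right-of e) (ne ∘ sym)
    from : (exposedᵇ n (mulS w i) (suc i) a ∧ (app w a <ᵇ app w (suc i))) ≡ true → exposedᵇ n w i a ≡ true
    from t = ⇒exposedᵇ n w i (exposed (<-trans (n<1+n i) (right-of e)) (subst₂ _<_ mulS-at-right (mulS-beyond p (right-of e)) (above e)) unb)
      where
      both = ∧-true {exposedᵇ n (mulS w i) (suc i) a} t
      e = exposedᵇ⇒ n (mulS w i) (suc i) (proj₁ both)
      unb : ∀ {a′} → In n a′ → i < a′ → a′ < a → app w i < app w a′ → ¬ app w a′ < app w a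
      unb {a′} q l r u v with a′ ≟ suc i
      ... | yes refl = <⇒≯ v (<ᵇ≡⇒< (proj₂ both))
      ... | no ne′ = let l′ = ≤∧≢⇒< l (ne′ ∘ sym) in unblocked e q l′ r (subst₂ _<_ (sym mulS-at-right) (sym (mulS-beyond q l′)) u)
          (subst₂ _<_ (sym (mulS-beyond q l′)) (sym (mulS-beyond p (right-of e))) v)

  phi-mulS : phi n w i ≡ suc i ∷ filterB (λ a → app w a <ᵇ app w (suc i)) (phi n (mulS w i) (suc i))
  phi-mulS = begin
    filterB (exposedᵇ n w i) (range n) ≡⟨ filterB-cong (All-range n (λ k p → exposed-mulS p)) ⟩
    filterB (λ a → (a ≡ᵇ suc i) ∨ r a) (range n) ≡⟨ filterB-least r (sorted-range n) (In⇒∈-range (Adj-r A))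
      (λ {a} t → right-of (exposedᵇ⇒ n (mulS w i) (suc i) (proj₁ (∧-true {exposedᵇ n (mulS w i) (suc i) a} t)))) ⟩
    suc i ∷ filterB r (range n) ≡⟨ cong (suc i ∷_) (sym (filterB-filterB (λ a → app w a <ᵇ app w (suc i)) (exposedᵇ n (mulS w i) (suc i)) (range n))) ⟩
    suc i ∷ filterB (λ a → app w a <ᵇ app w (suc i)) (phi n (mulS w i) (suc i)) ∎
    where
    open ≡-Reasoning
    r : ℕ → Bool
    r a = exposedᵇ n (mulS w i) (suc i) a ∧ (app w a <ᵇ app w (suc i))

-- For S = i₁ < ... < i_k the fold applies i_k first and yields w t_{i,i_k} ... t_{i,i_1}; `U-foldl`
-- identifies it with the left fold over the reversed list in `PhiBar`.
U : Perm → ℕ → List ℕ → Perm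
U w i S = foldr (λ a v → mulT v i a) w S

U-foldl : ∀ w i S → foldl (λ v a → mulT v i a) w (reverse S) ≡ U w i S
U-foldl w i S = trans (sym (reverse-foldr (λ a v → mulT v i a) w (reverse S))) (cong (foldr (λ a v → mulT v i a) w) (reverse-involutive S))

U-perm : ∀ {n w i S} → IsPerm n w → In n i → All (In n) S → IsPerm n (U w i S)
U-perm W p [] = W
U-perm W p (q ∷ qs) = mulT-perm (U-perm W p qs) p q

U-other : ∀ {n w i S k} → IsPerm n w → In n i → All (In n) S → In n k → k ≢ i → All (k ≢_) S → app (U w i S) k ≡ app w k
U-other W p [] r ne [] = refl
U-other W p (q ∷ qs) r ne (m ∷ ms) = trans (mulT-app-o (U-perm W p qs) r ne m) (U-other W p qs r ne ms)

U-head : ∀ {n w i x S} → IsPerm n w → In n i → In n x → All (In n) S → x ≢ i → All (x ≢_) S → app (U w i (x ∷ S)) i ≡ app w x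
U-head W p q qs ne m = trans (mulT-app-l (U-perm W p qs) p q) (U-other W p qs q ne m)

-- The final s_i is pulled inwards past each t_{i,x} by t_{i,x} s_i = s_i t_{i+1,x} until it reaches
-- w.
U-mulS : ∀ {n w i S} → IsPerm n w → Adj n i → All (λ a → In n a × suc i < a) S → U w i (suc i ∷ S) ≡ U (mulS w i) (suc i) S
U-mulS W A [] = refl
U-mulS {n} {w} {i} {x ∷ S} W A ((q , lt) ∷ qs) = begin
  mulS (mulT v i x) i ≡⟨ cong (λ u → mulS u i) (mulT-comm V i₀ q) ⟩
  mulS (mulT v x i) i ≡⟨ cong (λ u → mulS (mulT u x i) i) (sym (mulS-invol V A)) ⟩
  mulT (mulT (mulT u i (suc i)) x i) i (suc i) ≡⟨ mulT-conj (mulS-perm V A) q i₀ (Adj-r A) (<⇒≢ (n<1+n i)) (<⇒≢ (<-trans (n<1+n i) lt) ∘ sym) (<⇒≢ lt ∘ sym) ⟩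
  mulT u x (suc i) ≡⟨ mulT-comm (mulS-perm V A) q (Adj-r A) ⟩
  mulT u (suc i) x ≡⟨ cong (λ u → mulT u (suc i) x) (U-mulS W A qs) ⟩
  mulT (U (mulS w i) (suc i) S) (suc i) x ∎
  where
  open ≡-Reasoning
  i₀ = Adj-l A
  v = U w i S
  u = mulS v i
  V : IsPerm n v
  V = U-perm W i₀ (All.map proj₁ qs)

-- The properties of φ_i(w) that its sublists inherit.
record Chain (n : ℕ) (w : Perm) (i : ℕ) (S : List ℕ) : Set where
  constructor chain
  field
    members : All (λ a → Exposed n w i a × In n a) S
    decreasing : AllPairs (Decreasing n w i) S
open Chain public

chain-In : ∀ {n w i S} → Chain n w i S → All (In n) S
chain-In c = All.map proj₂ (members c)

data NonEmpty {A : Set} : List A → Set where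
  nonEmpty : ∀ {x xs} → NonEmpty (x ∷ xs)

subsets-All : ∀ {P : ℕ → Set} {R : ℕ → ℕ → Set} {xs} → All P xs → AllPairs R xs → All (λ S → All P S × AllPairs R S) (subsets xs)
subsets-All [] [] = ([] , []) ∷ []
subsets-All {P} {R} {x ∷ xs} (p ∷ ps) (r ∷ rs) =
  All.++⁺ (All.map⁺ (All.map (λ ((q , s) , t) → p ∷ q , t ∷ s) (All.zip (subsets-All ps rs , All.map proj₁ (subsets-All r rs))))) (subsets-All ps rs)

neSubsets-All : ∀ {P : ℕ → Set} {R : ℕ → ℕ → Set} {xs} → All P xs → AllPairs R xs →
  All (λ S → NonEmpty S × All P S × AllPairs R S) (neSubsets xs)
neSubsets-All [] [] = []
neSubsets-All {P} {R} {x ∷ xs} (p ∷ ps) (r ∷ rs) =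
  All.++⁺ (All.map⁺ (All.map (λ ((q , s) , t) → nonEmpty , p ∷ q , t ∷ s) (All.zip (subsets-All ps rs , All.map proj₁ (subsets-All r rs))))) (neSubsets-All ps rs)

phi-chains : ∀ {n w} i → IsPerm n w → All (λ S → NonEmpty S × Chain n w i S) (neSubsets (phi n w i))
phi-chains {n} {w} i W = All.map (λ (e , p , r) → e , chain p r) (neSubsets-All (phi-exposed n w i) (phi-decreasing n w i W))

-- Before t_{i,x} acts, position i holds w(i) or the value of w at the head of S. Both lie below
-- w(x), which is still at x, so `ell-mulT` applies.
U-step-ell : ∀ {n w i x S} → IsPerm n w → In n i → Chain n w i (x ∷ S) → ell (U w i S) < ell (U w i (x ∷ S))
U-step-ell {n} {w} {i} {x} W p (chain ((e , q) ∷ es) (d ∷ ds)) = ell-mulT (U-perm W p (All.map proj₂ es)) p q (right-of e)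
  (subst₂ _<_ refl (sym (U-other W p (All.map proj₂ es) q (<⇒≢ (right-of e) ∘ sym) (All.map (<⇒≢ ∘ proj₁) d))) (lower es ds d))
  where
  lower : ∀ {S} → All (λ a → Exposed n w i a × In n a) S → AllPairs (Decreasing n w i) S → All (Decreasing n w i x) S → app (U w i S) i < app w x
  lower [] [] [] = above e
  lower ((f , r) ∷ fs) (c ∷ _) (b ∷ _) = subst (_< app w x)
    (sym (U-head W p r (All.map proj₂ fs) (<⇒≢ (right-of f) ∘ sym) (All.map (<⇒≢ ∘ proj₁) c))) (proj₂ b)

chain-tail : ∀ {n w i x S} → Chain n w i (x ∷ S) → Chain n w i S
chain-tail (chain (_ ∷ es) (_ ∷ ds)) = chain es ds

U-ell : ∀ {n w i S} → IsPerm n w → In n i → Chain n w i S → ell w + length S ≤ ell (U w i S)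
U-ell {w = w} {S = []} W p c = ≤-reflexive (+-identityʳ (ell w))
U-ell {w = w} {S = x ∷ S} W p c = ≤-trans (≤-reflexive (+-suc (ell w) (length S))) (≤-trans (s≤s (U-ell W p (chain-tail c))) (U-step-ell W p c))

U-ell-< : ∀ {n w i S} → IsPerm n w → In n i → NonEmpty S → Chain n w i S → ell w < ell (U w i S)
U-ell-< {w = w} W p (nonEmpty {xs = S}) c = ≤-trans (≤-trans (s≤s (m≤m+n (ell w) (length S))) (≤-reflexive (sym (+-suc (ell w) (length S))))) (U-ell W p c)

-- Agreement with w₀ in all columns left of j.
Tail : ℕ → ℕ → Perm → Set
Tail n j w = ∀ {a b} → In n a → b < j → a + b ≡ suc n → app w a ≡ b

-- The dot of w in the first column j in which w and w₀ differ; this is the addable cell of dom(w) in column α(w).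
record Corner (n : ℕ) (w : Perm) (j i : ℕ) : Set where
  field
    row-In : In n i
    dot : app w i ≡ j
    inside : i + j ≤ n
    tail : Tail n j w
open Corner public

module _ {n : ℕ} {w : Perm} (W : IsPerm n w) where
  -- A value b < j sits in row n + 1 - b, strictly below all rows up to n + 1 - j.
  large : ∀ {j k} → Tail n j w → In n k → k + j ≤ suc n → j ≤ app w k
  large {j} {k} t p le with app w k <? j
  ... | no ge = ≮⇒≥ ge
  ... | yes lt = contradiction le (<⇒≱ (subst (_< k + j) sum (+-monoʳ-< k lt)))
    where
    b = app w k
    a = suc n ∸ b
    a+b : a + b ≡ suc n
    a+b = m∸n+n≡m (m≤n⇒m≤1+n (proj₂ (bound W p)))
    a-In : In n a
    a-In = m<n⇒0<n∸m (s≤s (proj₂ (bound W p))) , (begin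
      suc n ∸ b ≤⟨ ∸-monoʳ-≤ (suc n) (proj₁ (bound W p)) ⟩
      n ∎)
      where open ≤-Reasoning
    sum : k + b ≡ suc n
    sum = trans (cong (_+ b) (inj W p a-In (sym (t a-In lt a+b)))) a+b

  corner-large : ∀ {j i k} → Corner n w j i → In n k → k + j ≤ suc n → k ≢ i → j < app w k
  corner-large c p le ne = ≤∧≢⇒< (large (tail c) p le) (λ e → ne (inj W p (row-In c) (trans (sym e) (sym (dot c)))))

  corner-1≤j : ∀ {j i} → Corner n w j i → 1 ≤ j
  corner-1≤j c = subst (1 ≤_) (dot c) (proj₁ (bound W (row-In c)))

  corner-Adj : ∀ {j i} → Corner n w j i → Adj n i
  corner-Adj {j} {i} c = proj₁ (row-In c) , ≤-trans (≤-reflexive (+-comm 1 i)) (≤-trans (+-monoʳ-≤ i (corner-1≤j c)) (inside c))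

  corner-asc : ∀ {j i} → Corner n w j i → app w i < app w (suc i)
  corner-asc c = subst (_< app w (suc _)) (sym (dot c)) (corner-large c (Adj-r (corner-Adj c)) (s≤s (inside c)) (<⇒≢ (n<1+n _) ∘ sym))

  -- The number m is the row of the antidiagonal cell in column j. If the dot of column j is there,
  -- the search moves one column to the right. Otherwise the dot lies strictly above the
  -- antidiagonal, since the rows below that cell are occupied by smaller values.
  find-corner : ∀ m j → j + m ≡ suc n → 1 ≤ j → Tail n j w → (∃ λ j′ → ∃ λ i → j ≤ j′ × Corner n w j′ i) ⊎ w ≡ w0 n
  find-corner zero j e 1≤j t = inj₂ (app-ext (len W) (trans (length-reverse (range n)) (length-range n)) λ k p →
    trans (t p (subst (suc n ∸ k <_) (sym (trans (sym (+-identityʳ j)) e)) (s≤s (≤-trans (∸-monoʳ-≤ (suc n) (proj₁ p)) ≤-refl))) (m+[n∸m]≡n (m≤n⇒m≤1+n (proj₂ p))))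
      (sym (app-w0 p)))
  find-corner (suc m) j e 1≤j t with app w (suc m) ≟ j
  ... | yes q with find-corner m (suc j) (trans (sym (+-suc j m)) e) (s≤s z≤n) tail′
    where
    tail′ : Tail n (suc j) w
    tail′ {a} {b} p lt eq with b ≟ j
    ... | no b≢j = t p (≤∧≢⇒< (s≤s⁻¹ lt) b≢j) eq
    ... | yes refl = trans (cong (app w) (+-cancelˡ-≡ b a (suc m) (trans (+-comm b a) (trans eq (sym e))))) q
  ...   | inj₁ (j′ , i , le , c) = inj₁ (j′ , i , ≤-trans (n≤1+n j) le , c)
  ...   | inj₂ eq = inj₂ eq
  find-corner (suc m) j e 1≤j t | no q = inj₁ (j , i , ≤-refl , record { row-In = i-In ; dot = d ; inside = s≤s⁻¹ (≤∧≢⇒< (≮⇒≥ not-beyond) not-on) ; tail = t })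
    where
    j-In : In n j
    j-In = 1≤j , s≤s⁻¹ (≤-trans (≤-reflexive (+-comm 1 j)) (≤-trans (+-monoʳ-≤ j (s≤s (z≤n {m}))) (≤-reflexive e)))
    i = proj₁ (surj W j-In)
    i-In = proj₁ (proj₂ (surj W j-In))
    d : app w i ≡ j
    d = proj₂ (proj₂ (surj W j-In))
    not-on : i + j ≢ suc n
    not-on eq = q (trans (cong (app w) (sym (+-cancelˡ-≡ j i (suc m) (trans (+-comm j i) (trans eq (sym e)))))) d)
    not-beyond : ¬ suc n < i + j
    not-beyond lt = <⇒≢ b<j (trans (sym (t i-In b<j i+b)) d)
      where
      i+b : i + (suc n ∸ i) ≡ suc n
      i+b = m+[n∸m]≡n (m≤n⇒m≤1+n (proj₂ i-In))
      b<j : suc n ∸ i < j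
      b<j = +-cancelˡ-< i _ _ (subst (_< i + j) (sym i+b) lt)

  corner-or-w0 : (∃ λ j → ∃ λ i → Corner n w j i) ⊎ w ≡ w0 n
  corner-or-w0 with find-corner n 1 refl ≤-refl t
    where
    t : Tail n 1 w
    t {a} {zero} p lt eq = contradiction (trans (sym (+-identityʳ a)) eq) (<⇒≢ (s≤s (proj₂ p)))
    t {b = suc b} p (s≤s ()) eq
  ... | inj₁ (j , i , _ , c) = inj₁ (j , i , c)
  ... | inj₂ e = inj₂ e

  corner-mulS : ∀ {j i} → Corner n w j i → suc i + j ≤ n → Corner n (mulS w i) j (suc i)
  corner-mulS {j} {i} c le = record { row-In = Adj-r A ; dot = trans (mulT-app-r W (Adj-l A) (Adj-r A)) (dot c) ; inside = le ; tail = t }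
    where
    A = corner-Adj c
    t : Tail n j (mulS w i)
    t {a} {b} p lt eq = trans (mulT-app-o W p (λ { refl → <⇒≢ (<-trans (+-monoʳ-< a lt) (s≤s (inside c))) eq })
      (λ { refl → <⇒≢ (<-trans (+-monoʳ-< a lt) (s≤s le)) eq })) (tail c p lt eq)

  corner-w0 : ∀ {j i} → Corner n w j i → w ≢ w0 n
  corner-w0 {j} {i} c refl = <⇒≢ (s≤s (inside c)) (trans (cong (λ x → i + x) (trans (sym (dot c)) (app-w0 (row-In c)))) (m+[n∸m]≡n (m≤n⇒m≤1+n (proj₂ (row-In c)))))

  -- Position i holds j and exposed positions hold larger values, so the transpositions leave all
  -- smaller values in place.
  tail-U : ∀ {j k i S} → Corner n w j i → k ≤ j → Chain n w i S → Tail n k (U w i S)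
  tail-U {j} {k} {i} {S} c k≤j s {a} {b} p lt eq = trans (U-other W (row-In c) (chain-In s) p
      (λ { refl → <⇒≢ (<-≤-trans lt k≤j) (trans (sym at-a) (dot c)) })
      (All.map (λ { (e , _) refl → <⇒≱ (subst₂ _<_ (dot c) at-a (above e)) (<⇒≤ (<-≤-trans lt k≤j)) }) (members s))) at-a
    where
    at-a : app w a ≡ b
    at-a = tail c p (<-≤-trans lt k≤j) eq

-- Transition formula

module Sums {n : ℕ} (A : LaurentAlgebra n) where
  open LaurentAlgebra A

  Σ : ∀ {B : Set} → (B → M) → List B → M
  Σ h [] = 𝟘
  Σ h (x ∷ xs) = h x ⊕ Σ h xs

  Σ-cong : ∀ {B : Set} {h g : B → M} {xs} → All (λ x → h x ≈ g x) xs → Σ h xs ≈ Σ g xs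
  Σ-cong [] = ≈-refl
  Σ-cong (p ∷ ps) = ⊕-cong p (Σ-cong ps)

  Σ-zero : ∀ {B : Set} {h : B → M} {xs} → All (λ x → h x ≈ 𝟘) xs → Σ h xs ≈ 𝟘
  Σ-zero [] = ≈-refl
  Σ-zero (p ∷ ps) = ≈-trans (⊕-cong p (Σ-zero ps)) (⊕-identityʳ 𝟘)

  Σ-++ : ∀ {B : Set} (h : B → M) xs ys → Σ h (xs ++ ys) ≈ Σ h xs ⊕ Σ h ys
  Σ-++ h [] ys = ≈-sym (⊕-identityˡ _)
  Σ-++ h (x ∷ xs) ys = ≈-trans (⊕-cong ≈-refl (Σ-++ h xs ys))
    (coefficientwise (⟨ h x ⟩ :+ (⟨ Σ h xs ⟩ :+ ⟨ Σ h ys ⟩)) (⟨ h x ⟩ :+ ⟨ Σ h xs ⟩ :+ ⟨ Σ h ys ⟩)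
      (λ e → sym (ℤ.+-assoc (coef (h x) e) (coef (Σ h xs) e) (coef (Σ h ys) e))))

  Σ-map : ∀ {B C : Set} (h : C → M) (f : B → C) xs → Σ h (map f xs) ≡ Σ (λ x → h (f x)) xs
  Σ-map h f [] = refl
  Σ-map h f (x ∷ xs) = cong (λ m → h (f x) ⊕ m) (Σ-map h f xs)

  Σ-concatMap : ∀ {B C : Set} (h : C → M) (f : B → List C) xs → Σ h (concatMap f xs) ≈ Σ (λ x → Σ h (f x)) xs
  Σ-concatMap h f [] = ≈-refl
  Σ-concatMap h f (x ∷ xs) = ≈-trans (Σ-++ h (f x) (concatMap f xs)) (⊕-cong ≈-refl (Σ-concatMap h f xs))

  Σ-linear : ∀ {B : Set} {F} → Linear F → ∀ (h : B → M) xs → F (Σ h xs) ≈ Σ (λ x → F (h x)) xs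
  Σ-linear L h [] = linear-𝟘 L
  Σ-linear L h (x ∷ xs) = ≈-trans (add L _ _) (⊕-cong ≈-refl (Σ-linear L h xs))

  Σ-⊕ : ∀ {B : Set} (h g : B → M) xs → Σ (λ x → h x ⊕ g x) xs ≈ Σ h xs ⊕ Σ g xs
  Σ-⊕ h g [] = ≈-sym (⊕-identityʳ 𝟘)
  Σ-⊕ h g (x ∷ xs) = ≈-trans (⊕-cong ≈-refl (Σ-⊕ h g xs))
    (coefficientwise (⟨ h x ⟩ :+ ⟨ g x ⟩ :+ (⟨ Σ h xs ⟩ :+ ⟨ Σ g xs ⟩)) (⟨ h x ⟩ :+ ⟨ Σ h xs ⟩ :+ (⟨ g x ⟩ :+ ⟨ Σ g xs ⟩))
      (λ e → lemma (coef (h x) e) (coef (g x) e) (coef (Σ h xs) e) (coef (Σ g xs) e)))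
    where
    lemma : ∀ a b c d → a ℤ.+ b ℤ.+ (c ℤ.+ d) ≡ a ℤ.+ c ℤ.+ (b ℤ.+ d)
    lemma = solve-∀

  Σ-filterB : ∀ {B : Set} (h : B → M) (p : B → Bool) xs → Σ h (filterB p xs) ≈ Σ (λ x → if p x then h x else 𝟘) xs
  Σ-filterB h p [] = ≈-refl
  Σ-filterB h p (x ∷ xs) with p x
  ... | true = ⊕-cong ≈-refl (Σ-filterB h p xs)
  ... | false = ≈-trans (Σ-filterB h p xs) (≈-sym (⊕-identityˡ _))

  Σ-subsets : ∀ (h : List ℕ → M) xs → Σ h (subsets xs) ≈ h [] ⊕ Σ h (neSubsets xs)
  Σ-subsets h [] = ≈-refl
  Σ-subsets h (x ∷ xs) = begin
    Σ h (map (x ∷_) (subsets xs) ++ subsets xs) ≈⟨ Σ-++ h (map (x ∷_) (subsets xs)) (subsets xs) ⟩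
    Σ h (map (x ∷_) (subsets xs)) ⊕ Σ h (subsets xs) ≈⟨ ⊕-cong ≈-refl (Σ-subsets h xs) ⟩
    Σ h (map (x ∷_) (subsets xs)) ⊕ (h [] ⊕ Σ h (neSubsets xs))
      ≈⟨ coefficientwise (⟨ a ⟩ :+ (⟨ h [] ⟩ :+ ⟨ Σ h (neSubsets xs) ⟩)) (⟨ h [] ⟩ :+ (⟨ a ⟩ :+ ⟨ Σ h (neSubsets xs) ⟩))
           (λ e → lemma (coef a e) (coef (h []) e) (coef (Σ h (neSubsets xs)) e)) ⟩
    h [] ⊕ (Σ h (map (x ∷_) (subsets xs)) ⊕ Σ h (neSubsets xs)) ≈⟨ ⊕-cong ≈-refl (≈-sym (Σ-++ h (map (x ∷_) (subsets xs)) (neSubsets xs))) ⟩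
    h [] ⊕ Σ h (neSubsets (x ∷ xs)) ∎
    where
    open import Relation.Binary.Reasoning.Setoid ≈-setoid
    a = Σ h (map (x ∷_) (subsets xs))
    lemma : ∀ a b c → a ℤ.+ (b ℤ.+ c) ≡ b ℤ.+ (a ℤ.+ c)
    lemma = solve-∀

  headᵇ : (ℕ → Bool) → List ℕ → Bool
  headᵇ p [] = false
  headᵇ p (x ∷ xs) = p x

  -- As p passes from each entry to all later ones, it holds on the whole of a subset as soon as it
  -- holds at the head.
  Σ-neSubsets-filterB : ∀ (h : List ℕ → M) (p : ℕ → Bool) {xs} → AllPairs (λ x y → p x ≡ true → p y ≡ true) xs →
    Σ (λ S → if headᵇ p S then h S else 𝟘) (neSubsets xs) ≈ Σ h (neSubsets (filterB p xs))
  Σ-neSubsets-filterB h p [] = ≈-refl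
  Σ-neSubsets-filterB h p {x ∷ xs} (r ∷ rs) with p x in eq
  ... | false = ≈-trans (Σ-++ _ (map (x ∷_) (subsets xs)) (neSubsets xs)) (≈-trans (⊕-cong
        (≈-trans (≈-reflexive (Σ-map _ (x ∷_) (subsets xs))) (Σ-zero (All.universal (λ S → ≈-reflexive (cong (λ b → if b then h (x ∷ S) else 𝟘) eq)) (subsets xs))))
        (Σ-neSubsets-filterB h p rs)) (⊕-identityˡ _))
  ... | true = ≈-trans (Σ-++ _ (map (x ∷_) (subsets xs)) (neSubsets xs)) (≈-trans (⊕-cong
        (≈-trans (≈-reflexive (Σ-map _ (x ∷_) (subsets xs))) (≈-trans
          (Σ-cong (All.universal (λ S → ≈-reflexive (cong (λ b → if b then h (x ∷ S) else 𝟘) eq)) (subsets xs)))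
          (≈-reflexive (trans (sym (Σ-map h (x ∷_) (subsets xs))) (cong (λ ys → Σ h (map (x ∷_) (subsets ys))) (sym all))))))
        (Σ-neSubsets-filterB h p rs)) (≈-sym (Σ-++ h (map (x ∷_) (subsets (filterB p xs))) (neSubsets (filterB p xs)))))
    where
    filterB-all : ∀ {ys} → All (λ y → true ≡ true → p y ≡ true) ys → filterB p ys ≡ ys
    filterB-all [] = refl
    filterB-all {y ∷ ys} (q ∷ qs) rewrite q refl = cong (y ∷_) (filterB-all qs)
    all : filterB p xs ≡ xs
    all = filterB-all r

module Transition {n : ℕ} (A : LaurentAlgebra n) (β : ℤ) where
  open LaurentAlgebra A
  open Demazure A β
  open Grothendieck A β
  open Sums A
  open import Relation.Binary.Reasoning.Setoid ≈-setoid

  -- The exponent ℓ(u) - ℓ(w) - 1 is recorded as the size of S minus one. At β = 0 the convention 0⁰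
  -- = 1 keeps exactly the singletons.
  weight : List ℕ → ℤ
  weight S = β ℤ.^ pred (length S)

  term : Perm → ℕ → List ℕ → M
  term w i S = weight S · G (U w i S)

  Transition : Perm → ℕ → Set
  Transition w i = X i (G w) ≈ Σ (term w i) (neSubsets (phi n w i))

  -- On functions symmetric in x_i, x_{i+1} the operator π_i is multiplication by -β, so adding β
  -- produces an operator that annihilates them.
  K : ℕ → M → M
  K i f = π i f ⊕ β · f

  K-linear : ∀ i → Linear (K i)
  K-linear i = ⊕-linear (π-linear i) (·-linear β id-linear)

  ∂⇒K : ∀ {i f} → Adj n i → ∂ i f ≈ 𝟘 → K i f ≈ 𝟘
  ∂⇒K {i} {f} A p = ≈-trans (⊕-cong (π-fixed A p) ≈-refl) (coefficientwise ((- β) :* ⟨ f ⟩ :+ β :* ⟨ f ⟩) :0 (λ e → lemma β (coef f e)))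
    where
    lemma : ∀ b a → (- b) ℤ.* a ℤ.+ b ℤ.* a ≡ + 0
    lemma = solve-∀

  X-π : ∀ {i} → Adj n i → ∀ f → X i (π i f) ≈ f ⊕ K i (X (suc i) f)
  X-π {i} A f = begin
    -- Adding and subtracting (1 + β x_{i+1}) f makes `π-Xʳ` applicable from right to left.
    X i (π i f) ≈⟨ coefficientwise ⟨ X i (π i f) ⟩ (⟨ X i (π i f) ⟩ :+ -[1+ 0 ] :* (⟨ f ⟩ :+ β :* ⟨ X (suc i) f ⟩) :+ (⟨ f ⟩ :+ β :* ⟨ X (suc i) f ⟩))
         (λ e → lemma (coef (X i (π i f)) e) (coef f e ℤ.+ β ℤ.* coef (X (suc i) f) e)) ⟩
    X i (π i f) ⊕ -[1+ 0 ] · θ (suc i) f ⊕ θ (suc i) f ≈⟨ ⊕-cong (≈-sym (π-Xʳ A f)) ≈-refl ⟩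
    π i (X (suc i) f) ⊕ (f ⊕ β · X (suc i) f)
      ≈⟨ coefficientwise (⟨ π i (X (suc i) f) ⟩ :+ (⟨ f ⟩ :+ β :* ⟨ X (suc i) f ⟩)) (⟨ f ⟩ :+ (⟨ π i (X (suc i) f) ⟩ :+ β :* ⟨ X (suc i) f ⟩))
           (λ e → lemma′ (coef (π i (X (suc i) f)) e) (coef f e) (β ℤ.* coef (X (suc i) f) e)) ⟩
    f ⊕ K i (X (suc i) f) ∎
    where
    lemma : ∀ a b → a ≡ a ℤ.+ -[1+ 0 ] ℤ.* b ℤ.+ b
    lemma = solve-∀
    lemma′ : ∀ a b c → a ℤ.+ (b ℤ.+ c) ≡ b ℤ.+ (a ℤ.+ c)
    lemma′ = solve-∀

  module Step {w : Perm} {i : ℕ} (W : IsPerm n w) (A : Adj n i) (asc : app w i < app w (suc i)) where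
    w′ : Perm
    w′ = mulS w i

    p : ℕ → Bool
    p a = app w a <ᵇ app w (suc i)

    B : List ℕ
    B = filterB p (phi n w′ (suc i))

    expand : X i (G w) ≈ G w′ ⊕ K i (X (suc i) (G w′))
    expand = ≈-trans (resp (X-linear i) (G-asc W A asc)) (X-π A (G w′))

    member : ∀ {a} → Exposed n w′ (suc i) a × In n a → In n a × suc i < a
    member (e , q) = q , right-of e

    values : ∀ {x S} → Chain n w′ (suc i) (x ∷ S) → app (U w i (x ∷ S)) i ≡ app w x × app (U w i (x ∷ S)) (suc i) ≡ app w (suc i)
    values (chain ((e , q) ∷ es) (d ∷ _)) =
      U-head W (Adj-l A) q (All.map proj₂ es) (<⇒≢ (<-trans (n<1+n i) (right-of e)) ∘ sym) (All.map (<⇒≢ ∘ proj₁) d) ,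
      U-other W (Adj-l A) (q ∷ All.map proj₂ es) (Adj-r A) (<⇒≢ (n<1+n i) ∘ sym) (<⇒≢ (right-of e) ∷ All.map (<⇒≢ ∘ right-of ∘ proj₁) es)

    module _ {x S} (c : Chain n w′ (suc i) (x ∷ S)) where
      V : IsPerm n (U w i (x ∷ S))
      V = U-perm W (Adj-l A) (chain-In c)

      shift : U w i (suc i ∷ x ∷ S) ≡ U w′ (suc i) (x ∷ S)
      shift = U-mulS W A (All.map member (members c))

      -- With u = `U w i (x ∷ S)`, `values` shows that u has w(x) and w(i+1) at positions i and i +
      -- 1, and `shift` that the term at hand is us_i. Here u ascends at i, so π_i produces u and β
      -- keeps us_i.
      low : app w x < app w (suc i) → K i (G (U w′ (suc i) (x ∷ S))) ≈ G (U w i (x ∷ S)) ⊕ β · G (U w i (suc i ∷ x ∷ S))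
      low lt = begin
        K i (G (U w′ (suc i) (x ∷ S))) ≡⟨ cong (λ u → K i (G u)) (sym shift) ⟩
        K i (G (mulS (U w i (x ∷ S)) i)) ≈⟨ ⊕-cong (≈-sym (G-asc V A (subst₂ _<_ (sym (proj₁ (values c))) (sym (proj₂ (values c))) lt))) ≈-refl ⟩
        G (U w i (x ∷ S)) ⊕ β · G (U w i (suc i ∷ x ∷ S)) ∎

      -- Now us_i itself ascends at i, so its polynomial is symmetric and K_i annihilates it.
      high : ¬ app w x < app w (suc i) → K i (G (U w′ (suc i) (x ∷ S))) ≈ 𝟘
      high ge = ≈-trans (≈-reflexive (cong (λ u → K i (G u)) (sym shift))) (∂⇒K A (∂-G (mulS-perm V A) A (mulS-desc V A
        (subst₂ _<_ (sym (proj₂ (values c))) (sym (proj₁ (values c))) (≤∧≢⇒< (≮⇒≥ ge) ne)))))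
        where
        ne : app w (suc i) ≢ app w x
        ne eq with members c
        ... | (e , q) ∷ _ = <⇒≢ (right-of e) (inj W (Adj-r A) q eq)

    split : List ℕ → M
    split S = weight S · (G (U w i S) ⊕ β · G (U w i (suc i ∷ S)))

    apply-K : ∀ {S} → NonEmpty S × Chain n w′ (suc i) S → K i (term w′ (suc i) S) ≈ (if headᵇ p S then split S else 𝟘)
    apply-K (nonEmpty {x} {S} , c) = ≈-trans (scale (K-linear i) (weight (x ∷ S)) _) (cases (p x) refl)
      where
      cases : ∀ b → p x ≡ b → weight (x ∷ S) · K i (G (U w′ (suc i) (x ∷ S))) ≈ (if b then split (x ∷ S) else 𝟘)
      cases true eq = ·-cong (weight (x ∷ S)) (low c (<ᵇ≡⇒< eq))
      cases false eq = linear-≈𝟘 (·-linear (weight (x ∷ S)) id-linear) (high c (<ᵇ≡⇒≮ eq))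

    monotone : AllPairs (λ x y → p x ≡ true → p y ≡ true) (phi n w′ (suc i))
    monotone = go (phi-exposed n w′ (suc i)) (phi-decreasing n w′ (suc i) (mulS-perm W A))
      where
      go : ∀ {xs} → All (λ a → Exposed n w′ (suc i) a × In n a) xs → AllPairs (Decreasing n w′ (suc i)) xs → AllPairs (λ x y → p x ≡ true → p y ≡ true) xs
      go [] [] = []
      go ((e , q) ∷ es) (d ∷ ds) = All.zipWith (λ { ((f , r) , (_ , lt)) px → <⇒<ᵇ≡ (<-trans
        (subst₂ _<_ (mulS-beyond W A asc r (right-of f)) (mulS-beyond W A asc q (right-of e)) lt) (<ᵇ≡⇒< {_} {app w (suc i)} px)) }) (es , d) ∷ go es ds

    -- Each x in φ_{i+1}(ws_i) with w(x) > w(i+1) contributes nothing; each remaining S contributes the sets S and {i+1} ∪ S of φ_i(w).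
    transition-step : Transition w′ (suc i) → Transition w i
    transition-step T = begin
      X i (G w) ≈⟨ expand ⟩
      G w′ ⊕ K i (X (suc i) (G w′)) ≈⟨ ⊕-cong ≈-refl (≈-trans (resp (K-linear i) T) (Σ-linear (K-linear i) (term w′ (suc i)) (neSubsets (phi n w′ (suc i))))) ⟩
      G w′ ⊕ Σ (λ S → K i (term w′ (suc i) S)) (neSubsets (phi n w′ (suc i)))
        ≈⟨ ⊕-cong ≈-refl (≈-trans (Σ-cong (All.map apply-K (phi-chains (suc i) (mulS-perm W A)))) (Σ-neSubsets-filterB split p monotone)) ⟩
      G w′ ⊕ Σ split (neSubsets B) ≈⟨ ⊕-cong ≈-refl (≈-trans (Σ-cong regroup) (Σ-⊕ _ _ (neSubsets B))) ⟩
      G w′ ⊕ (Σ (λ S → term w i (suc i ∷ S)) (neSubsets B) ⊕ Σ (term w i) (neSubsets B))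
        -- `G w′` is the term of the one-element set of i + 1, of weight β⁰. It supplies S = ∅ to
        -- the sum over sets containing i + 1, which thereby runs over all subsets of `B`.
        ≈⟨ coefficientwise (⟨ G w′ ⟩ :+ (⟨ s₁ ⟩ :+ ⟨ s₂ ⟩)) ((+ 1) :* ⟨ G w′ ⟩ :+ ⟨ s₁ ⟩ :+ ⟨ s₂ ⟩) (λ e → lemma (coef (G w′) e) (coef s₁ e) (coef s₂ e)) ⟩
      term w i (suc i ∷ []) ⊕ Σ (λ S → term w i (suc i ∷ S)) (neSubsets B) ⊕ Σ (term w i) (neSubsets B)
        ≈⟨ ⊕-cong (≈-sym (≈-trans (≈-reflexive (Σ-map (term w i) (suc i ∷_) (subsets B))) (Σ-subsets (λ S → term w i (suc i ∷ S)) B))) ≈-refl ⟩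
      Σ (term w i) (map (suc i ∷_) (subsets B)) ⊕ Σ (term w i) (neSubsets B) ≈⟨ ≈-sym (Σ-++ (term w i) (map (suc i ∷_) (subsets B)) (neSubsets B)) ⟩
      Σ (term w i) (neSubsets (suc i ∷ B)) ≡⟨ cong (λ l → Σ (term w i) (neSubsets l)) (sym (phi-mulS W A asc)) ⟩
      Σ (term w i) (neSubsets (phi n w i)) ∎
      where
      s₁ = Σ (λ S → term w i (suc i ∷ S)) (neSubsets B)
      s₂ = Σ (term w i) (neSubsets B)
      lemma : ∀ a b c → a ℤ.+ (b ℤ.+ c) ≡ (+ 1) ℤ.* a ℤ.+ b ℤ.+ c
      lemma = solve-∀
      lemma′ : ∀ u b x y → u ℤ.* (x ℤ.+ b ℤ.* y) ≡ b ℤ.* u ℤ.* y ℤ.+ u ℤ.* x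
      lemma′ = solve-∀
      regroup : All (λ S → split S ≈ term w i (suc i ∷ S) ⊕ term w i S) (neSubsets B)
      regroup = All.map (λ { {x ∷ S} (nonEmpty , _) → coefficientwise
          (weight (x ∷ S) :* (⟨ G (U w i (x ∷ S)) ⟩ :+ β :* ⟨ G (U w i (suc i ∷ x ∷ S)) ⟩))
          (weight (suc i ∷ x ∷ S) :* ⟨ G (U w i (suc i ∷ x ∷ S)) ⟩ :+ weight (x ∷ S) :* ⟨ G (U w i (x ∷ S)) ⟩)
          (λ e → lemma′ (weight (x ∷ S)) β (coef (G (U w i (x ∷ S))) e) (coef (G (U w i (suc i ∷ x ∷ S))) e)) })
        (neSubsets-All (All-filterB p (phi-exposed n w′ (suc i))) (AllPairs-filterB p (phi-sorted n w′ (suc i))))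

    -- In this case φ_i(w) consists of i + 1 alone and the formula degenerates to x_i G_w =
    -- G_{ws_i}.
    transition-base : filterB p (phi n w′ (suc i)) ≡ [] → ∂ i (X (suc i) (G w′)) ≈ 𝟘 → Transition w i
    transition-base e q = begin
      X i (G w) ≈⟨ expand ⟩
      G w′ ⊕ K i (X (suc i) (G w′)) ≈⟨ ⊕-cong ≈-refl (∂⇒K A q) ⟩
      G w′ ⊕ 𝟘 ≈⟨ coefficientwise (⟨ G w′ ⟩ :+ :0) ((+ 1) :* ⟨ G w′ ⟩ :+ :0) (λ e → cong (ℤ._+ (+ 0)) (sym (ℤ.*-identityˡ (coef (G w′) e)))) ⟩
      Σ (term w i) (neSubsets (suc i ∷ [])) ≡⟨ cong (λ l → Σ (term w i) (neSubsets l)) (sym (trans (phi-mulS W A asc) (cong (suc i ∷_) e))) ⟩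
      Σ (term w i) (neSubsets (phi n w i)) ∎

  TransitionFrom : ℕ → Set
  TransitionFrom j = ∀ {w j′ i} → j ≤ j′ → IsPerm n w → Corner n w j′ i → Transition w i

  -- Expanding G w along transitions in columns > j, which only involve the variables x_k with k < n − j.
  tail-symmetric : ∀ {j w i} → TransitionFrom (suc j) → Adj n i → i + j ≡ n → IsPerm n w → Tail n (suc j) w → ∂ i (X (suc i) (G w)) ≈ 𝟘
  tail-symmetric {j} {w} {i} T A i+j W = ell-induction (λ w → Tail n (suc j) w → ∂ i (X (suc i) (G w)) ≈ 𝟘) (λ V → step V (corner-or-w0′ V)) W
    where
    corner-or-w0′ : ∀ {v} → IsPerm n v → Tail n (suc j) v → (∃ λ j′ → ∃ λ i → suc j ≤ j′ × Corner n v j′ i) ⊎ v ≡ w0 n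
    corner-or-w0′ V = find-corner V i (suc j) (cong suc (trans (+-comm j i) i+j)) (s≤s z≤n)
    step : ∀ {v} → IsPerm n v → (Tail n (suc j) v → (∃ λ j′ → ∃ λ i → suc j ≤ j′ × Corner n v j′ i) ⊎ v ≡ w0 n) →
      (∀ {u} → IsPerm n u → ell v < ell u → Tail n (suc j) u → ∂ i (X (suc i) (G u)) ≈ 𝟘) → Tail n (suc j) v → ∂ i (X (suc i) (G v)) ≈ 𝟘
    step {v} V view ih t with view t
    ... | inj₂ e = ≈-trans (resp L (≈-reflexive G-w0)) (∂-XΔ A)
      where
      L = ∘-linear (∂-linear i) (X-linear (suc i))
      G-w0 : G v ≡ Δ
      G-w0 = trans (G-unfold V) (cong (maybe (λ k → π k (G (mulS v k))) Δ) (trans (cong (firstAscent n) e) (firstAscent-w0 n)))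
    -- Since k < i, x_k commutes with ∂_i, so the claim may be checked after multiplication by x_k.
    -- There the transition formula replaces v by longer permutations with the same tail.
    ... | inj₁ (j′ , k , lt , c) = X-cancel k (begin
      X k (∂ i (X (suc i) (G v))) ≈⟨ ≈-sym (∂-Xᵒ A (<⇒≢ k<i) (<⇒≢ (m≤n⇒m≤1+n k<i)) _) ⟩
      ∂ i (X k (X (suc i) (G v))) ≈⟨ resp (∂-linear i) (X-comm k (suc i) (G v)) ⟩
      ∂ i (X (suc i) (X k (G v))) ≈⟨ resp L (T lt V c) ⟩
      ∂ i (X (suc i) (Σ (term v k) (neSubsets (phi n v k)))) ≈⟨ Σ-linear L (term v k) (neSubsets (phi n v k)) ⟩
      Σ (λ S → ∂ i (X (suc i) (term v k S))) (neSubsets (phi n v k))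
        ≈⟨ Σ-zero (All.map (λ { {S} (ne , s) → ≈-trans (scale L (weight S) _) (linear-≈𝟘 (·-linear (weight S) id-linear)
             (ih (U-perm V (row-In c) (chain-In s)) (U-ell-< V (row-In c) ne s) (tail-U V c lt s))) }) (phi-chains k V)) ⟩
      𝟘 ≈⟨ ≈-sym (linear-𝟘 (X-linear k)) ⟩
      X k 𝟘 ∎)
      where
      L = ∘-linear (∂-linear i) (X-linear (suc i))
      k<i : k < i
      k<i = +-cancelʳ-< j k i (subst (k + j <_) (sym i+j) (≤-trans (+-monoʳ-< k lt) (inside c)))

  -- The number m counts how many rows the dot can descend in column j while keeping i + j ≤ n. At m
  -- = 0 one further step puts it on the antidiagonal, and ws_i agrees with w₀ in column j as well.
  transition-column : ∀ j → TransitionFrom (suc j) → ∀ m {w i} → i + j + m ≡ n → IsPerm n w → Corner n w j i → Transition w i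
  transition-column j T zero {w} {i} e W c = transition-base none (tail-symmetric T A₁ (trans (sym (+-identityʳ _)) e) (mulS-perm W A₁) tail′)
    where
    A₁ : Adj n i
    A₁ = corner-Adj W c
    open Step W A₁ (corner-asc W c)
    i+j = trans (sym (+-identityʳ (i + j))) e
    tail′ : Tail n (suc j) w′
    tail′ {a} {b} p lt eq with a ≟ suc i
    ... | yes refl = trans (mulT-app-r W (Adj-l A₁) (Adj-r A₁)) (trans (dot c) (+-cancelˡ-≡ i j b (trans i+j (sym (suc-injective eq)))))
    ... | no a≢ = trans (mulT-app-o W p a≢i a≢) (tail c p b<j eq)
      where
      b<j : b < j
      b<j = ≤∧≢⇒< (s≤s⁻¹ lt) (λ { refl → a≢ (+-cancelʳ-≡ b a (suc i) (trans eq (sym (cong suc i+j)))) })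
      a≢i : a ≢ i
      a≢i refl = <⇒≢ (<-trans (+-monoʳ-< a b<j) (≤-reflexive (cong suc i+j))) eq
    -- By the tail condition all rows below i + 1 hold values smaller than j, so nothing is exposed
    -- from i + 1.
    none : filterB p (phi n w′ (suc i)) ≡ []
    none = filterB-none (All.map (λ { {a} (x , q) → contradiction (above x) (<⇒≯ (subst₂ _<_
      (sym (low-value (right-of x) q)) (sym (trans (mulT-app-r W (Adj-l A₁) (Adj-r A₁)) (dot c))) (b<j (right-of x) q))) })
      (phi-exposed n w′ (suc i)))
      where
      a+b : ∀ {a} → In n a → a + (suc n ∸ a) ≡ suc n
      a+b q = m+[n∸m]≡n (m≤n⇒m≤1+n (proj₂ q))
      b<j : ∀ {a} → suc i < a → In n a → suc n ∸ a < j
      b<j {a} lt q = +-cancelˡ-< a _ _ (subst (_< a + j) (sym (a+b q)) (subst (λ m → suc m < a + j) i+j (+-monoˡ-< j lt)))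
      low-value : ∀ {a} → suc i < a → In n a → app w′ a ≡ suc n ∸ a
      low-value lt q = trans (mulS-beyond W A₁ (corner-asc W c) q lt) (tail c q (b<j lt q) (a+b q))
  transition-column j T (suc m) {w} {i} e W c = transition-step (transition-column j T m e′ (mulS-perm W A₁)
      (corner-mulS W c (≤-trans (m≤m+n _ m) (≤-reflexive e′))))
    where
    A₁ : Adj n i
    A₁ = corner-Adj W c
    open Step W A₁ (corner-asc W c)
    e′ : suc i + j + m ≡ n
    e′ = trans (sym (+-suc (i + j) m)) e

  -- Induction on the columns from right to left, with m a bound for n - j. For j ≥ n there is no
  -- corner, as i ≥ 1 and i + j ≤ n are incompatible.
  transition-from : ∀ m j → n ≤ j + m → TransitionFrom j
  transition-from zero j le {i = i} j≤j′ W c = contradiction (inside c) (<⇒≱ (≤-trans (s≤s (≤-trans le (≤-trans (≤-reflexive (+-identityʳ j)) j≤j′)))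
    (+-monoˡ-≤ _ (proj₁ (row-In c)))))
  transition-from (suc m) j le {j′ = j′} {i} j≤j′ W c with j ≟ j′
  ... | yes refl = transition-column j (transition-from m (suc j) (≤-trans le (≤-reflexive (+-suc j m)))) (n ∸ (i + j)) (m+[n∸m]≡n (inside c)) W c
  ... | no ne = transition-from m (suc j) (≤-trans le (≤-reflexive (+-suc j m))) (≤∧≢⇒< j≤j′ ne) W c

  transition : ∀ {w j i} → IsPerm n w → Corner n w j i → Transition w i
  transition = transition-from n 0 ≤-refl z≤n

-- Dominant part and paths

allB-++ : ∀ xs ys → allB (xs ++ ys) ≡ allB xs ∧ allB ys
allB-++ [] ys = refl
allB-++ (true ∷ xs) ys = allB-++ xs ys
allB-++ (false ∷ xs) ys = refl

allB-intro : ∀ {f : ℕ → Bool} {xs} → All (λ x → f x ≡ true) xs → allB (map f xs) ≡ true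
allB-intro [] = refl
allB-intro (p ∷ ps) = cong₂ _∧_ p (allB-intro ps)

allB-elim : ∀ {f : ℕ → Bool} {x xs} → allB (map f xs) ≡ true → x ∈ xs → f x ≡ true
allB-elim {f} {xs = y ∷ xs} t (here refl) = proj₁ (∧-true {f y} t)
allB-elim {f} {xs = y ∷ xs} t (there m) = allB-elim (proj₂ (∧-true {f y} t)) m

inDom-intro : ∀ w i j → (∀ {a b} → In i a → In j b → inD w a b ≡ true) → inDom w i j ≡ true
inDom-intro w i j h = go (All-range i (λ a p → p))
  where
  go : ∀ {xs} → All (In i) xs → allB (concatMap (λ a → map (inD w a) (range j)) xs) ≡ true
  go [] = refl
  go {a ∷ xs} (p ∷ ps) = trans (allB-++ (map (inD w a) (range j)) _) (cong₂ _∧_ (allB-intro (All-range j (λ b q → h p q))) (go ps))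

inDom-elim : ∀ w i j {a b} → inDom w i j ≡ true → In i a → In j b → inD w a b ≡ true
inDom-elim w i j t p q = go t (In⇒∈-range p)
  where
  go : ∀ {a xs} → allB (concatMap (λ a → map (inD w a) (range j)) xs) ≡ true → a ∈ xs → inD w a _ ≡ true
  go {xs = x ∷ xs} t m with ∧-true {allB (map (inD w x) (range j))} (trans (sym (allB-++ (map (inD w x) (range j)) _)) t)
  go t (here refl) | u , v = allB-elim u (In⇒∈-range q)
  go t (there m) | u , v = go v m

firstB-least : ∀ (p : ℕ → Bool) {k xs} → AllPairs _<_ xs → k ∈ xs → p k ≡ true → (∀ {x} → x ∈ xs → x < k → p x ≡ false) → firstB p xs ≡ just k
firstB-least p {k} {x ∷ xs} (x< ∷ s) (here refl) t h rewrite t = refl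
firstB-least p {k} {x ∷ xs} (x< ∷ s) (there m) t h rewrite h (here refl) (All.lookup x< m) = firstB-least p s m t (h ∘ there)

appInv-app : ∀ {n w k} → IsPerm n w → In n k → appInv w (app w k) ≡ k
appInv-app {n} {w} {suc k} W (_ , p) = cong (maybe (λ x → x) (app w (suc k))) (trans (go w k 1 (subst (k <_) (sym (len W)) p)
    (λ l l<k eq → <⇒≢ (s≤s l<k) (inj W (s≤s z≤n , <⇒≤ (≤-trans (s≤s l<k) p)) (s≤s z≤n , p)
      (trans (getD-nth w (suc l) 0 (<-trans l<k (subst (k <_) (sym (len W)) p))) eq)))
    (getD-nth w 0 (suc k) (subst (k <_) (sym (len W)) p))) (cong just (+-comm k 1)))
  where
  go : ∀ (w : List ℕ) {j} k s → k < length w → (∀ l → l < k → getD 0 (nth w l) ≢ j) → getD 0 (nth w k) ≡ j → findPos w j s ≡ just (k + s)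
  go (x ∷ w) zero s p h refl rewrite ≡ᵇ-refl x = refl
  go (x ∷ w) (suc k) s (s≤s p) h eq rewrite ≢⇒≡ᵇ (h 0 (s≤s z≤n)) = trans (go w k (suc s) p (λ l q → h (suc l) (s≤s q)) eq) (cong just (+-suc k s))

eqPerm-refl : ∀ w → eqPerm w w ≡ true
eqPerm-refl [] = refl
eqPerm-refl (x ∷ w) = cong₂ _∧_ (≡ᵇ-refl x) (eqPerm-refl w)

eqPerm⇒≡ : ∀ {w v} → eqPerm w v ≡ true → w ≡ v
eqPerm⇒≡ {[]} {[]} t = refl
eqPerm⇒≡ {x ∷ w} {y ∷ v} t = let (p , q) = ∧-true {x ≡ᵇ y} t in cong₂ _∷_ (≡ᵇ≡⇒≡ p) (eqPerm⇒≡ q)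

≢⇒eqPerm : ∀ {w v} → w ≢ v → eqPerm w v ≡ false
≢⇒eqPerm {w} {v} ne with eqPerm w v in eq
... | true = contradiction (eqPerm⇒≡ eq) ne
... | false = refl

≤⇒≤ᵇ≡ : ∀ {a b} → a ≤ b → (a ≤ᵇ b) ≡ true
≤⇒≤ᵇ≡ {a} {b} p with a ≤ᵇ b | ≤⇒≤ᵇ p
... | true | _ = refl

module _ {n : ℕ} {w : Perm} {j i : ℕ} (W : IsPerm n w) (c : Corner n w j i) where
  private
    1≤j = corner-1≤j W c

    j-In : In n j
    j-In = 1≤j , ≤-trans (m≤n+m j i) (inside c)

    +⇒<∸ : ∀ {a b} → a + b ≤ n → a < suc n ∸ b
    +⇒<∸ {a} {b} le = +-cancelʳ-< b a (suc n ∸ b) (subst (a + b <_) (sym (m∸n+n≡m (≤-trans (m≤n+m b a) (m≤n⇒m≤1+n le)))) (s≤s le))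

    below : ∀ {a b} → In n a → 1 ≤ b → b < j → a + b ≤ n → a < appInv w b
    below {a} {b} p 1≤b b<j le = subst (a <_) (sym (trans (cong (appInv w) (sym value)) (appInv-app W row))) (+⇒<∸ le)
      where
      b≤n : b ≤ n
      b≤n = ≤-trans (m≤n+m b a) le
      row : In n (suc n ∸ b)
      row = m<n⇒0<n∸m (s≤s b≤n) , ∸-monoʳ-≤ (suc n) 1≤b
      value : app w (suc n ∸ b) ≡ b
      value = tail c row b<j (m∸n+n≡m (m≤n⇒m≤1+n b≤n))

    -- In a column left of j every cell with k + l ≤ n lies in the dominant part. An addable cell
    -- there would violate the bound in `alpha`, which therefore passes over these columns.
    full-column : ∀ {k l} → In n k → 1 ≤ l → l < j → k + l ≤ n → inDom w k l ≡ true
    full-column {k} {l} p 1≤l l<j le = inDom-intro w k l λ {a} {b} q r →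
      let a-In = proj₁ q , ≤-trans (proj₂ q) (proj₂ p) in
      cong₂ _∧_ (<⇒<ᵇ≡ (≤-trans (s≤s (proj₂ r)) (large W {suc l} (λ s lt → tail c s (<-≤-trans lt l<j)) a-In
          (≤-trans (≤-reflexive (+-suc a l)) (s≤s (≤-trans (+-monoˡ-≤ l (proj₂ q)) le))))))
        (<⇒<ᵇ≡ (below a-In (proj₁ r) (≤-<-trans (proj₂ r) l<j) (≤-trans (+-mono-≤ (proj₂ q) (proj₂ r)) le)))

    dot-outside : inDom w i j ≡ false
    dot-outside with inDom w i j in eq
    ... | false = refl
    ... | true = contradiction (<ᵇ≡⇒< (proj₁ (∧-true {j <ᵇ app w i} (inDom-elim w i j eq (proj₁ (row-In c) , ≤-refl) (1≤j , ≤-refl))))) (≤⇒≯ (≤-reflexive (dot c)))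

    above-inside : inDom w (i ∸ 1) j ≡ true
    above-inside = inDom-intro w (i ∸ 1) j λ {a} {b} q r →
      let a<i = ≤-trans (s≤s (proj₂ q)) (≤-reflexive (m+[n∸m]≡n (proj₁ (row-In c))))
          a-In = proj₁ q , ≤-trans (<⇒≤ a<i) (proj₂ (row-In c))
          a+j≤n = ≤-trans (+-monoˡ-≤ j (<⇒≤ a<i)) (inside c)
      in cong₂ _∧_ (<⇒<ᵇ≡ (≤-<-trans (proj₂ r) (corner-large W c a-In (m≤n⇒m≤1+n a+j≤n) (<⇒≢ a<i)))) (<⇒<ᵇ≡ (column a-In a<i r a+j≤n))
      where
      column : ∀ {a b} → In n a → a < i → In j b → a + j ≤ n → a < appInv w b
      column {a} {b} p lt (1≤b , b≤j) le with b ≟ j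
      ... | yes refl = subst (a <_) (sym (trans (cong (appInv w) (sym (dot c))) (appInv-app W (row-In c)))) lt
      ... | no ne = below p 1≤b (≤∧≢⇒< b≤j ne) (≤-trans (+-monoʳ-≤ a b≤j) le)

    left-inside : inDom w i (j ∸ 1) ≡ true
    left-inside = inDom-intro w i (j ∸ 1) λ {a} {b} q r →
      let b<j = ≤-trans (s≤s (proj₂ r)) (≤-reflexive (m+[n∸m]≡n 1≤j))
          a-In = proj₁ q , ≤-trans (proj₂ q) (proj₂ (row-In c))
          a+j≤n = ≤-trans (+-monoˡ-≤ j (proj₂ q)) (inside c)
      in cong₂ _∧_ (<⇒<ᵇ≡ (<-≤-trans b<j (large W (tail c) a-In (m≤n⇒m≤1+n a+j≤n))))
           (<⇒<ᵇ≡ (below a-In (proj₁ r) b<j (≤-trans (+-monoʳ-≤ a (<⇒≤ b<j)) a+j≤n)))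

    ∨-true : ∀ {a b} → b ≡ true → (a ∨ b) ≡ true
    ∨-true {true} p = refl
    ∨-true {false} p = p

    addable-corner : addable w i j ≡ true
    addable-corner = cong₂ _∧_ (cong not dot-outside) (cong₂ _∧_ (∨-true {i ≡ᵇ 1} above-inside) (∨-true {j ≡ᵇ 1} left-inside))

    column-test : ℕ → Bool
    column-test l = anyB (map (λ k → addable w k l ∧ (k + l ≤ᵇ n)) (range n))

    earlier : ∀ {l} → l ∈ range n → l < j → column-test l ≡ false
    earlier {l} m lt with column-test l in eq
    ... | false = refl
    ... | true = let (k , r , t) = anyB-elim (λ k → addable w k l ∧ (k + l ≤ᵇ n)) (range n) eq
                     (u , v) = ∧-true {addable w k l} t
                     (x , _) = ∧-true {not (inDom w k l)} u
                 in contradiction (trans (sym x) (cong not (full-column (∈-range⇒In r) (proj₁ (∈-range⇒In m)) lt (≤ᵇ⇒≤ (k + l) n (subst T (sym v) tt))))) true≢false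

  -- The dot is outside D(w), whereas the rectangles ending just above it and just left of it are
  -- inside, so it is an addable cell of the dominant part.
  alpha-corner : alpha n w ≡ just j
  alpha-corner = firstB-least column-test (sorted-range n) (In⇒∈-range j-In)
    (anyB-intro (λ k → addable w k j ∧ (k + j ≤ᵇ n)) (In⇒∈-range (row-In c)) (cong₂ _∧_ addable-corner (≤⇒≤ᵇ≡ (inside c)))) earlier

  edges-corner : ∀ g → edges g n w ≡ map (λ u → (i , u)) (targets g n w i)
  edges-corner g rewrite ≢⇒eqPerm (corner-w0 W c) | alpha-corner = cong (λ k → map (λ u → (k , u)) (targets g n w k))
    (trans (cong (appInv w) (sym (dot c))) (appInv-app W (row-In c)))

edges-w0 : ∀ g n → edges g n (w0 n) ≡ []
edges-w0 g n rewrite eqPerm-refl (w0 n) = refl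

Above : ℕ → Perm → Perm → Set
Above n w u = IsPerm n u × ell w < ell u

targets-above : ∀ g {n w i} → IsPerm n w → In n i → All (Above n w) (targets g n w i)
targets-above 𝒢 {n} {w} {i} W p = All.map⁺ (All.map (λ (e , q) → mulT-perm W p q , ell-mulT W p q (right-of e) (above e)) (phi-exposed n w i))
targets-above 𝒢bar {n} {w} {i} W p = All.map⁺ (All.map (λ {S} (ne , c) → subst (Above n w) (sym (U-foldl w i S))
  (U-perm W p (chain-In c) , U-ell-< W p ne c)) (phi-chains i W))
targets-above ℛ W p = All.map proj₂ (All-filterB _ (targets-above 𝒢bar W p))

paths-Adj : ∀ g {n} f {w} → IsPerm n w → All (All (Adj n)) (pathsF g n f w)
paths-Adj g {n} zero {w} W with eqPerm w (w0 n)
... | true = [] ∷ []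
... | false = []
paths-Adj g {n} (suc f) {w} W with corner-or-w0 W
... | inj₂ refl rewrite edges-w0 g n | eqPerm-refl (w0 n) = [] ∷ []
... | inj₁ (j , i , c) rewrite edges-corner W c g | ≢⇒eqPerm (corner-w0 W c) =
  All.concat⁺ (All.map⁺ (All.map⁺ (All.map (λ (U , _) → All.map⁺ (All.map (λ q → corner-Adj W c ∷ q) (paths-Adj g f U))) (targets-above g W (row-In c)))))

module PathSum {n : ℕ} (A : LaurentAlgebra n) where
  open LaurentAlgebra A
  open Sums A
  open import Relation.Binary.Reasoning.Setoid ≈-setoid

  -- The induction common to all four formulas: F satisfies a recursion over the edges leaving w,
  -- and H, the contribution of a path, grows by the same operator with each label. The operator is
  -- division by x_i for (1) and (2), ∂_i for (3), and π_i with β = -1 for (4).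
  path-sum : ∀ g (F : Perm → M) (op : ℕ → M → M) (H : List ℕ → M) → (∀ i → Linear (op i)) → H [] ≈ F (w0 n) →
    (∀ {i p} → Adj n i → All (Adj n) p → H (i ∷ p) ≈ op i (H p)) →
    (∀ {w j i} → IsPerm n w → Corner n w j i → F w ≈ Σ (λ u → op i (F u)) (targets g n w i)) →
    ∀ f {w} → IsPerm n w → n * n < ell w + f → F w ≈ Σ H (pathsF g n f w)
  path-sum g F op H L base cons rec zero {w} W p = contradiction p (≤⇒≯ (≤-trans (≤-reflexive (+-identityʳ (ell w))) (ell-≤ W)))
  path-sum g F op H L base cons rec (suc f) {w} W p with corner-or-w0 W
  ... | inj₂ refl rewrite edges-w0 g n | eqPerm-refl (w0 n) = ≈-sym (≈-trans (⊕-identityʳ _) base)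
  ... | inj₁ (j , i , c) rewrite edges-corner W c g | ≢⇒eqPerm (corner-w0 W c) = begin
    F w ≈⟨ rec W c ⟩
    Σ (λ u → op i (F u)) (targets g n w i) ≈⟨ Σ-cong (All.map (λ {u} (U , lt) → ≈-trans (resp (L i) (ih U lt)) (Σ-linear (L i) H (pathsF g n f u))) (targets-above g W (row-In c))) ⟩
    Σ (λ u → Σ (λ p → op i (H p)) (pathsF g n f u)) (targets g n w i)
      ≈⟨ Σ-cong (All.map (λ {u} (U , _) → Σ-cong (All.map (λ q → ≈-sym (cons (corner-Adj W c) q)) (paths-Adj g f U))) (targets-above g W (row-In c))) ⟩
    Σ (λ u → Σ (λ p → H (i ∷ p)) (pathsF g n f u)) (targets g n w i)
      ≈⟨ Σ-cong (All.universal (λ u → ≈-reflexive (sym (Σ-map H (i ∷_) (pathsF g n f u)))) (targets g n w i)) ⟩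
    Σ (λ u → Σ H (map (i ∷_) (pathsF g n f u))) (targets g n w i) ≡⟨ sym (Σ-map (λ e → Σ H (extend e)) (λ u → (i , u)) (targets g n w i)) ⟩
    Σ (λ e → Σ H (extend e)) (map (λ u → (i , u)) (targets g n w i)) ≈⟨ ≈-sym (Σ-concatMap H extend (map (λ u → (i , u)) (targets g n w i))) ⟩
    Σ H (concatMap extend (map (λ u → (i , u)) (targets g n w i))) ∎
    where
    extend : ℕ × Perm → List (List ℕ)
    extend (i , v) = map (i ∷_) (pathsF g n f v)
    ih : ∀ {u} → IsPerm n u → ell w < ell u → F u ≈ Σ H (pathsF g n f u)
    ih U lt = path-sum g F op H L base cons rec f U (≤-trans p (≤-trans (≤-reflexive (+-suc (ell w) f)) (+-monoˡ-≤ f lt)))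

-- Demazure products, reduced words and Bruhat order

idPerm-perm : ∀ n → IsPerm n (idPerm n)
idPerm-perm n = record
  { len = length-range n
  ; bound = λ p → subst (In n) (sym (app-range p)) p
  ; inj = λ p q e → trans (sym (app-range p)) (trans e (app-range q))
  ; surj = λ {j} p → j , p , app-range p
  }

mulPerm-w0-app : ∀ {n v k} → IsPerm n v → In n k → app (mulPerm (w0 n) v) k ≡ suc n ∸ app v k
mulPerm-w0-app {n} {v} {k} V p = trans (app-map (λ k → app (w0 n) (app v k)) (subst (λ m → In m k) (sym (len V)) p)) (app-w0 (bound V p))

complement-In : ∀ {n k} → In n k → In n (suc n ∸ k)
complement-In {n} {k} (p , q) = m<n⇒0<n∸m (s≤s q) , ∸-monoʳ-≤ (suc n) p

complement-invol : ∀ {n k} → In n k → suc n ∸ (suc n ∸ k) ≡ k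
complement-invol (_ , q) = m∸[m∸n]≡n (m≤n⇒m≤1+n q)

mulPerm-w0-perm : ∀ {n v} → IsPerm n v → IsPerm n (mulPerm (w0 n) v)
mulPerm-w0-perm {n} {v} V = record
  { len = trans (length-map _ (range (length v))) (trans (length-range (length v)) (len V))
  ; bound = λ p → subst (In n) (sym (mulPerm-w0-app V p)) (complement-In (bound V p))
  ; inj = λ p q e → inj V p q (trans (sym (complement-invol (bound V p))) (trans (cong (suc n ∸_)
      (trans (sym (mulPerm-w0-app V p)) (trans e (mulPerm-w0-app V q)))) (complement-invol (bound V q))))
  ; surj = λ p → let (k , q , e) = surj V (complement-In p) in k , q , trans (mulPerm-w0-app V q) (trans (cong (suc n ∸_) e) (complement-invol p))
  }

mulPerm-w0-mulS : ∀ {n v i} → IsPerm n v → Adj n i → mulPerm (w0 n) (mulS v i) ≡ mulS (mulPerm (w0 n) v) i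
mulPerm-w0-mulS {n} {v} {i} V A = app-ext (len (mulPerm-w0-perm (mulS-perm V A))) (len (mulS-perm (mulPerm-w0-perm V) A)) λ k p →
  trans (mulPerm-w0-app (mulS-perm V A) p) (trans (cong (suc n ∸_) (app-mulT v i (suc i) (len V) p))
    (sym (trans (app-mulT (mulPerm (w0 n) v) i (suc i) (len (mulPerm-w0-perm V)) p) (mulPerm-w0-app V (sw-In (Adj-l A) (Adj-r A) p)))))

mulPerm-w0-id : ∀ n → mulPerm (w0 n) (idPerm n) ≡ w0 n
mulPerm-w0-id n = app-ext (len (mulPerm-w0-perm (idPerm-perm n))) (trans (length-reverse (range n)) (length-range n)) λ k p →
  trans (mulPerm-w0-app (idPerm-perm n) p) (trans (cong (suc n ∸_) (app-range p)) (sym (app-w0 p)))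

mulPerm-w0-reverses : ∀ {n v a b} → IsPerm n v → In n a → In n b → app v a < app v b → app (mulPerm (w0 n) v) b < app (mulPerm (w0 n) v) a
mulPerm-w0-reverses {n} V p q lt = subst₂ _<_ (sym (mulPerm-w0-app V q)) (sym (mulPerm-w0-app V p)) (∸-monoʳ-< lt (m≤n⇒m≤1+n (proj₂ (bound V q))))

demStep : Perm → ℕ → Perm
demStep v m = if ell v <ᵇ ell (mulS v m) then mulS v m else v

-- The word of a path is reversed, so the label of the first edge is the last letter and acts on the
-- product of the rest from the right; this is the order in which `path-sum` builds H.
dem-∷ : ∀ n i p → dem n (word (i ∷ p)) ≡ demStep (dem n (word p)) i
dem-∷ n i p = trans (cong (dem n) (unfold-reverse i p)) (foldl-∷ʳ demStep (idPerm n) i (reverse p))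

demStep-asc : ∀ {n v i} → IsPerm n v → Adj n i → app v i < app v (suc i) → demStep v i ≡ mulS v i
demStep-asc {v = v} {i} V A asc = cong (λ b → if b then mulS v i else v) (<⇒<ᵇ≡ (≤-reflexive (sym (ell-asc V A asc))))

demStep-desc : ∀ {n v i} → IsPerm n v → Adj n i → app v (suc i) < app v i → demStep v i ≡ v
demStep-desc {v = v} {i} V A d = cong (λ b → if b then mulS v i else v) (≮⇒<ᵇ≡ (≤⇒≯ (≤-trans (n≤1+n _) (≤-reflexive (sym (ell-desc V A d))))))

dem-perm : ∀ {n p} → All (Adj n) p → IsPerm n (dem n (word p))
dem-perm {n} [] = idPerm-perm n
dem-perm {n} {i ∷ p} (A ∷ As) = subst (IsPerm n) (sym (dem-∷ n i p)) (step (asc-or-desc V (Adj-l A) (Adj-r A) (<⇒≢ (n<1+n i))))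
  where
  V = dem-perm As
  step : app (dem n (word p)) i < app (dem n (word p)) (suc i) ⊎ app (dem n (word p)) (suc i) < app (dem n (word p)) i → IsPerm n (demStep (dem n (word p)) i)
  step (inj₁ asc) = subst (IsPerm n) (sym (demStep-asc V A asc)) (mulS-perm V A)
  step (inj₂ d) = subst (IsPerm n) (sym (demStep-desc V A d)) V

prodS : ℕ → List ℕ → Perm
prodS n p = foldl mulS (idPerm n) (word p)

prodS-∷ : ∀ n i p → prodS n (i ∷ p) ≡ mulS (prodS n p) i
prodS-∷ n i p = trans (cong (foldl mulS (idPerm n)) (unfold-reverse i p)) (foldl-∷ʳ mulS (idPerm n) i (reverse p))

prodS-perm : ∀ {n p} → All (Adj n) p → IsPerm n (prodS n p)
prodS-perm {n} [] = idPerm-perm n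
prodS-perm {n} {i ∷ p} (A ∷ As) = subst (IsPerm n) (sym (prodS-∷ n i p)) (mulS-perm (prodS-perm As) A)

ell-id : ∀ n → ell (idPerm n) ≡ 0
ell-id n = trans (ell-∑ (idPerm n) (length-range n)) (∑-zero n λ a p → ∑-zero n λ b q → cong b2n (no-inversion p q))
  where
  no-inversion : ∀ {a b} → In n a → In n b → ((a <ᵇ b) ∧ (app (idPerm n) b <ᵇ app (idPerm n) a)) ≡ false
  no-inversion {a} {b} p q with a <ᵇ b in eq
  ... | false = refl
  ... | true = ≮⇒<ᵇ≡ (λ lt → <-asym (<ᵇ≡⇒< eq) (subst₂ _<_ (app-range q) (app-range p) lt))

ell-mulS-≤ : ∀ {n w k} → IsPerm n w → Adj n k → ell (mulS w k) ≤ suc (ell w)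
ell-mulS-≤ {w = w} {k} W A = ≤-trans (ell-mulS-≥ (mulS-perm W A) A) (≤-reflexive (cong (λ u → suc (ell u)) (mulS-invol W A)))

ell-prodS : ∀ {n p} → All (Adj n) p → ell (prodS n p) ≤ length p
ell-prodS {n} [] = ≤-reflexive (ell-id n)
ell-prodS {n} {i ∷ p} (A ∷ As) = ≤-trans (≤-reflexive (cong ell (prodS-∷ n i p))) (≤-trans (ell-mulS-≤ (prodS-perm As) A) (s≤s (ell-prodS As)))

Reduced : ℕ → List ℕ → Set
Reduced n p = ell (prodS n p) ≡ length p

isReduced⇒ : ∀ {n p} → isReduced n (word p) ≡ true → Reduced n p
isReduced⇒ {n} {p} t = trans (≡ᵇ≡⇒≡ t) (length-reverse p)

⇒isReduced : ∀ {n p} → Reduced n p → isReduced n (word p) ≡ true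
⇒isReduced {n} {p} r = trans (cong₂ _≡ᵇ_ r (length-reverse p)) (≡ᵇ-refl (length p))

isReduced-∷-asc : ∀ {n i p} → Adj n i → All (Adj n) p → Reduced n p → app (prodS n p) i < app (prodS n p) (suc i) → Reduced n (i ∷ p)
isReduced-∷-asc {n} {i} {p} A As r asc = trans (cong ell (prodS-∷ n i p)) (trans (ell-asc (prodS-perm As) A asc) (cong suc r))

-- The product of p has length at most that of p, so a descent at i would leave the product of the
-- extended word too short.
isReduced-∷⁻ : ∀ {n i p} → Adj n i → All (Adj n) p → Reduced n (i ∷ p) → Reduced n p × app (prodS n p) i < app (prodS n p) (suc i)
isReduced-∷⁻ {n} {i} {p} A As r with asc-or-desc (prodS-perm As) (Adj-l A) (Adj-r A) (<⇒≢ (n<1+n i))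
... | inj₁ asc = suc-injective (trans (sym (ell-asc (prodS-perm As) A asc)) (trans (sym (cong ell (prodS-∷ n i p))) r)) , asc
... | inj₂ d = contradiction (≤-trans (≤-reflexive (sym (ell-desc (prodS-perm As) A d))) (ell-prodS As))
  (<⇒≱ (≤-trans (s≤s (n≤1+n (length p))) (≤-reflexive (cong suc (trans (sym r) (cong ell (prodS-∷ n i p)))))))

reduced-dem : ∀ {n p} → All (Adj n) p → Reduced n p → dem n (word p) ≡ prodS n p
reduced-dem [] r = refl
reduced-dem {n} {i ∷ p} (A ∷ As) r = let (s , asc) = isReduced-∷⁻ A As r in
  trans (dem-∷ n i p) (trans (cong (λ v → demStep v i) (reduced-dem As s)) (trans (demStep-asc (prodS-perm As) A asc) (sym (prodS-∷ n i p))))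

bruhat-refl : ∀ f w → bruhatLeF f w w ≡ true
bruhat-refl zero w = eqPerm-refl w
bruhat-refl (suc f) w rewrite eqPerm-refl w = refl

anyB-++ : ∀ xs ys → anyB (xs ++ ys) ≡ anyB xs ∨ anyB ys
anyB-++ [] ys = refl
anyB-++ (true ∷ xs) ys = refl
anyB-++ (false ∷ xs) ys = anyB-++ xs ys

∨-elim : ∀ {a b} → (a ∨ b) ≡ true → a ≡ true ⊎ b ≡ true
∨-elim {true} t = inj₁ refl
∨-elim {false} t = inj₂ t

∨-introʳ : ∀ a {b} → b ≡ true → (a ∨ b) ≡ true
∨-introʳ true t = refl
∨-introʳ false t = t

anyB₂-elim : ∀ (f : ℕ → ℕ → Bool) ys xs → anyB (concatMap (λ a → map (f a) ys) xs) ≡ true → ∃ λ a → ∃ λ b → a ∈ xs × b ∈ ys × f a b ≡ true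
anyB₂-elim f ys (x ∷ xs) t with ∨-elim {anyB (map (f x) ys)} (trans (sym (anyB-++ (map (f x) ys) _)) t)
... | inj₁ u = let (b , m , q) = anyB-elim (f x) ys u in x , b , here refl , m , q
... | inj₂ u = let (a , b , l , m , q) = anyB₂-elim f ys xs u in a , b , there l , m , q

anyB₂-intro : ∀ (f : ℕ → ℕ → Bool) {ys xs a b} → a ∈ xs → b ∈ ys → f a b ≡ true → anyB (concatMap (λ a → map (f a) ys) xs) ≡ true
anyB₂-intro f {ys} (here {x} {xs} refl) m q = trans (anyB-++ (map (f x) ys) _) (cong (_∨ anyB (concatMap (λ a → map (f a) ys) xs)) (anyB-intro (f x) m q))
anyB₂-intro f {ys} (there {x} l) m q = trans (anyB-++ (map (f x) ys) _) (∨-introʳ (anyB (map (f x) ys)) (anyB₂-intro f l m q))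

-- `bruhatLeF` peels a chain from its bottom, whereas `U` grows at the top; induction on the fuel
-- carries the new top step through the chain.
bruhat-step : ∀ {n} f {u v a b} → IsPerm n u → In n a → In n b → a < b → ell v < ell (mulT v a b) →
  bruhatLeF f u v ≡ true → bruhatLeF (suc f) u (mulT v a b) ≡ true
bruhat-step {n} f {u} {v} {a} {b} U p q lt up t = ∨-introʳ (eqPerm u (mulT v a b)) (go f t)
  where
  covers : ℕ → Perm → ℕ → ℕ → Bool
  covers f v a b = (a <ᵇ b) ∧ (ell u <ᵇ ell (mulT u a b)) ∧ bruhatLeF f (mulT u a b) v
  In⇒∈ : ∀ {k} → In n k → k ∈ range (length u)
  In⇒∈ r = In⇒∈-range (subst (λ m → In m _) (sym (len U)) r)
  equal : ∀ f → u ≡ v → anyB (concatMap (λ c → map (covers f (mulT v a b) c) (range (length u))) (range (length u))) ≡ true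
  equal f refl = anyB₂-intro (covers f (mulT v a b)) (In⇒∈ p) (In⇒∈ q) (cong₂ _∧_ (<⇒<ᵇ≡ lt) (cong₂ _∧_ (<⇒<ᵇ≡ up) (bruhat-refl f (mulT v a b))))
  go : ∀ f → bruhatLeF f u v ≡ true → anyB (concatMap (λ c → map (covers f (mulT v a b) c) (range (length u))) (range (length u))) ≡ true
  go zero t = equal zero (eqPerm⇒≡ t)
  go (suc f) t with ∨-elim {eqPerm u v} t
  ... | inj₁ e = equal (suc f) (eqPerm⇒≡ e)
  ... | inj₂ e = let (c , d , l , m , r) = anyB₂-elim (covers f v) (range (length u)) (range (length u)) e
                     (x , y) = ∧-true {c <ᵇ d} r
                     (z , s) = ∧-true {ell u <ᵇ ell (mulT u c d)} y
                     to-In = λ {k} (m : k ∈ range (length u)) → subst (λ m → In m k) (len U) (∈-range⇒In m)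
                 in anyB₂-intro (covers (suc f) (mulT v a b)) l m
                      (cong₂ _∧_ x (cong₂ _∧_ z (bruhat-step f (mulT-perm U (to-In l) (to-In m)) p q lt up s)))

bruhat-U : ∀ {n w i S} f → IsPerm n w → In n i → Chain n w i S → length S ≤ f → bruhatLeF f w (U w i S) ≡ true
bruhat-U {w = w} {S = []} f W p c le = bruhat-refl f w
bruhat-U {S = x ∷ S} (suc f) W p c@(chain ((e , q) ∷ _) _) (s≤s le) =
  bruhat-step f W p q (right-of e) (U-step-ell W p c) (bruhat-U f W p (chain-tail c) le)

module _ {n : ℕ} {w : Perm} {i : ℕ} (W : IsPerm n w) (A : Adj n i) (asc : app w i < app w (suc i)) where
  chain-shift : ∀ {S} → Chain n w i (suc i ∷ S) → Chain n (mulS w i) (suc i) S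
  chain-shift (chain (_ ∷ es) (d ∷ ds)) = chain (All.zipWith shift (es , d)) (shift-pairs es d ds)
    where
    shift : ∀ {a} → (Exposed n w i a × In n a) × Decreasing n w i (suc i) a → Exposed n (mulS w i) (suc i) a × In n a
    shift {a} ((e , q) , (lt , _)) = exposedᵇ⇒ n (mulS w i) (suc i) (proj₁ (∧-true {exposedᵇ n (mulS w i) (suc i) a} (trans (sym eq) (⇒exposedᵇ n w i e)))) , q
      where
      r : Bool
      r = exposedᵇ n (mulS w i) (suc i) a ∧ (app w a <ᵇ app w (suc i))
      eq : exposedᵇ n w i a ≡ r
      eq = trans (exposed-mulS W A asc q) (cong (_∨ r) (≢⇒≡ᵇ (<⇒≢ lt ∘ sym)))
    shift-pairs : ∀ {S} → All (λ a → Exposed n w i a × In n a) S → All (Decreasing n w i (suc i)) S → AllPairs (Decreasing n w i) S →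
      AllPairs (Decreasing n (mulS w i) (suc i)) S
    shift-pairs [] [] [] = []
    shift-pairs ((_ , q) ∷ es) ((lt , _) ∷ d) (r ∷ ds) = All.zipWith (λ { (((_ , q′) , (lt′ , _)) , (x<y , y<x)) → x<y ,
        subst₂ _<_ (sym (mulS-beyond W A asc q′ lt′)) (sym (mulS-beyond W A asc q lt)) y<x })
      (All.zip (es , d) , r) ∷ shift-pairs es d ds

  -- Removing i + 1 by `U-mulS` presents the target as a product of transpositions climbing from
  -- ws_i.
  bruhat-chain : ∀ {S} → Chain n w i (suc i ∷ S) → bruhatLe (mulS w i) (U w i (suc i ∷ S)) ≡ true
  bruhat-chain {S} c = trans (cong₂ (λ m u → bruhatLeF (m * m + 1) (mulS w i) u) (len (mulS-perm W A)) (U-mulS W A after))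
    (bruhat-U (n * n + 1) (mulS-perm W A) (Adj-r A) (chain-shift c) bounded)
    where
    after : All (λ a → In n a × suc i < a) S
    after = All.map (λ (e , q) → q , right-of e) (members (chain-shift c))
    -- Each element of S raises the length, and lengths are at most n², so the fuel in `bruhatLe`
    -- covers the whole chain.
    bounded : length S ≤ n * n + 1
    bounded = ≤-trans (m≤n+m (length S) (ell (mulS w i))) (≤-trans (U-ell (mulS-perm W A) (Adj-r A) (chain-shift c))
      (≤-trans (ell-≤ (U-perm (mulS-perm W A) (Adj-r A) (All.map proj₁ after))) (m≤m+n (n * n) 1)))

  -- Here x lies beyond i + 1 without being blocked by it, so w(x) < w(i+1); these are the values of
  -- the product at i and i + 1.
  chain-asc : ∀ {x S} → Chain n w i (x ∷ S) → x ≢ suc i → app (U w i (x ∷ S)) i < app (U w i (x ∷ S)) (suc i)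
  chain-asc {x} {S} (chain ((e , q) ∷ es) (d ∷ _)) ne = subst₂ _<_
    (sym (U-head W (Adj-l A) q (All.map proj₂ es) (<⇒≢ (right-of e) ∘ sym) (All.map (<⇒≢ ∘ proj₁) d)))
    (sym (U-other W (Adj-l A) (q ∷ All.map proj₂ es) (Adj-r A) (<⇒≢ (n<1+n i) ∘ sym) (ne ∘ sym ∷ All.map (λ (x<y , _) → <⇒≢ (<-trans si<x x<y)) d)))
    (≤∧≢⇒< (≮⇒≥ (unblocked e (Adj-r A) (n<1+n i) si<x asc)) (λ eq → <⇒≢ si<x (sym (inj W q (Adj-r A) eq))))
    where
    si<x : suc i < x
    si<x = ≤∧≢⇒< (right-of e) (ne ∘ sym)

-- The four expansions over an abstract Laurent algebra

module Expansions {n : ℕ} (A : LaurentAlgebra n) where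
  open LaurentAlgebra A
  open Sums A
  open PathSum A
  open import Relation.Binary.Reasoning.Setoid ≈-setoid
  module D₀ = Demazure A (+ 0)
  module D₁ = Demazure A (+ 1)
  module D₋ = Demazure A -[1+ 0 ]
  module G₀ = Grothendieck A (+ 0)
  module G₁ = Grothendieck A (+ 1)
  module G₋ = Grothendieck A -[1+ 0 ]
  module T₀ = Transition A (+ 0)
  module T₁ = Transition A (+ 1)

  w0-perm : IsPerm n (w0 n)
  w0-perm = subst (IsPerm n) (mulPerm-w0-id n) (mulPerm-w0-perm (idPerm-perm n))

  G-w0 : ∀ β → Grothendieck.G A β (w0 n) ≡ Δ
  G-w0 β = trans (Grothendieck.G-unfold A β w0-perm)
    (cong (maybe (λ k → Demazure.π A β k (Grothendieck.G A β (mulS (w0 n) k))) Δ) (firstAscent-w0 n))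

  weight₁ : ∀ S → T₁.weight S ≡ + 1
  weight₁ S = ℤ.^-zeroˡ (pred (length S))

  transition₁ : ∀ {w j i} → IsPerm n w → Corner n w j i → X i (G₁.G w) ≈ Σ G₁.G (targets 𝒢bar n w i)
  transition₁ {w} {j} {i} W c = ≈-trans (T₁.transition W c) (≈-trans (Σ-cong (All.universal (λ S →
      coefficientwise (T₁.weight S :* ⟨ G₁.G (U w i S) ⟩) ⟨ G₁.G (U w i S) ⟩ (λ e → trans (cong (ℤ._* coef (G₁.G (U w i S)) e) (weight₁ S)) (ℤ.*-identityˡ _)))
    (neSubsets (phi n w i)))) (≈-trans (Σ-cong (All.universal (λ S → ≈-reflexive (cong G₁.G (sym (U-foldl w i S)))) (neSubsets (phi n w i))))
      (≈-reflexive (sym (Σ-map G₁.G _ (neSubsets (phi n w i)))))))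

  -- The weight 0^(length S - 1) removes all sets with more than one element, and the singletons
  -- give the targets in 𝒢.
  transition₀ : ∀ {w j i} → IsPerm n w → Corner n w j i → X i (G₀.G w) ≈ Σ G₀.G (targets 𝒢 n w i)
  transition₀ {w} {j} {i} W c = ≈-trans (T₀.transition W c) (≈-trans (singletons (phi n w i)) (≈-reflexive (sym (Σ-map G₀.G (mulT w i) (phi n w i)))))
    where
    singletons : ∀ xs → Σ (T₀.term w i) (neSubsets xs) ≈ Σ (λ x → G₀.G (mulT w i x)) xs
    singletons [] = ≈-refl
    singletons (x ∷ xs) = ≈-trans (Σ-++ (T₀.term w i) (map (x ∷_) (subsets xs)) (neSubsets xs)) (⊕-cong
      (≈-trans (≈-reflexive (Σ-map (T₀.term w i) (x ∷_) (subsets xs))) (≈-trans (Σ-subsets (λ S → T₀.term w i (x ∷ S)) xs)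
        (≈-trans (⊕-cong (coefficientwise ((+ 1) :* ⟨ f ⟩) ⟨ f ⟩ (λ e → ℤ.*-identityˡ (coef f e)))
          (Σ-zero (All.map (λ { {y ∷ S} (nonEmpty , _) → coefficientwise (T₀.weight (x ∷ y ∷ S) :* ⟨ G₀.G (U w i (x ∷ y ∷ S)) ⟩) :0
            (λ e → ℤ.*-zeroˡ (coef (G₀.G (U w i (x ∷ y ∷ S))) e)) }) (neSubsets-All (All.universal (λ _ → tt) xs) (always xs)))))
          (⊕-identityʳ _))))
      (singletons xs))
      where
      f = G₀.G (mulT w i x)
      always : ∀ xs → AllPairs (λ _ _ → ⊤) xs
      always [] = []
      always (x ∷ xs) = All.universal (λ _ → tt) xs ∷ always xs

  inverse-weight : List ℕ → M
  inverse-weight = foldr Y Δ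

  grothendieck-paths : ∀ {w} → IsPerm n w → G₁.G w ≈ Σ inverse-weight (paths 𝒢bar n w)
  grothendieck-paths {w} W = path-sum 𝒢bar G₁.G Y inverse-weight Y-linear (≈-reflexive (sym (G-w0 (+ 1)))) (λ _ _ → ≈-refl)
    (λ {w} {j} {i} W c → ≈-trans (≈-sym (YX i (G₁.G w))) (≈-trans (resp (Y-linear i) (transition₁ W c)) (Σ-linear (Y-linear i) G₁.G (targets 𝒢bar n w i))))
    (n * n + 1) W (G₁.full-fuel w _ G₁.n²<n²+1)

  schubert-paths : ∀ {w} → IsPerm n w → G₀.G w ≈ Σ inverse-weight (paths 𝒢 n w)
  schubert-paths {w} W = path-sum 𝒢 G₀.G Y inverse-weight Y-linear (≈-reflexive (sym (G-w0 (+ 0)))) (λ _ _ → ≈-refl)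
    (λ {w} {j} {i} W c → ≈-trans (≈-sym (YX i (G₀.G w))) (≈-trans (resp (Y-linear i) (transition₀ W c)) (Σ-linear (Y-linear i) G₀.G (targets 𝒢 n w i))))
    (n * n + 1) W (G₁.full-fuel w _ G₁.n²<n²+1)

  π₀≈∂ : ∀ k f → D₀.π k f ≈ ∂ k f
  π₀≈∂ k f = resp (∂-linear k) (coefficientwise (⟨ f ⟩ :+ (+ 0) :* ⟨ X (suc k) f ⟩) ⟨ f ⟩ (λ e → lemma (coef f e) (coef (X (suc k) f) e)))
    where
    lemma : ∀ a b → a ℤ.+ (+ 0) ℤ.* b ≡ a
    lemma = solve-∀

  dual : Perm → Perm
  dual v = mulPerm (w0 n) v

  schubertSummand : List ℕ → M
  schubertSummand p = G₀.G (dual (dem n (word p)))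

  -- Extended by zero, because `path-sum` runs over all paths; the filter by reducedness is restored
  -- at the end by `Σ-filterB`.
  reducedSummand : List ℕ → M
  reducedSummand p = if isReduced n (word p) then schubertSummand p else 𝟘

  grothendieckSummand : List ℕ → M
  grothendieckSummand p = G₋.G (dual (dem n (word p)))

  -- Left multiplication by w₀ exchanges ascents and descents. A letter that lengthens the product
  -- is realised by ∂_i; a letter that shortens it meets a polynomial symmetric in x_i, x_{i+1}, and
  -- the resulting zero is the value given to an unreduced word.
  reducedSummand-∷ : ∀ {i p} → Adj n i → All (Adj n) p → reducedSummand (i ∷ p) ≈ ∂ i (reducedSummand p)
  reducedSummand-∷ {i} {p} A As = cases (isReduced n (word p)) refl
    where
    P = prodS n p
    V = prodS-perm As
    unreduced : ∀ {q} → ¬ Reduced n q → reducedSummand q ≡ 𝟘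
    unreduced {q} h with isReduced n (word q) in eq
    ... | true = contradiction (isReduced⇒ {n} {q} eq) h
    ... | false = refl
    reduced : ∀ {q} → All (Adj n) q → Reduced n q → reducedSummand q ≡ G₀.G (dual (prodS n q))
    reduced {q} As r = trans (cong (λ b → if b then schubertSummand q else 𝟘) (⇒isReduced {n} {q} r)) (cong (λ v → G₀.G (dual v)) (reduced-dem As r))
    cases : ∀ b → isReduced n (word p) ≡ b → reducedSummand (i ∷ p) ≈ ∂ i (reducedSummand p)
    cases false eq = ≈-trans (≈-reflexive (unreduced {i ∷ p} (λ r → ¬r (proj₁ (isReduced-∷⁻ A As r)))))
      (≈-sym (≈-trans (resp (∂-linear i) (≈-reflexive (unreduced {p} ¬r))) (linear-𝟘 (∂-linear i))))
      where
      ¬r : ¬ Reduced n p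
      ¬r r = true≢false (trans (sym (⇒isReduced {n} {p} r)) eq)
    cases true eq with asc-or-desc V (Adj-l A) (Adj-r A) (<⇒≢ (n<1+n i))
    ... | inj₁ asc = begin
      reducedSummand (i ∷ p) ≡⟨ reduced (A ∷ As) (isReduced-∷-asc A As r asc) ⟩
      G₀.G (dual (prodS n (i ∷ p))) ≡⟨ cong G₀.G (trans (cong dual (prodS-∷ n i p)) (mulPerm-w0-mulS V A)) ⟩
      G₀.G (mulS (dual P) i) ≈⟨ G₀.G-desc (mulPerm-w0-perm V) A (mulPerm-w0-reverses V (Adj-l A) (Adj-r A) asc) ⟩
      D₀.π i (G₀.G (dual P)) ≈⟨ π₀≈∂ i _ ⟩
      ∂ i (G₀.G (dual P)) ≡⟨ cong (∂ i) (sym (reduced As r)) ⟩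
      ∂ i (reducedSummand p) ∎
      where r = isReduced⇒ {n} {p} eq
    ... | inj₂ d = begin
      reducedSummand (i ∷ p) ≡⟨ unreduced {i ∷ p} (λ r → <-asym d (proj₂ (isReduced-∷⁻ A As r))) ⟩
      𝟘 ≈⟨ ≈-sym (G₀.∂-G (mulPerm-w0-perm V) A (mulPerm-w0-reverses V (Adj-r A) (Adj-l A) d)) ⟩
      ∂ i (G₀.G (dual P)) ≡⟨ cong (∂ i) (sym (reduced As (isReduced⇒ {n} {p} eq))) ⟩
      ∂ i (reducedSummand p) ∎

  transition-ℛ : ∀ {w j i} → IsPerm n w → Corner n w j i → G₁.G w ≈ Σ (λ u → ∂ i (G₁.G u)) (targets ℛ n w i)
  transition-ℛ {w} {j} {i} W c = begin
    G₁.G w ≈⟨ ≈-sym (D₁.∂-X-fixed A₁ (G₁.∂-G W A₁ asc)) ⟩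
    ∂ i (X i (G₁.G w)) ≈⟨ ≈-trans (resp (∂-linear i) (transition₁ W c)) (Σ-linear (∂-linear i) G₁.G (PhiBar n w i)) ⟩
    Σ (λ u → ∂ i (G₁.G u)) (PhiBar n w i) ≡⟨ Σ-map _ _ (neSubsets (phi n w i)) ⟩
    Σ (λ S → ∂ i (G₁.G (F S))) (neSubsets (phi n w i)) ≈⟨ Σ-cong (All.map (λ {S} (ne , s) → keep ne s) (phi-chains i W)) ⟩
    Σ (λ S → if bruhatLe (mulS w i) (F S) then ∂ i (G₁.G (F S)) else 𝟘) (neSubsets (phi n w i)) ≡⟨ sym (Σ-map _ F (neSubsets (phi n w i))) ⟩
    Σ (λ u → if bruhatLe (mulS w i) u then ∂ i (G₁.G u) else 𝟘) (PhiBar n w i) ≈⟨ ≈-sym (Σ-filterB (λ u → ∂ i (G₁.G u)) (bruhatLe (mulS w i)) (PhiBar n w i)) ⟩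
    Σ (λ u → ∂ i (G₁.G u)) (targets ℛ n w i) ∎
    where
    A₁ : Adj n i
    A₁ = corner-Adj W c
    asc = corner-asc W c
    F : List ℕ → Perm
    F S = foldl (λ v a → mulT v i a) w (reverse S)
    -- If the least element of S is i + 1, the Bruhat test succeeds. Otherwise the target ascends at
    -- i, its divided difference is zero, and both outcomes of the test give the same summand.
    keep : ∀ {S} → NonEmpty S → Chain n w i S → ∂ i (G₁.G (F S)) ≈ (if bruhatLe (mulS w i) (F S) then ∂ i (G₁.G (F S)) else 𝟘)
    keep {x ∷ S} nonEmpty s with x ≟ suc i
    ... | yes refl rewrite U-foldl w i (x ∷ S) | bruhat-chain W A₁ asc s = ≈-refl
    ... | no ne rewrite U-foldl w i (x ∷ S) with bruhatLe (mulS w i) (U w i (x ∷ S))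
    ...   | true = ≈-refl
    ...   | false = G₁.∂-G (U-perm W (row-In c) (chain-In s)) A₁ (chain-asc W A₁ asc s ne)

  grothendieck-to-schubert : ∀ {w} → IsPerm n w → G₁.G w ≈ Σ schubertSummand (filterB (λ p → isReduced n (word p)) (paths ℛ n w))
  grothendieck-to-schubert {w} W = ≈-trans (path-sum ℛ G₁.G ∂ reducedSummand ∂-linear empty reducedSummand-∷ transition-ℛ (n * n + 1) W (G₁.full-fuel w _ G₁.n²<n²+1))
    (≈-sym (Σ-filterB schubertSummand (λ p → isReduced n (word p)) (paths ℛ n w)))
    where
    empty : reducedSummand [] ≈ G₁.G (w0 n)
    empty = ≈-reflexive (trans (cong (λ b → if b then schubertSummand [] else 𝟘) (⇒isReduced {n} {[]} (ell-id n)))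
      (trans (cong G₀.G (mulPerm-w0-id n)) (trans (G-w0 (+ 0)) (sym (G-w0 (+ 1))))))

  -- At β = -1 the operator π_i fixes symmetric polynomials, in accordance with the Demazure
  -- product, which stays put at a descent.
  grothendieckSummand-∷ : ∀ {i p} → Adj n i → All (Adj n) p → grothendieckSummand (i ∷ p) ≈ D₋.π i (grothendieckSummand p)
  grothendieckSummand-∷ {i} {p} A As = ≈-trans (≈-reflexive (cong (λ v → G₋.G (dual v)) (dem-∷ n i p))) step
    where
    v = dem n (word p)
    V : IsPerm n v
    V = dem-perm As
    step : G₋.G (dual (demStep v i)) ≈ D₋.π i (G₋.G (dual v))
    step with asc-or-desc V (Adj-l A) (Adj-r A) (<⇒≢ (n<1+n i))
    ... | inj₁ asc = ≈-trans (≈-reflexive (cong G₋.G (trans (cong dual (demStep-asc V A asc)) (mulPerm-w0-mulS V A))))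
      (G₋.G-desc (mulPerm-w0-perm V) A (mulPerm-w0-reverses V (Adj-l A) (Adj-r A) asc))
    ... | inj₂ d = ≈-trans (≈-reflexive (cong (λ v → G₋.G (dual v)) (demStep-desc V A d)))
      (≈-sym (≈-trans (D₋.π-fixed A (G₋.∂-G (mulPerm-w0-perm V) A (mulPerm-w0-reverses V (Adj-r A) (Adj-l A) d)))
        (coefficientwise ((+ 1) :* ⟨ G₋.G (dual v) ⟩) ⟨ G₋.G (dual v) ⟩ (λ e → ℤ.*-identityˡ (coef (G₋.G (dual v)) e)))))

  -- For symmetric f one has π_k f = f, so the term -x_{k+1} f coming from θ is cancelled by x_{k+1}
  -- π_k f.
  π-X-fixed : ∀ {k f} → Adj n k → ∂ k f ≈ 𝟘 → D₋.π k (X k f) ≈ f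
  π-X-fixed {k} {f} A p = begin
    D₋.π k (X k f) ≈⟨ D₋.π-Xˡ A f ⟩
    D₋.θ (suc k) f ⊕ X (suc k) (D₋.π k f) ≈⟨ ⊕-cong ≈-refl (≈-trans (resp (X-linear (suc k)) (D₋.π-fixed A p)) (scale (X-linear (suc k)) (+ 1) f)) ⟩
    f ⊕ -[1+ 0 ] · X (suc k) f ⊕ (+ 1) · X (suc k) f
      ≈⟨ coefficientwise (⟨ f ⟩ :+ -[1+ 0 ] :* ⟨ X (suc k) f ⟩ :+ (+ 1) :* ⟨ X (suc k) f ⟩) ⟨ f ⟩ (λ e → lemma (coef f e) (coef (X (suc k) f) e)) ⟩
    f ∎
    where
    lemma : ∀ a b → a ℤ.+ -[1+ 0 ] ℤ.* b ℤ.+ (+ 1) ℤ.* b ≡ a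
    lemma = solve-∀

  schubert-to-grothendieck : ∀ {w} → IsPerm n w → G₀.G w ≈ Σ grothendieckSummand (paths 𝒢 n w)
  schubert-to-grothendieck {w} W = path-sum 𝒢 G₀.G D₋.π grothendieckSummand D₋.π-linear empty grothendieckSummand-∷ step (n * n + 1) W (G₁.full-fuel w _ G₁.n²<n²+1)
    where
    empty : grothendieckSummand [] ≈ G₀.G (w0 n)
    empty = ≈-reflexive (trans (cong G₋.G (mulPerm-w0-id n)) (trans (G-w0 -[1+ 0 ]) (sym (G-w0 (+ 0)))))
    step : ∀ {w j i} → IsPerm n w → Corner n w j i → G₀.G w ≈ Σ (λ u → D₋.π i (G₀.G u)) (targets 𝒢 n w i)
    step {w} {j} {i} W c = ≈-trans (≈-sym (π-X-fixed (corner-Adj W c) (G₀.∂-G W (corner-Adj W c) (corner-asc W c))))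
      (≈-trans (resp (D₋.π-linear i) (transition₀ W c)) (Σ-linear (D₋.π-linear i) G₀.G (targets 𝒢 n w i)))

-- Divided differences of monomials

Term : Set
Term = ℤ × Mono

coeff-++ : ∀ p q e → coeff (p ++ q) e ≡ coeff p e ℤ.+ coeff q e
coeff-++ [] q e = sym (ℤ.+-identityˡ _)
coeff-++ ((c , m) ∷ p) q e with eqMono m e
... | true = trans (cong (λ x → c ℤ.+ x) (coeff-++ p q e)) (sym (ℤ.+-assoc c (coeff p e) (coeff q e)))
... | false = coeff-++ p q e

scaleP : ℤ → Poly → Poly
scaleP d = map (λ (c , m) → d ℤ.* c , m)

coeff-scaleP : ∀ d p e → coeff (scaleP d p) e ≡ d ℤ.* coeff p e
coeff-scaleP d [] e = sym (ℤ.*-zeroʳ d)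
coeff-scaleP d ((c , m) ∷ p) e with eqMono m e
... | true = trans (cong (λ x → d ℤ.* c ℤ.+ x) (coeff-scaleP d p e)) (sym (ℤ.*-distribˡ-+ d c (coeff p e)))
... | false = coeff-scaleP d p e

-- The linear functional with prescribed values on monomials. It is computed on the list, while
-- `_≈P_` sees only coefficients; the operators respect `_≈P_` because their coefficients are
-- functionals of this kind.
linExt : (Mono → ℤ) → Poly → ℤ
linExt g [] = + 0
linExt g ((c , m) ∷ p) = c ℤ.* g m ℤ.+ linExt g p

linExt-++ : ∀ g p q → linExt g (p ++ q) ≡ linExt g p ℤ.+ linExt g q
linExt-++ g [] q = sym (ℤ.+-identityˡ _)
linExt-++ g ((c , m) ∷ p) q = trans (cong (λ x → c ℤ.* g m ℤ.+ x) (linExt-++ g p q)) (sym (ℤ.+-assoc (c ℤ.* g m) (linExt g p) (linExt g q)))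

linExt-scaleP : ∀ g d p → linExt g (scaleP d p) ≡ d ℤ.* linExt g p
linExt-scaleP g d [] = sym (ℤ.*-zeroʳ d)
linExt-scaleP g d ((c , m) ∷ p) = trans (cong (λ x → d ℤ.* c ℤ.* g m ℤ.+ x) (linExt-scaleP g d p)) (lemma d c (g m) (linExt g p))
  where
  lemma : ∀ d c x y → d ℤ.* c ℤ.* x ℤ.+ d ℤ.* y ≡ d ℤ.* (c ℤ.* x ℤ.+ y)
  lemma = solve-∀

without : Mono → Poly → Poly
without m [] = []
without m ((c , m′) ∷ p) = if eqMono m′ m then without m p else (c , m′) ∷ without m p

eqMono-refl : ∀ m → eqMono m m ≡ true
eqMono-refl m with ≡-dec ℤ._≟_ m m
... | yes _ = refl
... | no ne = contradiction refl ne

eqMono⇒≡ : ∀ {m m′} → eqMono m m′ ≡ true → m ≡ m′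
eqMono⇒≡ {m} {m′} t with ≡-dec ℤ._≟_ m m′
... | yes e = e

linExt-without : ∀ g m p → linExt g p ≡ coeff p m ℤ.* g m ℤ.+ linExt g (without m p)
linExt-without g m [] = sym (trans (ℤ.+-identityʳ _) (ℤ.*-zeroˡ (g m)))
linExt-without g m ((c , m′) ∷ p) with eqMono m′ m in eq
... | true rewrite eqMono⇒≡ {m′} {m} eq = trans (cong (λ x → c ℤ.* g m ℤ.+ x) (linExt-without g m p)) (lemma c (g m) (coeff p m) (linExt g (without m p)))
  where
  lemma : ∀ c x y z → c ℤ.* x ℤ.+ (y ℤ.* x ℤ.+ z) ≡ (c ℤ.+ y) ℤ.* x ℤ.+ z
  lemma = solve-∀
... | false = trans (cong (λ x → c ℤ.* g m′ ℤ.+ x) (linExt-without g m p)) (lemma (c ℤ.* g m′) (coeff p m ℤ.* g m) (linExt g (without m p)))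
  where
  lemma : ∀ x y z → x ℤ.+ (y ℤ.+ z) ≡ y ℤ.+ (x ℤ.+ z)
  lemma = solve-∀

coeff-without : ∀ m p e → coeff (without m p) e ≡ (if eqMono m e then + 0 else coeff p e)
coeff-without m [] e with eqMono m e
... | true = refl
... | false = refl
coeff-without m ((c , m′) ∷ p) e with eqMono m′ m in eq
... | true rewrite eqMono⇒≡ {m′} {m} eq with coeff-without m p e
...   | h with eqMono m e
...     | true = h
...     | false = h
coeff-without m ((c , m′) ∷ p) e | false with coeff-without m p e
... | h with eqMono m′ e in eq′
...   | false = h
...   | true rewrite sym (eqMono⇒≡ {m′} {e} eq′) with eqMono m m′ in eq″
...     | false = cong (λ x → c ℤ.+ x) h
...     | true = contradiction (trans (sym (trans (cong (eqMono m′) (eqMono⇒≡ {m} {m′} eq″)) (eqMono-refl m′))) eq) true≢false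

length-without : ∀ m p → length (without m p) ≤ length p
length-without m [] = z≤n
length-without m ((c , m′) ∷ p) with eqMono m′ m
... | true = m≤n⇒m≤1+n (length-without m p)
... | false = s≤s (length-without m p)

-- Induction on a bound for the length: collecting all terms with the head monomial contributes its
-- coefficient, which is zero, and leaves a shorter list whose coefficients still vanish.
linExt-≈0 : ∀ g b p → length p ≤ b → (∀ e → coeff p e ≡ + 0) → linExt g p ≡ + 0
linExt-≈0 g b [] le h = refl
linExt-≈0 g (suc b) ((c , m) ∷ p) (s≤s le) h = begin
  linExt g q ≡⟨ linExt-without g m q ⟩
  coeff q m ℤ.* g m ℤ.+ linExt g (without m q) ≡⟨ cong₂ (λ x y → x ℤ.* g m ℤ.+ y) (h m) (linExt-≈0 g b (without m q) shorter zeros) ⟩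
  + 0 ℤ.* g m ℤ.+ + 0 ≡⟨ trans (ℤ.+-identityʳ _) (ℤ.*-zeroˡ (g m)) ⟩
  + 0 ∎
  where
  open ≡-Reasoning
  q = (c , m) ∷ p
  shorter : length (without m q) ≤ b
  shorter rewrite eqMono-refl m = ≤-trans (length-without m p) le
  zeros : ∀ e → coeff (without m q) e ≡ + 0
  zeros e = trans (coeff-without m q e) (either (eqMono m e) (h e))
    where
    either : ∀ b {x} → x ≡ + 0 → (if b then + 0 else x) ≡ + 0
    either true _ = refl
    either false r = r

-- The vanishing statement is applied to the list p - q.
linExt-cong : ∀ g p q → p ≈P q → linExt g p ≡ linExt g q
linExt-cong g p q h = trans (sym (ℤ.+-identityʳ _)) (trans (cong (λ x → linExt g p ℤ.+ x) (sym cancel)) (trans (lemma (linExt g p) (linExt g q))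
    (trans (cong (ℤ._+ linExt g q) (trans (cong (λ x → linExt g p ℤ.+ x) (sym (linExt-scaleP g -[1+ 0 ] q))) (trans (sym (linExt-++ g p (scaleP -[1+ 0 ] q))) difference)))
      (ℤ.+-identityˡ _))))
  where
  cancel : -[1+ 0 ] ℤ.* linExt g q ℤ.+ linExt g q ≡ + 0
  cancel = lemma′ (linExt g q)
    where
    lemma′ : ∀ a → -[1+ 0 ] ℤ.* a ℤ.+ a ≡ + 0
    lemma′ = solve-∀
  lemma : ∀ a b → a ℤ.+ (-[1+ 0 ] ℤ.* b ℤ.+ b) ≡ a ℤ.+ -[1+ 0 ] ℤ.* b ℤ.+ b
  lemma = solve-∀
  difference : linExt g (p ++ scaleP -[1+ 0 ] q) ≡ + 0
  difference = linExt-≈0 g _ (p ++ scaleP -[1+ 0 ] q) ≤-refl λ e → trans (coeff-++ p _ e)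
    (trans (cong₂ ℤ._+_ (h e) (coeff-scaleP -[1+ 0 ] q e)) (lemma″ (coeff q e)))
    where
    lemma″ : ∀ a → a ℤ.+ -[1+ 0 ] ℤ.* a ≡ + 0
    lemma″ = solve-∀

-- Homogeneity in the scalar makes the coefficients of the extension by `concatMap` into functionals
-- `linExt`, so the extension respects `_≈P_` and is linear.
record LinearKernel (κ : Term → Poly) : Set where
  constructor kernel
  field
    homogeneous : ∀ c m e → coeff (κ (c , m)) e ≡ c ℤ.* coeff (κ (+ 1 , m)) e

  coeff-concatMap : ∀ p e → coeff (concatMap κ p) e ≡ linExt (λ m → coeff (κ (+ 1 , m)) e) p
  coeff-concatMap [] e = refl
  coeff-concatMap ((c , m) ∷ p) e = trans (coeff-++ (κ (c , m)) (concatMap κ p) e) (cong₂ ℤ._+_ (homogeneous c m e) (coeff-concatMap p e))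

  concatMap-cong : ∀ p q → p ≈P q → concatMap κ p ≈P concatMap κ q
  concatMap-cong p q h e = trans (coeff-concatMap p e) (trans (linExt-cong _ p q h) (sym (coeff-concatMap q e)))

  concatMap-scaleP : ∀ c p → concatMap κ (scaleP c p) ≈P scaleP c (concatMap κ p)
  concatMap-scaleP c p e = trans (coeff-concatMap (scaleP c p) e) (trans (linExt-scaleP _ c p)
    (sym (trans (coeff-scaleP c (concatMap κ p) e) (cong (c ℤ.*_) (coeff-concatMap p e)))))

coeff-map-const : ∀ {B : Set} c (P : B → Mono) xs e → coeff (map (λ k → (c , P k)) xs) e ≡ c ℤ.* coeff (map (λ k → (+ 1 , P k)) xs) e
coeff-map-const c P [] e = sym (ℤ.*-zeroʳ c)
coeff-map-const c P (x ∷ xs) e with eqMono (P x) e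
... | true = trans (cong (λ y → c ℤ.+ y) (coeff-map-const c P xs e)) (lemma c (coeff (map (λ k → (+ 1 , P k)) xs) e))
  where
  lemma : ∀ c y → c ℤ.+ c ℤ.* y ≡ c ℤ.* (+ 1 ℤ.+ y)
  lemma = solve-∀
... | false = coeff-map-const c P xs e

single-kernel : ∀ (μ : Mono → Mono) → LinearKernel (λ (c , m) → [ (c , μ m) ])
single-kernel μ = kernel λ c m e → coeff-map-const c (λ _ → μ m) (tt ∷ []) e

NiTerm-kernel : ∀ i → LinearKernel (NiTerm i)
NiTerm-kernel i = kernel go
  where
  go : ∀ c m e → coeff (NiTerm i (c , m)) e ≡ c ℤ.* coeff (NiTerm i (+ 1 , m)) e
  go c m e with ⌊ expAt m (suc i) ℤ.<? expAt m i ⌋ | ⌊ expAt m i ℤ.<? expAt m (suc i) ⌋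
  ... | true | _ = coeff-map-const c _ (applyUpTo (λ k → k) ℤ.∣ expAt m i ℤ.- expAt m (suc i) ∣) e
  ... | false | true = trans (coeff-map-const (- c) _ xs e) (trans (lemma c (coeff (map _ xs) e)) (cong (c ℤ.*_) (sym (coeff-map-const -[1+ 0 ] _ xs e))))
    where
    xs = applyUpTo (λ k → k) ℤ.∣ expAt m (suc i) ℤ.- expAt m i ∣
    lemma : ∀ c y → (- c) ℤ.* y ≡ c ℤ.* (-[1+ 0 ] ℤ.* y)
    lemma = solve-∀
  ... | false | false = sym (ℤ.*-zeroʳ c)

getE-map : ∀ {B : Set} (f : B → ℤ) (g : ℕ → B) n k → k < n → getE (map f (applyUpTo g n)) k ≡ f (g k)
getE-map f g (suc n) zero p = refl
getE-map f g (suc n) (suc k) (s≤s p) = getE-map f (g ∘ suc) n k p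

expAt-map : ∀ (f : ℕ → ℤ) {n k} → In n k → expAt (map f (range n)) k ≡ f k
expAt-map f {n} {suc k} (_ , p) = getE-map f suc n k p

expAt-zipWith : ∀ (_∙_ : ℤ → ℤ → ℤ) m m′ {n k} → length m ≡ n → length m′ ≡ n → In n k → expAt (zipWith _∙_ m m′) k ≡ expAt m k ∙ expAt m′ k
expAt-zipWith _∙_ m m′ {n} {suc k} refl q (_ , p) = go m m′ k (sym q) p
  where
  go : ∀ m m′ k → length m ≡ length m′ → k < length m → getE (zipWith _∙_ m m′) k ≡ getE m k ∙ getE m′ k
  go (x ∷ m) (y ∷ m′) zero q p = refl
  go (x ∷ m) (y ∷ m′) (suc k) q (s≤s p) = go m m′ k (suc-injective q) p

expAt-setAt : ∀ m i v {n k} → length m ≡ n → In n k → expAt (setAt m i v) k ≡ (if k ≡ᵇ i then v else expAt m k)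
expAt-setAt m i v {n} {suc k} refl (_ , p) = go suc m k p
  where
  go : ∀ (g : ℕ → ℕ) m k → k < length m → getE (zipWith (λ k x → if k ≡ᵇ i then v else x) (applyUpTo g (length m)) m) k ≡ (if g k ≡ᵇ i then v else getE m k)
  go g (x ∷ m) zero p = refl
  go g (x ∷ m) (suc k) (s≤s p) = go (g ∘ suc) m k p

length-zipWith-≡ : ∀ {B C D : Set} (f : B → C → D) xs ys → length xs ≡ length ys → length (zipWith f xs ys) ≡ length ys
length-zipWith-≡ f [] [] q = refl
length-zipWith-≡ f (x ∷ xs) (y ∷ ys) q = cong suc (length-zipWith-≡ f xs ys (suc-injective q))

length-setAt : ∀ m i v → length (setAt m i v) ≡ length m
length-setAt m i v = length-zipWith-≡ _ (range (length m)) m (length-range (length m))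

mono-ext : ∀ {n m m′} → length m ≡ n → length m′ ≡ n → (∀ {k} → In n k → expAt m k ≡ expAt m′ k) → m ≡ m′
mono-ext {n} {m} {m′} refl q h = go m m′ (sym q) (λ k p → h {suc k} (s≤s z≤n , p))
  where
  go : ∀ m m′ → length m ≡ length m′ → (∀ k → k < length m → getE m k ≡ getE m′ k) → m ≡ m′
  go [] [] q h = refl
  go (x ∷ m) (y ∷ m′) q h = cong₂ _∷_ (h 0 (s≤s z≤n)) (go m m′ (suc-injective q) (λ k p → h (suc k) (s≤s p)))

length-map-range : ∀ {B : Set} (f : ℕ → B) n → length (map f (range n)) ≡ n
length-map-range f n = trans (length-map f (range n)) (length-range n)

shift unshift : ℕ → ℕ → Mono → Mono
shift n k m = zipWith ℤ._+_ (varMono n k) m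
unshift n k m = zipWith ℤ._-_ m (varMono n k)

put : ℕ → Mono → ℤ → ℤ → Mono
put i m a b = setAt (setAt m i a) (suc i) b

𝟙[_≡_] : ℕ → ℕ → ℤ
𝟙[ k ≡ l ] = if k ≡ᵇ l then + 1 else + 0

module _ {n : ℕ} where
  length-shift : ∀ k m → length m ≡ n → length (shift n k m) ≡ n
  length-shift k m p = trans (length-zipWith-≡ _ (varMono n k) m (trans (length-map-range _ n) (sym p))) p

  length-unshift : ∀ k m → length m ≡ n → length (unshift n k m) ≡ n
  length-unshift k m p = trans (length-zipWith-≡ _ m (varMono n k) (trans p (sym (length-map-range _ n)))) (length-map-range _ n)

  length-put : ∀ i m a b → length m ≡ n → length (put i m a b) ≡ n
  length-put i m a b p = trans (length-setAt (setAt m i a) (suc i) b) (trans (length-setAt m i a) p)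

  expAt-shift : ∀ k m {l} → length m ≡ n → In n l → expAt (shift n k m) l ≡ 𝟙[ l ≡ k ] ℤ.+ expAt m l
  expAt-shift k m {l} p i = trans (expAt-zipWith ℤ._+_ (varMono n k) m (length-map-range _ n) p i) (cong (ℤ._+ expAt m l) (expAt-map (λ l → 𝟙[ l ≡ k ]) i))

  expAt-unshift : ∀ k m {l} → length m ≡ n → In n l → expAt (unshift n k m) l ≡ expAt m l ℤ.- 𝟙[ l ≡ k ]
  expAt-unshift k m {l} p i = trans (expAt-zipWith ℤ._-_ m (varMono n k) p (length-map-range _ n) i) (cong (λ x → expAt m l ℤ.- x) (expAt-map (λ l → 𝟙[ l ≡ k ]) i))

  expAt-shift-≡ : ∀ k m → length m ≡ n → In n k → expAt (shift n k m) k ≡ + 1 ℤ.+ expAt m k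
  expAt-shift-≡ k m p i = trans (expAt-shift k m p i) (cong (λ b → (if b then + 1 else + 0) ℤ.+ expAt m k) (≡ᵇ-refl k))

  expAt-shift-≢ : ∀ k m {l} → length m ≡ n → In n l → l ≢ k → expAt (shift n k m) l ≡ expAt m l
  expAt-shift-≢ k m {l} p i ne = trans (expAt-shift k m p i) (trans (cong (λ b → (if b then + 1 else + 0) ℤ.+ expAt m l) (≢⇒≡ᵇ ne)) (ℤ.+-identityˡ _))

  expAt-put-l : ∀ i m a b → length m ≡ n → Adj n i → expAt (put i m a b) i ≡ a
  expAt-put-l i m a b p A = trans (expAt-setAt (setAt m i a) (suc i) b (trans (length-setAt m i a) p) (Adj-l A))
    (trans (cong (λ x → if x then b else expAt (setAt m i a) i) (≢⇒≡ᵇ (<⇒≢ (n<1+n i))))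
      (trans (expAt-setAt m i a p (Adj-l A)) (cong (λ x → if x then a else expAt m i) (≡ᵇ-refl i))))

  expAt-put-r : ∀ i m a b → length m ≡ n → Adj n i → expAt (put i m a b) (suc i) ≡ b
  expAt-put-r i m a b p A = trans (expAt-setAt (setAt m i a) (suc i) b (trans (length-setAt m i a) p) (Adj-r A))
    (cong (λ x → if x then b else expAt (setAt m i a) (suc i)) (≡ᵇ-refl i))

  expAt-put-o : ∀ i m a b {l} → length m ≡ n → In n l → l ≢ i → l ≢ suc i → expAt (put i m a b) l ≡ expAt m l
  expAt-put-o i m a b {l} p q ne ne′ = trans (expAt-setAt (setAt m i a) (suc i) b (trans (length-setAt m i a) p) q)
    (trans (cong (λ x → if x then b else expAt (setAt m i a) l) (≢⇒≡ᵇ ne′)) (trans (expAt-setAt m i a p q) (cong (λ x → if x then a else expAt m l) (≢⇒≡ᵇ ne))))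

  put-≡ : ∀ i m a b m′ → Adj n i → length m ≡ n → length m′ ≡ n → expAt m′ i ≡ a → expAt m′ (suc i) ≡ b →
    (∀ {l} → In n l → l ≢ i → l ≢ suc i → expAt m′ l ≡ expAt m l) → put i m a b ≡ m′
  put-≡ i m a b m′ A p p′ l r o = mono-ext (length-put i m a b p) p′ λ {k} q → go k q
    where
    go : ∀ k → In n k → expAt (put i m a b) k ≡ expAt m′ k
    go k q with k ≟ i | k ≟ suc i
    ... | yes refl | _ = trans (expAt-put-l i m a b p A) (sym l)
    ... | no _ | yes refl = trans (expAt-put-r i m a b p A) (sym r)
    ... | no ne | no ne′ = trans (expAt-put-o i m a b p q ne ne′) (sym (o q ne ne′))

⌊⌋-true : ∀ {B : Set} (d : Dec B) → B → ⌊ d ⌋ ≡ true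
⌊⌋-true (yes _) b = refl
⌊⌋-true (no ¬b) b = contradiction b ¬b

⌊⌋-false : ∀ {B : Set} (d : Dec B) → ¬ B → ⌊ d ⌋ ≡ false
⌊⌋-false (yes b) ¬b = contradiction b ¬b
⌊⌋-false (no _) ¬b = refl

NiTerm-≡ : ∀ i c m → expAt m i ≡ expAt m (suc i) → NiTerm i (c , m) ≡ []
NiTerm-≡ i c m e rewrite ⌊⌋-false (expAt m (suc i) ℤ.<? expAt m i) (ℤ.<-irrefl (sym e)) | ⌊⌋-false (expAt m i ℤ.<? expAt m (suc i)) (ℤ.<-irrefl e) = refl

n<n+suc : ∀ a d → a ℤ.< a ℤ.+ + suc d
n<n+suc a d = subst (ℤ._< a ℤ.+ + suc d) (ℤ.+-identityʳ a) (ℤ.+-monoʳ-< a (ℤ.+<+ (s≤s z≤n)))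

∣-∣-+ : ∀ a d → ℤ.∣ a ℤ.+ + d ℤ.- a ∣ ≡ d
∣-∣-+ a d = cong ℤ.∣_∣ (lemma a (+ d))
  where
  lemma : ∀ a b → a ℤ.+ b ℤ.- a ≡ b
  lemma = solve-∀

fallTerm riseTerm : ℕ → ℤ → Mono → ℕ → Term
fallTerm i c m k = c , put i m (expAt m i ℤ.- + 1 ℤ.- + k) (expAt m (suc i) ℤ.+ + k)
riseTerm i c m k = - c , put i m (expAt m (suc i) ℤ.- + 1 ℤ.- + k) (expAt m i ℤ.+ + k)

-- A natural number d for the gap between the two exponents replaces the comparison and the absolute
-- value in `NiTerm`; identities for ∂_i then become identities of lists `applyUpTo`. Gap 0 is the
-- empty sum.
NiTerm-≥ : ∀ i c m d → expAt m i ≡ expAt m (suc i) ℤ.+ + d → NiTerm i (c , m) ≡ applyUpTo (fallTerm i c m) d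
NiTerm-≥ i c m zero e = NiTerm-≡ i c m (trans e (ℤ.+-identityʳ _))
NiTerm-≥ i c m (suc d) e rewrite ⌊⌋-true (expAt m (suc i) ℤ.<? expAt m i) (subst (expAt m (suc i) ℤ.<_) (sym e) (n<n+suc (expAt m (suc i)) d)) =
  trans (cong (λ x → map (fallTerm i c m) (applyUpTo (λ k → k) x)) (trans (cong (λ x → ℤ.∣ x ℤ.- expAt m (suc i) ∣) e) (∣-∣-+ (expAt m (suc i)) (suc d))))
    (map-applyUpTo (λ k → k) (fallTerm i c m) (suc d))

NiTerm-≤ : ∀ i c m d → expAt m (suc i) ≡ expAt m i ℤ.+ + d → NiTerm i (c , m) ≡ applyUpTo (riseTerm i c m) d
NiTerm-≤ i c m zero e = NiTerm-≡ i c m (sym (trans e (ℤ.+-identityʳ _)))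
NiTerm-≤ i c m (suc d) e rewrite ⌊⌋-false (expAt m (suc i) ℤ.<? expAt m i) (λ lt → ℤ.<-asym lt (subst (expAt m i ℤ.<_) (sym e) (n<n+suc (expAt m i) d)))
  | ⌊⌋-true (expAt m i ℤ.<? expAt m (suc i)) (subst (expAt m i ℤ.<_) (sym e) (n<n+suc (expAt m i) d)) =
  trans (cong (λ x → map (riseTerm i c m) (applyUpTo (λ k → k) x)) (trans (cong (λ x → ℤ.∣ x ℤ.- expAt m i ∣) e) (∣-∣-+ (expAt m i) (suc d))))
    (map-applyUpTo (λ k → k) (riseTerm i c m) (suc d))

difference : ∀ a b → (∃ λ d → a ≡ b ℤ.+ + d) ⊎ (∃ λ d → b ≡ a ℤ.+ + suc d)
difference a b with a ℤ.- b in eq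
... | + d = inj₁ (d , trans (lemma a b) (cong (λ x → b ℤ.+ x) eq))
  where
  lemma : ∀ a b → a ≡ b ℤ.+ (a ℤ.- b)
  lemma = solve-∀
... | -[1+ d ] = inj₂ (d , trans (lemma a b) (cong (λ x → a ℤ.- x) eq))
  where
  lemma : ∀ a b → b ≡ a ℤ.- (a ℤ.- b)
  lemma = solve-∀

NiTerm-length : ∀ {n} i c m → length m ≡ n → All (λ (t : Term) → length (proj₂ t) ≡ n) (NiTerm i (c , m))
NiTerm-length i c m p with difference (expAt m i) (expAt m (suc i))
... | inj₁ (d , e) rewrite NiTerm-≥ i c m d e = All.applyUpTo⁺₁ (fallTerm i c m) d (λ {k} _ → length-put i m (expAt m i ℤ.- + 1 ℤ.- + k) (expAt m (suc i) ℤ.+ + k) p)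
... | inj₂ (d , e) rewrite NiTerm-≤ i c m (suc d) e = All.applyUpTo⁺₁ (riseTerm i c m) (suc d) (λ {k} _ → length-put i m (expAt m (suc i) ℤ.- + 1 ℤ.- + k) (expAt m i ℤ.+ + k) p)

-- The algebra of Laurent polynomials on lists of terms

concatMap-[] : ∀ {B C : Set} (f : B → C) xs → concatMap (λ x → [ f x ]) xs ≡ map f xs
concatMap-[] f [] = refl
concatMap-[] f (x ∷ xs) = cong (f x ∷_) (concatMap-[] f xs)

applyUpTo-cong : ∀ {B : Set} {f g : ℕ → B} n → (∀ k → f k ≡ g k) → applyUpTo f n ≡ applyUpTo g n
applyUpTo-cong zero h = refl
applyUpTo-cong (suc n) h = cong₂ _∷_ (h 0) (applyUpTo-cong n (λ k → h (suc k)))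

module Laurent (n : ℕ) where
  -- `zipWith` truncates, so multiplication by a variable is invertible only on exponent vectors of
  -- length n; this condition is bundled with the list of terms.
  record LaurentPolynomial : Set where
    constructor laurent
    field
      poly : Poly
      homogeneous-length : All (λ (t : Term) → length (proj₂ t) ≡ n) poly
  open LaurentPolynomial public

  formalModule : FormalModule
  formalModule = record
    { M = LaurentPolynomial
    ; I = Mono
    ; coef = λ f → coeff (poly f)
    ; 𝟘 = laurent [] []
    ; _⊕_ = λ (laurent p u) (laurent q v) → laurent (p ++ q) (All.++⁺ u v)
    ; _·_ = λ c (laurent p u) → laurent (scaleP c p) (All.map⁺ (All.map (λ h → h) u))
    ; coef-𝟘 = λ e → refl
    ; coef-⊕ = λ f g → coeff-++ (poly f) (poly g)
    ; coef-· = λ c f → coeff-scaleP c (poly f)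
    }

  open FormalModule formalModule
  open ModuleTheory formalModule

  Stable : (Term → Poly) → Set
  Stable κ = ∀ c m → length m ≡ n → All (λ (t : Term) → length (proj₂ t) ≡ n) (κ (c , m))

  operator : (κ : Term → Poly) → Stable κ → LaurentPolynomial → LaurentPolynomial
  operator κ s (laurent p u) = laurent (concatMap κ p) (All.concat⁺ (All.map⁺ (All.map (λ {t} h → s (proj₁ t) (proj₂ t) h) u)))

  operator-linear : ∀ {κ} (L : LinearKernel κ) (s : Stable κ) → Linear (operator κ s)
  operator-linear {κ} L s = linear
    (λ {f} {g} h → mk (LinearKernel.concatMap-cong L (poly f) (poly g) (at h)))
    (λ f g → mk λ e → cong (λ p → coeff p e) (concatMap-++ κ (poly f) (poly g)))
    (λ c f → mk (LinearKernel.concatMap-scaleP L c (poly f)))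

  mono : ∀ m → length m ≡ n → LaurentPolynomial
  mono m p = laurent [ (+ 1 , m) ] (p ∷ [])

  mono-cong : ∀ {m m′ p p′} → m ≡ m′ → mono m p ≈ mono m′ p′
  mono-cong refl = mk λ e → refl

  split-term : ∀ c m p q u → laurent ((c , m) ∷ q) (p ∷ u) ≈ c · mono m p ⊕ laurent q u
  split-term c m p q u = mk λ e → cong (λ d → coeff ((d , m) ∷ q) e) (sym (ℤ.*-identityʳ c))

  agree-mono : ∀ {F G} → Linear F → Linear G → (∀ m p → F (mono m p) ≈ G (mono m p)) → ∀ f → F f ≈ G f
  agree-mono {F} {G} L K h (laurent [] []) = ≈-trans (linear-𝟘 L) (≈-sym (linear-𝟘 K))
  agree-mono {F} {G} L K h (laurent ((c , m) ∷ q) (p ∷ u)) =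
    ≈-trans (both L) (≈-trans (⊕-cong (·-cong c (h m p)) (agree-mono L K h (laurent q u))) (≈-sym (both K)))
    where
    both : ∀ {H} → Linear H → H (laurent ((c , m) ∷ q) (p ∷ u)) ≈ c · H (mono m p) ⊕ H (laurent q u)
    both J = ≈-trans (resp J (split-term c m p q u)) (≈-trans (add J _ _) (⊕-cong (scale J c _) ≈-refl))

  shift-stable : ∀ k → Stable (λ (c , m) → [ (c , shift n k m) ])
  shift-stable k c m p = length-shift k m p ∷ []

  unshift-stable : ∀ k → Stable (λ (c , m) → [ (c , unshift n k m) ])
  unshift-stable k c m p = length-unshift k m p ∷ []

  NiTerm-stable : ∀ i → Stable (NiTerm i)
  NiTerm-stable i = NiTerm-length i

  X Y ∂ : ℕ → LaurentPolynomial → LaurentPolynomial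
  X k = operator (λ (c , m) → [ (c , shift n k m) ]) (shift-stable k)
  Y k = operator (λ (c , m) → [ (c , unshift n k m) ]) (unshift-stable k)
  ∂ k = operator (NiTerm k) (NiTerm-stable k)

  X-linear : ∀ k → Linear (X k)
  X-linear k = operator-linear (single-kernel (shift n k)) (shift-stable k)

  Y-linear : ∀ k → Linear (Y k)
  Y-linear k = operator-linear (single-kernel (unshift n k)) (unshift-stable k)

  ∂-linear : ∀ k → Linear (∂ k)
  ∂-linear k = operator-linear (NiTerm-kernel k) (NiTerm-stable k)

  shift-unshift : ∀ k m → length m ≡ n → shift n k (unshift n k m) ≡ m
  shift-unshift k m p = mono-ext (length-shift k _ (length-unshift k m p)) p λ {l} i →
    trans (expAt-shift k (unshift n k m) (length-unshift k m p) i) (trans (cong (λ x → 𝟙[ l ≡ k ] ℤ.+ x) (expAt-unshift k m p i)) (lemma 𝟙[ l ≡ k ] (expAt m l)))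
    where
    lemma : ∀ a b → a ℤ.+ (b ℤ.- a) ≡ b
    lemma = solve-∀

  unshift-shift : ∀ k m → length m ≡ n → unshift n k (shift n k m) ≡ m
  unshift-shift k m p = mono-ext (length-unshift k (shift n k m) (length-shift k m p)) p λ {l} i →
    trans (expAt-unshift k (shift n k m) (length-shift k m p) i) (trans (cong (ℤ._- 𝟙[ l ≡ k ]) (expAt-shift k m p i)) (lemma 𝟙[ l ≡ k ] (expAt m l)))
    where
    lemma : ∀ a b → a ℤ.+ b ℤ.- a ≡ b
    lemma = solve-∀

  shift-comm : ∀ k l m → length m ≡ n → shift n k (shift n l m) ≡ shift n l (shift n k m)
  shift-comm k l m p = mono-ext (length-shift k _ (length-shift l m p)) (length-shift l _ (length-shift k m p)) λ {j} i →
    trans (expAt-shift k (shift n l m) (length-shift l m p) i) (trans (cong (λ x → 𝟙[ j ≡ k ] ℤ.+ x) (expAt-shift l m p i))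
      (trans (lemma 𝟙[ j ≡ k ] 𝟙[ j ≡ l ] (expAt m j))
        (sym (trans (expAt-shift l (shift n k m) (length-shift k m p) i) (cong (λ x → 𝟙[ j ≡ l ] ℤ.+ x) (expAt-shift k m p i))))))
    where
    lemma : ∀ a b c → a ℤ.+ (b ℤ.+ c) ≡ b ℤ.+ (a ℤ.+ c)
    lemma = solve-∀

  XY : ∀ k f → X k (Y k f) ≈ f
  XY k = agree-mono (∘-linear (X-linear k) (Y-linear k)) id-linear λ m p → mono-cong {p = length-shift k _ (length-unshift k m p)} (shift-unshift k m p)

  YX : ∀ k f → Y k (X k f) ≈ f
  YX k = agree-mono (∘-linear (Y-linear k) (X-linear k)) id-linear λ m p → mono-cong {p = length-unshift k (shift n k m) (length-shift k m p)} (unshift-shift k m p)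

  X-comm : ∀ k l f → X k (X l f) ≈ X l (X k f)
  X-comm k l = agree-mono (∘-linear (X-linear k) (X-linear l)) (∘-linear (X-linear l) (X-linear k)) λ m p →
    mono-cong {p = length-shift k _ (length-shift l m p)} {length-shift l _ (length-shift k m p)} (shift-comm k l m p)

  ∂-mono-≡ : ∀ {k} m p → expAt m k ≡ expAt m (suc k) → ∂ k (mono m p) ≈ 𝟘
  ∂-mono-≡ {k} m p e = mk λ x → cong (λ q → coeff (q ++ []) x) (NiTerm-≡ k (+ 1) m e)

  module _ {i : ℕ} (A : Adj n i) where
    -- μ commutes with the divided difference if it preserves the difference of the two exponents.
    ∂-commutes : (μ : Mono → Mono) → (∀ m → length m ≡ n → length (μ m) ≡ n) →
      (∀ m d → length m ≡ n → expAt m i ≡ expAt m (suc i) ℤ.+ + d → expAt (μ m) i ≡ expAt (μ m) (suc i) ℤ.+ + d) →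
      (∀ m d → length m ≡ n → expAt m (suc i) ≡ expAt m i ℤ.+ + d → expAt (μ m) (suc i) ≡ expAt (μ m) i ℤ.+ + d) →
      (∀ m k → length m ≡ n → fallTerm i (+ 1) (μ m) k ≡ (+ 1 , μ (proj₂ (fallTerm i (+ 1) m k)))) →
      (∀ m k → length m ≡ n → riseTerm i (+ 1) (μ m) k ≡ (-[1+ 0 ] , μ (proj₂ (riseTerm i (+ 1) m k)))) →
      ∀ m → length m ≡ n → NiTerm i (+ 1 , μ m) ≡ map (λ (c , m) → c , μ m) (NiTerm i (+ 1 , m))
    ∂-commutes μ ℓ fall rise fall-k rise-k m p with difference (expAt m i) (expAt m (suc i))
    ... | inj₁ (d , e) = trans (NiTerm-≥ i (+ 1) (μ m) d (fall m d p e)) (trans (applyUpTo-cong d (λ k → fall-k m k p))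
          (trans (sym (map-applyUpTo (fallTerm i (+ 1) m) (λ (c , m) → c , μ m) d)) (cong (map _) (sym (NiTerm-≥ i (+ 1) m d e)))))
    ... | inj₂ (d , e) = trans (NiTerm-≤ i (+ 1) (μ m) (suc d) (rise m (suc d) p e)) (trans (applyUpTo-cong (suc d) (λ k → rise-k m k p))
          (trans (sym (map-applyUpTo (riseTerm i (+ 1) m) (λ (c , m) → c , μ m) (suc d))) (cong (map _) (sym (NiTerm-≤ i (+ 1) m (suc d) e)))))

    ∂-Xᵒ : ∀ {l} → l ≢ i → l ≢ suc i → ∀ f → ∂ i (X l f) ≈ X l (∂ i f)
    ∂-Xᵒ {l} l≢i l≢si = agree-mono (∘-linear (∂-linear i) (X-linear l)) (∘-linear (X-linear l) (∂-linear i)) λ m p → mk λ e →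
        cong (λ q → coeff q e) (trans (++-identityʳ _) (trans (∂-commutes (shift n l) (λ m → length-shift l m)
          (λ m d p e → trans (left′ m p) (trans e (cong (ℤ._+ + d) (sym (right′ m p)))))
          (λ m d p e → trans (right′ m p) (trans e (cong (ℤ._+ + d) (sym (left′ m p)))))
          (λ m k p → cong (+ 1 ,_) (moved m (expAt m i ℤ.- + 1 ℤ.- + k) (expAt m (suc i) ℤ.+ + k) p
            (cong (λ x → x ℤ.- + 1 ℤ.- + k) (left′ m p)) (cong (ℤ._+ + k) (right′ m p))))
          (λ m k p → cong (-[1+ 0 ] ,_) (moved m (expAt m (suc i) ℤ.- + 1 ℤ.- + k) (expAt m i ℤ.+ + k) p
            (cong (λ x → x ℤ.- + 1 ℤ.- + k) (right′ m p)) (cong (ℤ._+ + k) (left′ m p))))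
          m p) (trans (sym (concatMap-[] _ (NiTerm i (+ 1 , m)))) (cong (concatMap _) (sym (++-identityʳ (NiTerm i (+ 1 , m))))))))
      where
      left′ : ∀ m → length m ≡ n → expAt (shift n l m) i ≡ expAt m i
      left′ m p = expAt-shift-≢ l m p (Adj-l A) (l≢i ∘ sym)
      right′ : ∀ m → length m ≡ n → expAt (shift n l m) (suc i) ≡ expAt m (suc i)
      right′ m p = expAt-shift-≢ l m p (Adj-r A) (l≢si ∘ sym)
      moved : ∀ m a b {a′ b′} → length m ≡ n → a′ ≡ a → b′ ≡ b → put i (shift n l m) a′ b′ ≡ shift n l (put i m a b)
      moved m a b p refl refl = put-≡ i (shift n l m) a b (shift n l (put i m a b)) A (length-shift l m p) (length-shift l _ (length-put i m a b p))
        (trans (left′ _ (length-put i m a b p)) (expAt-put-l i m a b p A)) (trans (right′ _ (length-put i m a b p)) (expAt-put-r i m a b p A))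
        (λ {j} q r s → trans (expAt-shift l _ (length-put i m a b p) q) (trans (cong (λ x → 𝟙[ j ≡ l ] ℤ.+ x) (expAt-put-o i m a b p q r s)) (sym (expAt-shift l m p q))))

    -- Multiplication by x_i x_{i+1} raises both exponents by one and keeps their difference. With
    -- `∂-Xˡ` this yields `∂-Xʳ` without a second computation on monomials.
    ∂-XX : ∀ f → ∂ i (X i (X (suc i) f)) ≈ X i (X (suc i) (∂ i f))
    ∂-XX = agree-mono (∘-linear (∂-linear i) (∘-linear (X-linear i) (X-linear (suc i)))) (∘-linear (X-linear i) (∘-linear (X-linear (suc i)) (∂-linear i))) λ m p → mk λ e →
        cong (λ q → coeff q e) (trans (++-identityʳ _) (trans (∂-commutes μ ℓ
          (λ m d p e → trans (left′ m p) (trans (cong (λ x → + 1 ℤ.+ x) e) (trans (lemma (expAt m (suc i)) (+ d)) (cong (ℤ._+ + d) (sym (right′ m p))))))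
          (λ m d p e → trans (right′ m p) (trans (cong (λ x → + 1 ℤ.+ x) e) (trans (lemma (expAt m i) (+ d)) (cong (ℤ._+ + d) (sym (left′ m p))))))
          (λ m k p → cong (+ 1 ,_) (moved m (expAt m i ℤ.- + 1 ℤ.- + k) (expAt m (suc i) ℤ.+ + k) p
            (trans (cong (λ x → x ℤ.- + 1 ℤ.- + k) (left′ m p)) (lemma₁ (expAt m i) (+ k)))
            (trans (cong (ℤ._+ + k) (right′ m p)) (sym (lemma (expAt m (suc i)) (+ k))))))
          (λ m k p → cong (-[1+ 0 ] ,_) (moved m (expAt m (suc i) ℤ.- + 1 ℤ.- + k) (expAt m i ℤ.+ + k) p
            (trans (cong (λ x → x ℤ.- + 1 ℤ.- + k) (right′ m p)) (lemma₁ (expAt m (suc i)) (+ k)))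
            (trans (cong (ℤ._+ + k) (left′ m p)) (sym (lemma (expAt m i) (+ k))))))
          m p) (sym (trans (concatMap-[] _ (concatMap _ (NiTerm i (+ 1 , m) ++ [])))
            (trans (cong (map _) (trans (concatMap-[] _ (NiTerm i (+ 1 , m) ++ [])) (cong (map _) (++-identityʳ (NiTerm i (+ 1 , m))))))
              (sym (map-∘ (NiTerm i (+ 1 , m)))))))))
      where
      μ : Mono → Mono
      μ m = shift n i (shift n (suc i) m)
      ℓ : ∀ m → length m ≡ n → length (μ m) ≡ n
      ℓ m p = length-shift i _ (length-shift (suc i) m p)
      i≢si : i ≢ suc i
      i≢si = <⇒≢ (n<1+n i)
      lemma : ∀ a d → + 1 ℤ.+ (a ℤ.+ d) ≡ + 1 ℤ.+ a ℤ.+ d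
      lemma = solve-∀
      lemma₁ : ∀ a k → + 1 ℤ.+ a ℤ.- + 1 ℤ.- k ≡ + 1 ℤ.+ (a ℤ.- + 1 ℤ.- k)
      lemma₁ = solve-∀
      left′ : ∀ m → length m ≡ n → expAt (μ m) i ≡ + 1 ℤ.+ expAt m i
      left′ m p = trans (expAt-shift-≡ i (shift n (suc i) m) (length-shift (suc i) m p) (Adj-l A)) (cong (λ x → + 1 ℤ.+ x) (expAt-shift-≢ (suc i) m p (Adj-l A) i≢si))
      right′ : ∀ m → length m ≡ n → expAt (μ m) (suc i) ≡ + 1 ℤ.+ expAt m (suc i)
      right′ m p = trans (expAt-shift-≢ i (shift n (suc i) m) (length-shift (suc i) m p) (Adj-r A) (i≢si ∘ sym)) (expAt-shift-≡ (suc i) m p (Adj-r A))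
      other′ : ∀ m {j} → length m ≡ n → In n j → j ≢ i → j ≢ suc i → expAt (μ m) j ≡ expAt m j
      other′ m p q r s = trans (expAt-shift-≢ i (shift n (suc i) m) (length-shift (suc i) m p) q r) (expAt-shift-≢ (suc i) m p q s)
      moved : ∀ m a b {a′ b′} → length m ≡ n → a′ ≡ + 1 ℤ.+ a → b′ ≡ + 1 ℤ.+ b → put i (μ m) a′ b′ ≡ μ (put i m a b)
      moved m a b p refl refl = put-≡ i (μ m) _ _ (μ (put i m a b)) A (ℓ m p) (ℓ _ (length-put i m a b p))
        (trans (left′ _ (length-put i m a b p)) (cong (λ x → + 1 ℤ.+ x) (expAt-put-l i m a b p A)))
        (trans (right′ _ (length-put i m a b p)) (cong (λ x → + 1 ℤ.+ x) (expAt-put-r i m a b p A)))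
        (λ {j} q r s → trans (other′ _ (length-put i m a b p) q r s) (trans (expAt-put-o i m a b p q r s) (sym (other′ m p q r s))))

    ∂-Xˡ : ∀ f → ∂ i (X i f) ≈ f ⊕ X (suc i) (∂ i f)
    ∂-Xˡ = agree-mono (∘-linear (∂-linear i) (X-linear i)) (⊕-linear id-linear (∘-linear (X-linear (suc i)) (∂-linear i))) λ m p → mk λ e →
        trans (cong (λ q → coeff q e) (++-identityʳ (NiTerm i (+ 1 , shift n i m)))) (trans (term m p e)
          (cong (λ q → coeff ((+ 1 , m) ∷ q) e) (sym (trans (concatMap-[] _ (NiTerm i (+ 1 , m) ++ [])) (cong (map _) (++-identityʳ (NiTerm i (+ 1 , m))))))))
      where
      i≢si : i ≢ suc i
      i≢si = <⇒≢ (n<1+n i)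
      up : Term → Term
      up (c , m) = c , shift n (suc i) m
      left′ : ∀ m → length m ≡ n → expAt (shift n i m) i ≡ + 1 ℤ.+ expAt m i
      left′ m p = expAt-shift-≡ i m p (Adj-l A)
      right′ : ∀ m → length m ≡ n → expAt (shift n i m) (suc i) ≡ expAt m (suc i)
      right′ m p = expAt-shift-≢ i m p (Adj-r A) (i≢si ∘ sym)
      moved : ∀ m a b {a′ b′} → length m ≡ n → a′ ≡ a → b′ ≡ + 1 ℤ.+ b → put i (shift n i m) a′ b′ ≡ shift n (suc i) (put i m a b)
      moved m a b p refl refl = put-≡ i (shift n i m) _ _ (shift n (suc i) (put i m a b)) A (length-shift i m p) (length-shift (suc i) _ (length-put i m a b p))
        (trans (expAt-shift-≢ (suc i) _ (length-put i m a b p) (Adj-l A) i≢si) (expAt-put-l i m a b p A))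
        (trans (expAt-shift-≡ (suc i) _ (length-put i m a b p) (Adj-r A)) (cong (λ x → + 1 ℤ.+ x) (expAt-put-r i m a b p A)))
        (λ {j} q r s → trans (expAt-shift-≢ (suc i) _ (length-put i m a b p) q s) (trans (expAt-put-o i m a b p q r s) (sym (expAt-shift-≢ i m p q r))))
      lemma₁ : ∀ b d → + 1 ℤ.+ (b ℤ.+ d) ≡ b ℤ.+ (+ 1 ℤ.+ d)
      lemma₁ = solve-∀
      lemma₂ : ∀ a d → a ℤ.+ (+ 1 ℤ.+ d) ≡ + 1 ℤ.+ a ℤ.+ d
      lemma₂ = solve-∀
      lemma₃ : ∀ a → + 1 ℤ.+ a ℤ.- + 1 ℤ.- + 0 ≡ a
      lemma₃ = solve-∀
      lemma₄ : ∀ a k → + 1 ℤ.+ a ℤ.- + 1 ℤ.- (+ 1 ℤ.+ k) ≡ a ℤ.- + 1 ℤ.- k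
      lemma₄ = solve-∀
      lemma₅ : ∀ b k → b ℤ.+ (+ 1 ℤ.+ k) ≡ + 1 ℤ.+ (b ℤ.+ k)
      lemma₅ = solve-∀
      lemma₆ : ∀ a k → + 1 ℤ.+ a ℤ.+ k ≡ + 1 ℤ.+ (a ℤ.+ k)
      lemma₆ = solve-∀
      lemma₇ : ∀ a d → a ≡ a ℤ.+ (+ 1 ℤ.+ d) ℤ.- + 1 ℤ.- d
      lemma₇ = solve-∀
      cancel : ∀ q m e → coeff q e ≡ coeff ((+ 1 , m) ∷ q ++ [ (-[1+ 0 ] , m) ]) e
      cancel q m e = sym (trans (coeff-++ [ (+ 1 , m) ] (q ++ [ (-[1+ 0 ] , m) ]) e) (trans (cong (λ x → coeff [ (+ 1 , m) ] e ℤ.+ x) (coeff-++ q _ e))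
        (trans (cong (λ x → coeff [ (+ 1 , m) ] e ℤ.+ (coeff q e ℤ.+ x)) (coeff-map-const -[1+ 0 ] (λ _ → m) (tt ∷ []) e)) (lemma (coeff [ (+ 1 , m) ] e) (coeff q e)))))
        where
        lemma : ∀ a b → a ℤ.+ (b ℤ.+ -[1+ 0 ] ℤ.* a) ≡ b
        lemma = solve-∀
      -- Multiplication by x_i changes the gap by one. A falling sum gains a new first term, m
      -- itself, and its other terms are shifted by x_{i+1}. A rising sum loses its last term, whose
      -- shift by x_{i+1} is -m and cancels the additional m.
      term : ∀ m → length m ≡ n → ∀ e → coeff (NiTerm i (+ 1 , shift n i m)) e ≡ coeff ((+ 1 , m) ∷ map up (NiTerm i (+ 1 , m))) e
      term m p e with difference (expAt m i) (expAt m (suc i))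
      ... | inj₁ (d , h) = cong (λ q → coeff q e) (trans
            (NiTerm-≥ i (+ 1) (shift n i m) (suc d) (trans (left′ m p) (trans (cong (λ x → + 1 ℤ.+ x) h)
              (trans (lemma₁ (expAt m (suc i)) (+ d)) (cong (ℤ._+ + suc d) (sym (right′ m p)))))))
            (cong₂ _∷_ (cong (+ 1 ,_) first) (trans (applyUpTo-cong d (λ k → cong (+ 1 ,_) (moved m (expAt m i ℤ.- + 1 ℤ.- + k) (expAt m (suc i) ℤ.+ + k) p
                (trans (cong (λ x → x ℤ.- + 1 ℤ.- + suc k) (left′ m p)) (lemma₄ (expAt m i) (+ k)))
                (trans (cong (ℤ._+ + suc k) (right′ m p)) (lemma₅ (expAt m (suc i)) (+ k))))))
              (trans (sym (map-applyUpTo (fallTerm i (+ 1) m) up d)) (cong (map up) (sym (NiTerm-≥ i (+ 1) m d h)))))))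
        where
        first : put i (shift n i m) (expAt (shift n i m) i ℤ.- + 1 ℤ.- + 0) (expAt (shift n i m) (suc i) ℤ.+ + 0) ≡ m
        first = put-≡ i (shift n i m) _ _ m A (length-shift i m p) p (sym (trans (cong (λ x → x ℤ.- + 1 ℤ.- + 0) (left′ m p)) (lemma₃ (expAt m i))))
          (sym (trans (ℤ.+-identityʳ _) (right′ m p))) (λ q r s → sym (expAt-shift-≢ i m p q r))
      ... | inj₂ (d , h) = trans (cong (λ q → coeff q e) (NiTerm-≤ i (+ 1) (shift n i m) d (trans (right′ m p) (trans h
              (trans (lemma₂ (expAt m i) (+ d)) (cong (ℤ._+ + d) (sym (left′ m p))))))))
            (trans (cancel (applyUpTo (riseTerm i (+ 1) (shift n i m)) d) m e) (cong (λ q → coeff ((+ 1 , m) ∷ q) e)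
              (trans (cong₂ (λ q t → q ++ [ t ]) (applyUpTo-cong d lifted) (cong (-[1+ 0 ] ,_) (sym last)))
                (trans (applyUpTo-∷ʳ (λ k → up (riseTerm i (+ 1) m k)) d) (trans (sym (map-applyUpTo (riseTerm i (+ 1) m) up (suc d))) (cong (map up) (sym (NiTerm-≤ i (+ 1) m (suc d) h))))))))
        where
        lifted : ∀ k → riseTerm i (+ 1) (shift n i m) k ≡ up (riseTerm i (+ 1) m k)
        lifted k = cong (-[1+ 0 ] ,_) (moved m (expAt m (suc i) ℤ.- + 1 ℤ.- + k) (expAt m i ℤ.+ + k) p
          (cong (λ x → x ℤ.- + 1 ℤ.- + k) (right′ m p)) (trans (cong (ℤ._+ + k) (left′ m p)) (lemma₆ (expAt m i) (+ k))))
        a′ b′ : ℤ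
        a′ = expAt m (suc i) ℤ.- + 1 ℤ.- + d
        b′ = expAt m i ℤ.+ + d
        last : shift n (suc i) (put i m a′ b′) ≡ m
        last = mono-ext (length-shift (suc i) _ (length-put i m a′ b′ p)) p λ {j} q → go j q
          where
          go : ∀ j → In n j → expAt (shift n (suc i) (put i m a′ b′)) j ≡ expAt m j
          go j q with j ≟ i | j ≟ suc i
          ... | yes refl | _ = trans (expAt-shift-≢ (suc i) _ (length-put i m a′ b′ p) (Adj-l A) i≢si) (trans (expAt-put-l i m a′ b′ p A)
                (trans (cong (λ x → x ℤ.- + 1 ℤ.- + d) h) (sym (lemma₇ (expAt m i) (+ d)))))
          ... | no _ | yes refl = trans (expAt-shift-≡ (suc i) _ (length-put i m a′ b′ p) (Adj-r A)) (trans (cong (λ x → + 1 ℤ.+ x) (expAt-put-r i m a′ b′ p A))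
                (sym (trans h (lemma₅ (expAt m i) (+ d)))))
          ... | no ne | no ne′ = trans (expAt-shift-≢ (suc i) _ (length-put i m a′ b′ p) q ne′) (expAt-put-o i m a′ b′ p q ne ne′)

    -- Apply ∂ (x_i x_{i+1} g) = x_i x_{i+1} ∂ g and the rule for x_i to f = x_i g.
    ∂-Xʳ : ∀ f → ∂ i (X (suc i) f) ≈ X i (∂ i f) ⊕ -[1+ 0 ] · f
    ∂-Xʳ f = begin
      ∂ i (X (suc i) f) ≈⟨ resp (∂-linear i) (resp (X-linear (suc i)) (≈-sym (XY i f))) ⟩
      ∂ i (X (suc i) (X i g)) ≈⟨ resp (∂-linear i) (X-comm (suc i) i g) ⟩
      ∂ i (X i (X (suc i) g)) ≈⟨ ∂-XX g ⟩
      X i (X (suc i) (∂ i g)) ≈⟨ coefficientwise ⟨ h ⟩ (⟨ f ⟩ :+ ⟨ h ⟩ :+ -[1+ 0 ] :* ⟨ f ⟩) (λ e → lemma (coef h e) (coef f e)) ⟩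
      f ⊕ X i (X (suc i) (∂ i g)) ⊕ -[1+ 0 ] · f ≈⟨ ⊕-cong (⊕-cong (≈-sym (XY i f)) ≈-refl) ≈-refl ⟩
      X i g ⊕ X i (X (suc i) (∂ i g)) ⊕ -[1+ 0 ] · f ≈⟨ ⊕-cong (≈-sym (add (X-linear i) g _)) ≈-refl ⟩
      X i (g ⊕ X (suc i) (∂ i g)) ⊕ -[1+ 0 ] · f ≈⟨ ⊕-cong (resp (X-linear i) (≈-sym (∂-Xˡ g))) ≈-refl ⟩
      X i (∂ i (X i g)) ⊕ -[1+ 0 ] · f ≈⟨ ⊕-cong (resp (X-linear i) (resp (∂-linear i) (XY i f))) ≈-refl ⟩
      X i (∂ i f) ⊕ -[1+ 0 ] · f ∎
      where
      open import Relation.Binary.Reasoning.Setoid ≈-setoid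
      g = Y i f
      h = X i (X (suc i) (∂ i g))
      lemma : ∀ a b → a ≡ b ℤ.+ a ℤ.+ -[1+ 0 ] ℤ.* b
      lemma = solve-∀

  length-zeroMono : length (zeroMono n) ≡ n
  length-zeroMono = length-applyUpTo _ n

  𝟙 : LaurentPolynomial
  𝟙 = mono (zeroMono n) length-zeroMono

  expAt-zeroMono : ∀ {k} → In n k → expAt (zeroMono n) k ≡ + 0
  expAt-zeroMono {suc k} (_ , p) = go (λ _ → + 0) n k p
    where
    go : ∀ (f : ℕ → ℤ) n k → k < n → getE (applyUpTo f n) k ≡ f k
    go f (suc n) zero p = refl
    go f (suc n) (suc k) (s≤s p) = go (f ∘ suc) n k p

  ∂-𝟙 : ∀ {k} → Adj n k → ∂ k 𝟙 ≈ 𝟘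
  ∂-𝟙 A = ∂-mono-≡ (zeroMono n) length-zeroMono (trans (expAt-zeroMono (Adj-l A)) (sym (expAt-zeroMono (Adj-r A))))

  deltaMono : Mono
  deltaMono = map +_ (reverse (applyUpTo (λ k → k) n))

  length-deltaMono : length deltaMono ≡ n
  length-deltaMono = trans (length-map +_ (reverse (applyUpTo (λ k → k) n))) (trans (length-reverse (applyUpTo (λ k → k) n)) (length-applyUpTo (λ k → k) n))

  expAt-deltaMono : ∀ {k} → In n k → expAt deltaMono k ≡ + (n ∸ k)
  expAt-deltaMono {suc k} (_ , p) = trans (cong (λ l → getE (map +_ l) k) (reverse-applyUpTo (λ k → k) n)) (go n k p)
    where
    go : ∀ n k → k < n → getE (map +_ (applyDownFrom (λ k → k) n)) k ≡ + (n ∸ suc k)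
    go (suc n) zero p = refl
    go (suc n) (suc k) (s≤s p) = go n k p

  Δ : LaurentPolynomial
  Δ = mono deltaMono length-deltaMono

  -- In x^δ the exponent of x_k is n - k and that of x_{k+1} is one less, so multiplication by
  -- x_{k+1} makes them equal.
  ∂-XΔ : ∀ {k} → Adj n k → ∂ k (X (suc k) Δ) ≈ 𝟘
  ∂-XΔ {k} A = ∂-mono-≡ (shift n (suc k) deltaMono) (length-shift (suc k) deltaMono length-deltaMono)
    (trans (trans (expAt-shift-≢ (suc k) deltaMono length-deltaMono (Adj-l A) (<⇒≢ (n<1+n k))) (expAt-deltaMono (Adj-l A)))
      (sym (trans (expAt-shift-≡ (suc k) deltaMono length-deltaMono (Adj-r A)) (trans (cong (λ x → + 1 ℤ.+ x) (expAt-deltaMono (Adj-r A)))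
        (cong +_ (sym (+-∸-assoc 1 (proj₂ A))))))))

  module _ (P : LaurentPolynomial → Set) (P-resp : ∀ {f g} → f ≈ g → P f → P g)
           (P-X : ∀ {k f} → In n k → P f → P (X k f)) (P-Y : ∀ {k f} → In n k → P f → P (Y k f)) (P-𝟙 : P 𝟙) where
    -- With the proof of the length quantified existentially, `Pᵐ` transports along equality of
    -- monomials without a comparison of proofs.
    Pᵐ : Mono → Set
    Pᵐ m = ∃ λ p → P (mono m p)

    bump : ℕ → ℤ → Mono → Mono
    bump k z m = map (λ l → (if l ≡ᵇ k then z else + 0) ℤ.+ expAt m l) (range n)

    expAt-bump : ∀ k z m {l} → In n l → expAt (bump k z m) l ≡ (if l ≡ᵇ k then z else + 0) ℤ.+ expAt m l
    expAt-bump k z m = expAt-map (λ l → (if l ≡ᵇ k then z else + 0) ℤ.+ expAt m l)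

    length-bump : ∀ k z m → length (bump k z m) ≡ n
    length-bump k z m = length-map-range _ n

    P-bump : ∀ {k m} → In n k → length m ≡ n → Pᵐ m → ∀ z → Pᵐ (bump k z m)
    P-bump {k} {m} i q r (+ zero) = subst Pᵐ (sym (mono-ext (length-bump k (+ 0) m) q λ {l} j → trans (expAt-bump k (+ 0) m j) (zero-if (l ≡ᵇ k) (expAt m l)))) r
      where
      zero-if : ∀ b x → (if b then + 0 else + 0) ℤ.+ x ≡ x
      zero-if true x = ℤ.+-identityˡ x
      zero-if false x = ℤ.+-identityˡ x
    P-bump {k} {m} i q r (+ suc z) = let (p , s) = P-bump i q r (+ z) in subst Pᵐ
        (mono-ext (length-shift k _ p) (length-bump k (+ suc z) m) λ {l} j → trans (expAt-shift k (bump k (+ z) m) p j)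
          (trans (cong (λ x → 𝟙[ l ≡ k ] ℤ.+ x) (expAt-bump k (+ z) m j)) (trans (next (l ≡ᵇ k) (expAt m l)) (sym (expAt-bump k (+ suc z) m j)))))
        (length-shift k _ p , P-X i s)
      where
      next : ∀ b x → (if b then + 1 else + 0) ℤ.+ ((if b then + z else + 0) ℤ.+ x) ≡ (if b then + suc z else + 0) ℤ.+ x
      next true x = sym (ℤ.+-assoc (+ 1) (+ z) x)
      next false x = ℤ.+-identityˡ _
    P-bump {k} {m} i q r -[1+ zero ] = subst Pᵐ
        (mono-ext (length-unshift k m q) (length-bump k -[1+ 0 ] m) λ {l} j → trans (expAt-unshift k m q j) (trans (first (l ≡ᵇ k) (expAt m l)) (sym (expAt-bump k -[1+ 0 ] m j))))
        (length-unshift k m (proj₁ r) , P-Y i (proj₂ r))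
      where
      first : ∀ b x → x ℤ.- (if b then + 1 else + 0) ≡ (if b then -[1+ 0 ] else + 0) ℤ.+ x
      first true x = ℤ.+-comm x -[1+ 0 ]
      first false x = ℤ.+-comm x (+ 0)
    P-bump {k} {m} i q r -[1+ suc z ] = let (p , s) = P-bump i q r -[1+ z ] in subst Pᵐ
        (mono-ext (length-unshift k (bump k -[1+ z ] m) p) (length-bump k -[1+ suc z ] m) λ {l} j → trans (expAt-unshift k (bump k -[1+ z ] m) p j)
          (trans (cong (ℤ._- 𝟙[ l ≡ k ]) (expAt-bump k -[1+ z ] m j)) (trans (next (l ≡ᵇ k) (expAt m l)) (sym (expAt-bump k -[1+ suc z ] m j)))))
        (length-unshift k (bump k -[1+ z ] m) p , P-Y i s)
      where
      next : ∀ b x → (if b then -[1+ z ] else + 0) ℤ.+ x ℤ.- (if b then + 1 else + 0) ≡ (if b then -[1+ suc z ] else + 0) ℤ.+ x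
      next true x = trans (ℤ.+-comm (-[1+ z ] ℤ.+ x) -[1+ 0 ]) (sym (ℤ.+-assoc -[1+ 0 ] -[1+ z ] x))
      next false x = ℤ.+-identityʳ _

    -- A stage in building m from 1 by powers of one variable at a time: the first j exponents are
    -- final, the others still 0.
    truncate : ℕ → Mono → Mono
    truncate j m = map (λ l → if l ≤ᵇ j then expAt m l else + 0) (range n)

    ≤ᵇ-false : ∀ {a b} → b < a → (a ≤ᵇ b) ≡ false
    ≤ᵇ-false {a} {b} lt with a ≤ᵇ b in eq
    ... | false = refl
    ... | true = contradiction (≤ᵇ⇒≤ a b (subst T (sym eq) tt)) (<⇒≱ lt)

    P-truncate : ∀ m j → j ≤ n → Pᵐ (truncate j m)
    P-truncate m zero le = subst Pᵐ (mono-ext length-zeroMono (length-map-range _ n) λ { {suc l} i → trans (expAt-zeroMono i)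
      (sym (expAt-map (λ l → if l ≤ᵇ 0 then expAt m l else + 0) i)) }) (length-zeroMono , P-𝟙)
    P-truncate m (suc j) le = subst Pᵐ (mono-ext (length-bump (suc j) (expAt m (suc j)) (truncate j m)) (length-map-range _ n) λ {l} i →
        trans (expAt-bump (suc j) (expAt m (suc j)) (truncate j m) i) (trans (cong (λ x → (if l ≡ᵇ suc j then expAt m (suc j) else + 0) ℤ.+ x)
          (expAt-map (λ l → if l ≤ᵇ j then expAt m l else + 0) i)) (trans (extend-by l (<-cmp l (suc j))) (sym (expAt-map (λ l → if l ≤ᵇ suc j then expAt m l else + 0) i)))))
      (P-bump (s≤s z≤n , le) (length-map-range _ n) (P-truncate m j (<⇒≤ le)) (expAt m (suc j)))
      where
      extend-by : ∀ l → Tri (l < suc j) (l ≡ suc j) (suc j < l) →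
        (if l ≡ᵇ suc j then expAt m (suc j) else + 0) ℤ.+ (if l ≤ᵇ j then expAt m l else + 0) ≡ (if l ≤ᵇ suc j then expAt m l else + 0)
      extend-by l (tri< lt ne _) rewrite ≢⇒≡ᵇ ne | ≤⇒≤ᵇ≡ (s≤s⁻¹ lt) | ≤⇒≤ᵇ≡ (<⇒≤ lt) = ℤ.+-identityˡ _
      extend-by _ (tri≈ _ refl _) rewrite ≡ᵇ-refl j | ≤ᵇ-false (n<1+n j) | ≤⇒≤ᵇ≡ (≤-refl {suc j}) = ℤ.+-identityʳ _
      extend-by l (tri> _ ne gt) rewrite ≢⇒≡ᵇ ne | ≤ᵇ-false gt | ≤ᵇ-false (<-trans (n<1+n j) gt) = refl

    P-mono : ∀ m p → P (mono m p)
    P-mono m p = P-resp (mono-cong {p = proj₁ (P-truncate m n ≤-refl)} (mono-ext (length-map-range _ n) p λ {l} i →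
      trans (expAt-map (λ l → if l ≤ᵇ n then expAt m l else + 0) i) (cong (λ b → if b then expAt m l else + 0) (≤⇒≤ᵇ≡ (proj₂ i))))) (proj₂ (P-truncate m n ≤-refl))

  generated : (P : LaurentPolynomial → Set) → (∀ {f g} → f ≈ g → P f → P g) → P 𝟘 → (∀ {f g} → P f → P g → P (f ⊕ g)) →
    (∀ c {f} → P f → P (c · f)) → P 𝟙 → (∀ {k f} → In n k → P f → P (X k f)) → (∀ {k f} → In n k → P f → P (Y k f)) → ∀ f → P f
  generated P P-resp P-𝟘 P-⊕ P-· P-𝟙 P-X P-Y = go
    where
    go : ∀ f → P f
    go (laurent [] []) = P-𝟘
    go (laurent ((c , m) ∷ q) (p ∷ u)) = P-resp (≈-sym (split-term c m p q u)) (P-⊕ (P-· c (P-mono P P-resp P-X P-Y P-𝟙 m p)) (go (laurent q u)))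

  laurentAlgebra : LaurentAlgebra n
  laurentAlgebra = record
    { formalModule = formalModule
    ; 𝟙 = 𝟙
    ; Δ = Δ
    ; X = X
    ; Y = Y
    ; ∂ = ∂
    ; X-linear = X-linear
    ; Y-linear = Y-linear
    ; ∂-linear = ∂-linear
    ; XY = XY
    ; YX = YX
    ; X-comm = X-comm
    ; ∂-𝟙 = ∂-𝟙
    ; ∂-Xˡ = ∂-Xˡ
    ; ∂-Xʳ = ∂-Xʳ
    ; ∂-Xᵒ = λ A → ∂-Xᵒ A
    ; ∂-XΔ = ∂-XΔ
    ; generated = generated
    }

-- Agreement with the polynomials and sums of the statement

module Comparison (n : ℕ) where
  open Laurent n
  open LaurentAlgebra laurentAlgebra using (at; coef)
  open Sums laurentAlgebra
  open Expansions laurentAlgebra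

  poly-GF : ∀ β f v → poly (Grothendieck.GF laurentAlgebra β f v) ≡ grothF n β f v
  poly-GF β zero v = refl
  poly-GF β (suc f) v with firstAscent n v
  ... | nothing = refl
  ... | just k = cong (concatMap (NiTerm k)) (cong₂ _++_ (poly-GF β f (mulS v k)) (linear-term (poly-GF β f (mulS v k))))
    where
    linear-term : ∀ {p q} → p ≡ q → scaleP β (concatMap (λ (c , m) → [ (c , shift n (suc k) m) ]) p) ≡ polyMul [ (β , varMono n (suc k)) ] q
    linear-term {p} refl = trans (cong (scaleP β) (concatMap-[] _ p)) (trans (sym (map-∘ p)) (sym (++-identityʳ _)))

  -- In contrast to `poly-GF` only the coefficients agree: at β = 0 the operator θ appends terms
  -- with coefficient 0, which the list `schubF` does not contain.
  coef-GF₀ : ∀ f v e → coeff (poly (G₀.GF f v)) e ≡ coeff (schubF n f v) e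
  coef-GF₀ zero v e = refl
  coef-GF₀ (suc f) v e with firstAscent n v
  ... | nothing = refl
  ... | just k = trans (at (π₀≈∂ k (G₀.GF f (mulS v k))) e)
    (LinearKernel.concatMap-cong (NiTerm-kernel k) (poly (G₀.GF f (mulS v k))) (schubF n f (mulS v k)) (coef-GF₀ f (mulS v k)) e)

  coef-groth : ∀ β v e → coeff (poly (Grothendieck.G laurentAlgebra β v)) e ≡ coeff (groth n β v) e
  coef-groth β v e = cong (λ p → coeff p e) (poly-GF β (n * n + 1) v)

  coef-Σ : ∀ {B : Set} (h : B → LaurentPolynomial) (q : B → Poly) → (∀ x e → coef (h x) e ≡ coeff (q x) e) →
    ∀ xs e → coef (Σ h xs) e ≡ coeff (concatMap q xs) e
  coef-Σ h q eq [] e = refl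
  coef-Σ h q eq (x ∷ xs) e = trans (coeff-++ (poly (h x)) (poly (Σ h xs)) e)
    (trans (cong₂ ℤ._+_ (eq x e) (coef-Σ h q eq xs e)) (sym (coeff-++ (q x) (concatMap q xs) e)))

  invMono : Mono → List ℕ → Mono
  invMono = foldr (unshift n)

  length-invMono : ∀ {m} → length m ≡ n → ∀ p → length (invMono m p) ≡ n
  length-invMono q [] = q
  length-invMono q (i ∷ p) = length-unshift i (invMono _ p) (length-invMono q p)

  poly-inverse-weight : ∀ p → poly (inverse-weight p) ≡ [ (+ 1 , invMono deltaMono p) ]
  poly-inverse-weight [] = refl
  poly-inverse-weight (i ∷ p) = cong (concatMap (λ (c , m) → [ (c , unshift n i m) ])) (poly-inverse-weight p)

  delta-invMono : ∀ p → zipWith ℤ._+_ deltaMono (invMono (zeroMono n) p) ≡ invMono deltaMono p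
  delta-invMono p = mono-ext (length-sum p) (length-invMono length-deltaMono p) (λ i → exponents p i)
    where
    length-sum : ∀ p → length (zipWith ℤ._+_ deltaMono (invMono (zeroMono n) p)) ≡ n
    length-sum p = trans (length-zipWith-≡ ℤ._+_ deltaMono (invMono (zeroMono n) p) (trans length-deltaMono (sym (length-invMono length-zeroMono p)))) (length-invMono length-zeroMono p)
    expAt-sum : ∀ p {k} → In n k → expAt (zipWith ℤ._+_ deltaMono (invMono (zeroMono n) p)) k ≡ expAt deltaMono k ℤ.+ expAt (invMono (zeroMono n) p) k
    expAt-sum p i = expAt-zipWith ℤ._+_ deltaMono (invMono (zeroMono n) p) length-deltaMono (length-invMono length-zeroMono p) i
    exponents : ∀ p {k} → In n k → expAt (zipWith ℤ._+_ deltaMono (invMono (zeroMono n) p)) k ≡ expAt (invMono deltaMono p) k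
    exponents [] {k} i = trans (expAt-sum [] i) (trans (cong (λ x → expAt deltaMono k ℤ.+ x) (expAt-zeroMono i)) (ℤ.+-identityʳ _))
    exponents (j ∷ p) {k} i = trans (expAt-sum (j ∷ p) i)
      (trans (cong (λ x → expAt deltaMono k ℤ.+ x) (expAt-unshift j (invMono (zeroMono n) p) (length-invMono length-zeroMono p) i))
        (trans (sym (ℤ.+-assoc (expAt deltaMono k) (expAt (invMono (zeroMono n) p) k) (- 𝟙[ k ≡ j ])))
          (trans (cong (ℤ._- 𝟙[ k ≡ j ]) (trans (sym (expAt-sum p i)) (exponents p i)))
            (sym (expAt-unshift j (invMono deltaMono p) (length-invMono length-deltaMono p) i)))))

  inverse-weights : ∀ ps → concatMap (λ p → [ (+ 1 , invMono deltaMono p) ]) ps ≡ polyMul (deltaPoly n) (sumInvWt n ps)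
  inverse-weights [] = refl
  inverse-weights (p ∷ ps) = cong₂ _∷_ (cong (+ 1 ,_) (sym (delta-invMono p))) (inverse-weights ps)

  coef-inverse-weights : ∀ ps e → coef (Σ inverse-weight ps) e ≡ coeff (polyMul (deltaPoly n) (sumInvWt n ps)) e
  coef-inverse-weights ps e = trans (coef-Σ inverse-weight (λ p → [ (+ 1 , invMono deltaMono p) ]) (λ p e → cong (λ q → coeff q e) (poly-inverse-weight p)) ps e)
    (cong (λ q → coeff q e) (inverse-weights ps))

theorem6p7 : (n : ℕ) → 1 ≤ n → (w : List ℕ) → w ↭ range n →
    (groth n (+ 1) w ≈P polyMul (deltaPoly n) (sumInvWt n (paths 𝒢bar n w)))
    × (schub n w ≈P polyMul (deltaPoly n) (sumInvWt n (paths 𝒢 n w)))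
    × (groth n (+ 1) w ≈P concatMap (λ p → schub n (mulPerm (w0 n) (dem n (word p))))
    (filterB (λ p → isReduced n (word p)) (paths ℛ n w)))
    × (schub n w ≈P concatMap (λ p → groth n (- (+ 1)) (mulPerm (w0 n) (dem n (word p))))
    (paths 𝒢 n w))
theorem6p7 n _ w w↭ =
    (λ e → trans (sym (coef-groth (+ 1) w e)) (trans (at (grothendieck-paths W) e) (coef-inverse-weights (paths 𝒢bar n w) e)))
  , (λ e → trans (sym (coef-GF₀ (n * n + 1) w e)) (trans (at (schubert-paths W) e) (coef-inverse-weights (paths 𝒢 n w) e)))
  , (λ e → trans (sym (coef-groth (+ 1) w e)) (trans (at (grothendieck-to-schubert W) e)
      (coef-Σ schubertSummand _ (λ p → coef-GF₀ (n * n + 1) (dual (dem n (word p)))) (filterB (λ p → isReduced n (word p)) (paths ℛ n w)) e)))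
  , (λ e → trans (sym (coef-GF₀ (n * n + 1) w e)) (trans (at (schubert-to-grothendieck W) e)
      (coef-Σ grothendieckSummand _ (λ p → coef-groth -[1+ 0 ] (dual (dem n (word p)))) (paths 𝒢 n w) e)))
  where
  open Laurent n
  open LaurentAlgebra laurentAlgebra using (at)
  open Expansions laurentAlgebra
  open Comparison n
  W : IsPerm n w
  W = ↭-range⇒IsPerm w↭
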